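{- For every $n\ge1$, the number $\#AP_n$ of domino tilings of the Aztec pillow $AP_n$ is $$\#AP_n=\det\begin{bmatrix} S_n & I_n\\ -I_n & J_nS_nJ_n\end{bmatrix},$$ where $S_n$ is the $n\times n$ leading principal submatrix of the infinite upper-triangular array $S=(s_{i,j})_{i,j\ge0}$ of modified Schröder numbers and $J_n$ is the $n\times n$ exchange matrix.
   Context: The Aztec pillow $AP_n$ is the region in the plane formed by the unit squares whose vertices are integral points $(x,y)$ with $|x+y|\le n+1$ and $|3y-x|\le n+3$. It is symmetric under rotation by $180^\circ$, has $2n$ squares in each of its two central rows, and on its top left boundary the steps have three squares to the right for every square up. A domino tiling is a tiling by $1\times2$ and $2\times1$ rectangles made of two unit squares. Modified Schröder numbers: for $0\le i\le j$, $s_{i,j}$ is the number of lattice paths from $(i,i)$ to $(j,j)$ using steps $(0,1)$, $(1,0)$, $(1,1)$ that pass neither above the line $y=x$ nor below the line $y=x/2$; $s_{i,j}=0$ for $i>j$. Thus $S_n=(s_{i,j})_{0\le i,j\le n-1}$; for example $$S_4=\begin{bmatrix}1&1&2&5\\0&1&2&5\\0&0&1&2\\0&0&0&1\end{bmatrix}.$$ The exchange matrix $J_n$ has $1$'s on the skew-diagonal and $0$'s elsewhere. -}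

module Defs where

open import Data.Bool using (Bool; T; if_then_else_)
open import Data.Fin using (Fin; zero; suc; toℕ; opposite; punchIn)
import Data.Fin.Properties as Fin
open import Data.Integer as ℤ using (ℤ; +_; -_; ∣_∣; 0ℤ; 1ℤ; -1ℤ)
import Data.Integer.Properties as ℤ
open import Data.List using (List; []; _∷_; concatMap; cartesianProductWith; filter; length; upTo)
open import Data.Nat as ℕ using (ℕ; zero; suc; _≤_)
import Data.Nat.Properties as ℕ
open import Data.Product using (_×_; _,_; ∃!)
open import Data.Product.Properties using (≡-dec)
open import Data.Sum using (_⊎_)
open import Data.Vec.Functional using (Vector; _++_; zipWith)
open import Function.Bundles using (Inverse)
open import Level using (0ℓ)
open import Relation.Binary.Bundles using (Setoid)
import Relation.Binary.Construct.On as On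
open import Relation.Binary.PropositionalEquality using (_≡_; setoid; _→-setoid_)
open import Relation.Nullary using (Dec; does; _×-dec_)
open import Algebra.Properties.CommutativeMonoid.Sum ℤ.+-0-commutativeMonoid using (sum)

infix 4 _HasCardinality_

_HasCardinality_ : Setoid 0ℓ 0ℓ → ℕ → Set
A HasCardinality k = Inverse A (setoid (Fin k))

------------------------------------------------------------------------
-- Aztec pillows and domino tilings

-- (x , y) stands for the unit square [x , x + 1] × [y , y + 1].
Cell : Set
Cell = ℤ × ℤ

AllowedVertex : ℕ → ℤ → ℤ → Set
AllowedVertex n x y = (∣ x ℤ.+ y ∣ ≤ n ℕ.+ 1) × (∣ + 3 ℤ.* y ℤ.- x ∣ ≤ n ℕ.+ 3)

InAP : ℕ → Cell → Set
InAP n (x , y) =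
  AllowedVertex n x y × AllowedVertex n (x ℤ.+ 1ℤ) y ×
  AllowedVertex n x (y ℤ.+ 1ℤ) × AllowedVertex n (x ℤ.+ 1ℤ) (y ℤ.+ 1ℤ)

-- A domino is given by its left (horizontal) or lower (vertical) square.
data Domino : Set where
  horizontal vertical : Cell → Domino

Covers : Domino → Cell → Set
Covers (horizontal (x , y)) c = c ≡ (x , y) ⊎ c ≡ (x ℤ.+ 1ℤ , y)
Covers (vertical   (x , y)) c = c ≡ (x , y) ⊎ c ≡ (x , y ℤ.+ 1ℤ)

record Tiling (n : ℕ) : Set where
  field
    -- Indicator function of the set of dominoes used.
    uses   : Domino → Bool
    inside : ∀ d → T (uses d) → ∀ c → Covers d c → InAP n c
    tiles  : ∀ c → InAP n c → ∃! _≡_ λ d → T (uses d) × Covers d c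

-- Two tilings are identified when they use the same dominoes.
tilings : ℕ → Setoid 0ℓ 0ℓ
tilings n = On.setoid (Domino →-setoid Bool) (Tiling.uses {n})

------------------------------------------------------------------------
-- Modified Schröder numbers

Point : Set
Point = ℕ × ℕ

data Step : Set where
  north east diagonal : Step

move : Step → Point → Point
move north    (x , y) = x , suc y
move east     (x , y) = suc x , y
move diagonal (x , y) = suc x , suc y

-- The region y ≤ x, y ≥ x / 2 is convex, so a path stays in it as soon as
-- its vertices do.
Admissible : Point → Set
Admissible (x , y) = y ≤ x × x ≤ 2 ℕ.* y

admissible? : ∀ p → Dec (Admissible p)
admissible? (x , y) = y ℕ.≤? x ×-dec x ℕ.≤? 2 ℕ.* y

IsPath : Point → Point → List Step → Set
IsPath p q []      = Admissible p × p ≡ q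
IsPath p q (a ∷ w) = Admissible p × IsPath (move a p) q w

isPath? : ∀ p q w → Dec (IsPath p q w)
isPath? p q []      = admissible? p ×-dec ≡-dec ℕ._≟_ ℕ._≟_ p q
isPath? p q (a ∷ w) = admissible? p ×-dec isPath? (move a p) q w

words : ℕ → List (List Step)
words zero    = [] ∷ []
words (suc k) = cartesianProductWith _∷_ (north ∷ east ∷ diagonal ∷ []) (words k)

-- Every step increases x + y by at least 1, so a path from (i , i) to (j , j)
-- has at most 2 (j ∸ i) steps: the filtered list contains all paths, each once.
-- It is empty when j < i.
s : ℕ → ℕ → ℕ
s i j = length (filter (isPath? (i , i) (j , j))
                       (concatMap words (upTo (suc (2 ℕ.* (j ℕ.∸ i))))))

------------------------------------------------------------------------
-- Integer matrices

Matrix : ℕ → ℕ → Set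
Matrix m n = Vector (Vector ℤ n) m

infixl 7 _·_

_·_ : ∀ {l m n} → Matrix l m → Matrix m n → Matrix l n
(A · B) i k = sum λ j → A i j ℤ.* B j k

neg : ∀ {m n} → Matrix m n → Matrix m n
neg A i j = - A i j

-- Laplace expansion along the first row.
det : ∀ {n} → Matrix n n → ℤ
det {zero}  A = 1ℤ
det {suc n} A =
  sum λ j → -1ℤ ℤ.^ toℕ j ℤ.* A zero j ℤ.* det (λ i k → A (suc i) (punchIn j k))

-- block A B C D is the matrix with rows [ A B ] and [ C D ].
block : ∀ {k l m n} → Matrix k m → Matrix k n → Matrix l m → Matrix l n →
        Matrix (k ℕ.+ l) (m ℕ.+ n)
block A B C D = zipWith _++_ A B ++ zipWith _++_ C D

I : ∀ n → Matrix n n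
I n i j = if does (i Fin.≟ j) then 1ℤ else 0ℤ

J : ∀ n → Matrix n n
J n i j = if does (i Fin.≟ opposite j) then 1ℤ else 0ℤ

S : ∀ n → Matrix n n
S n i j = + s (toℕ i) (toℕ j)

{-# OPTIONS --safe #-}
-- Tile the pillow row by row. Each cell of a row carries a vector, the cells are coloured
-- alternately, and a set of cells is sent to the wedge product of the vectors of its white cells
-- and of the black cells outside it. On such wedge products the transfer from one row to the
-- next acts through a linear map of the vectors: the terms that would spoil this contain some
-- vector twice. Hence the tilings of the lower half, with the set p of cells left in its
-- neighbouring row weighted by the wedge product of p, add up to a wedge product of n vectors
-- c 0, c 1, ..., and a last-return decomposition of paths identifies these vectors as
-- w j + Σ s i j b i, up to signs and unitriangular operations (w and b being the vectors of the
-- neighbouring row).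
--
-- The upper half is the lower half rotated by 180°. Choose the vectors for the second half to be,
-- up to sign, those of the first in reverse order. Then the two wedge products of p and of q
-- pair to 1 if the halves fit together and to 0 otherwise. So the number of tilings is the wedge
-- product of all 2 n vectors c, that is, the determinant of the block matrix.

module Submission where

open import Defs
open import Data.Bool using (Bool; true; false; T; not; _∧_; _∨_; _xor_; if_then_else_)
import Data.Bool.Properties as Bool
open import Data.Empty using (⊥; ⊥-elim)
open import Data.Fin using (Fin; zero; suc; toℕ; opposite; punchIn; splitAt; join; _↑ˡ_; _↑ʳ_)
import Data.Fin.Properties as Fin
open import Data.Integer as ℤ using (ℤ; +_; -[1+_]; -_; _+_; _*_; _-_; 0ℤ; 1ℤ; -1ℤ; ∣_∣)
import Data.Integer.Properties as ℤ
open import Algebra.Properties.CommutativeMonoid.Sum ℤ.+-0-commutativeMonoid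
  using (sum; sum-cong-≗; ∑-distrib-+; ∑-comm; sum-replicate-zero)
open import Algebra.Properties.Semiring.Sum ℤ.+-*-semiring using (*-distribˡ-sum; *-distribʳ-sum)
open import Data.Integer.Tactic.RingSolver using (solve-∀)
open import Data.List using (List; []; _∷_; length; concatMap; filter; applyUpTo; applyDownFrom; upTo)
  renaming (_++_ to _⧺_; map to mapᴸ; reverse to reverseᴸ)
import Data.List.Properties as List
open import Data.Nat as ℕ using (ℕ; zero; suc; _≤_; z≤n; s≤s)
import Data.Nat.Properties as ℕ
open import Data.Product using (Σ; ∃-syntax; ∃!; _×_; _,_; proj₁; proj₂)
open import Data.Product.Properties using (≡-dec)
open import Data.Sum using (_⊎_; inj₁; inj₂; [_,_]′)
open import Data.Sum.Function.Setoid using (_⊎-inverse_)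
open import Data.Sum.Relation.Binary.Pointwise using (inj₁; inj₂; _⊎ₛ_; Pointwise-≡↔≡)
open import Data.Unit using (tt)
open import Data.Vec using (Vec; []; _∷_; _∷ʳ_; replicate; zipWith; reverse; init; head; tail; lookup; tabulate; toList)
import Data.Vec.Properties as Vec
open import Function using (_∘_; id)
open import Function.Bundles using (Inverse)
import Function.Construct.Composition as Composition
import Function.Construct.Symmetry as Symmetry
open import Level using (0ℓ)
open import Relation.Binary.Bundles using (Setoid)
import Relation.Binary.Construct.On as On
open import Relation.Binary.PropositionalEquality
  using (_≡_; _≢_; refl; sym; trans; cong; cong₂; subst; _→-setoid_; setoid; module ≡-Reasoning)
open import Relation.Nullary using (¬_; Dec; yes; no; does; contradiction)
open import Relation.Nullary.Decidable using (map′; dec-true; dec-false)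
open import Data.Nat.Tactic.RingSolver using () renaming (solve-∀ to ℕ-solve-∀)

-- Counting tilings of regions

-- No exterior algebra is built: wedge products occur only inside an arbitrary alternating form `D`
-- on lists, and fixing factors means prefixing or appending vectors to the argument of `D`. The
-- induction over rows is for all such forms at once; the determinant enters at the end.
--
-- The Schröder numbers come from the margins of the rows. A row overhangs the row below by one cell
-- on the left and three on the right. The odd shift swaps the colours: the new `w j` comes from
-- position `b (j + 2)`, the new `b j` from `w (j + 1)`, and two margin cells supply the remaining
-- two factors. The columns then satisfy `c⁺ j = c (j + 2) - c (j + 1) - Σ s k j c (k +
-- 1)`, which expresses the recurrence `s i (j + 2) = [i = j + 2] + s i (j + 1) + Σ s i (k + 1) s k
-- j`. The signs `σ j` turn the minus signs that would otherwise stand in this recurrence into plus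
-- signs.
--
-- The sign of sorting the vectors occurs on both sides of the final identity, so it cancels and is
-- never computed.

i<i+1 : ∀ i → i ℤ.< i + 1ℤ
i<i+1 i = subst (ℤ._< i + 1ℤ) (ℤ.+-identityʳ i) (ℤ.+-monoʳ-< i (ℤ.+<+ (s≤s z≤n)))

-- Placing dominoes one by one leaves regions that are no pillows, so tilings are needed for
-- arbitrary sets of cells.
record TilingOf (R : Cell → Set) : Set where
  field
    uses   : Domino → Bool
    inside : ∀ d → T (uses d) → ∀ c → Covers d c → R c
    tiles  : ∀ c → R c → ∃! _≡_ λ d → T (uses d) × Covers d c

open TilingOf

tilingsOf : (Cell → Set) → Setoid 0ℓ 0ℓ
tilingsOf R = On.setoid (Domino →-setoid Bool) (uses {R})

tilingsWith : (Cell → Set) → Domino → Setoid 0ℓ 0ℓ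
tilingsWith R d =
  On.setoid (Domino →-setoid Bool) (λ (t : Σ (TilingOf R) λ t → T (uses t d)) → uses (proj₁ t))

-- The cardinality is compared with an integer because the counts are later rewritten as values of
-- alternating forms.
HasCount : Setoid 0ℓ 0ℓ → ℤ → Set
HasCount A z = ∃[ k ] (A HasCardinality k) × (+ k ≡ z)

Count : (Cell → Set) → ℤ → Set
Count R = HasCount (tilingsOf R)

count-↔ : ∀ {A B z} → Inverse A B → HasCount B z → HasCount A z
count-↔ i (k , j , eq) = k , Composition.inverse i j , eq

count-empty : ∀ {A : Setoid 0ℓ 0ℓ} → ¬ Setoid.Carrier A → HasCount A 0ℤ
count-empty e = 0 , record
  { to        = λ a → ⊥-elim (e a)
  ; from      = λ ()
  ; to-cong   = λ {a} → ⊥-elim (e a)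
  ; from-cong = λ { {()} }
  ; inverse   = (λ { {()} }) , λ {a} → ⊥-elim (e a)
  } , refl

count-⊎ : ∀ {A B u v} → HasCount A u → HasCount B v → HasCount (A ⊎ₛ B) (u + v)
count-⊎ (k , i , refl) (l , j , refl) =
  k ℕ.+ l ,
  Composition.inverse (i ⊎-inverse j)
    (Composition.inverse (Pointwise-≡↔≡ _ _) (Symmetry.inverse Fin.+↔⊎)) ,
  refl

infix 4 _≐_
_≐_ : (P Q : Cell → Set) → Set
P ≐ Q = (∀ c → P c → Q c) × (∀ c → Q c → P c)

transport : ∀ {P Q} → P ≐ Q → TilingOf P → TilingOf Q
transport (f , g) t .uses = uses t
transport (f , g) t .inside d u c cov = f c (inside t d u c cov)
transport (f , g) t .tiles c q = tiles t c (g c q)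

count-cong : ∀ {P Q z} → P ≐ Q → Count P z → Count Q z
count-cong (f , g) = count-↔ record
  { to        = transport (g , f)
  ; from      = transport (f , g)
  ; to-cong   = id
  ; from-cong = id
  ; inverse   = id , id
  }

infix 4 _≟ᶜ_ _≟ᵈ_

_≟ᶜ_ : (c c′ : Cell) → Dec (c ≡ c′)
_≟ᶜ_ = ≡-dec ℤ._≟_ ℤ._≟_

_≟ᵈ_ : (d e : Domino) → Dec (d ≡ e)
horizontal c ≟ᵈ horizontal c′ = map′ (cong horizontal) (λ { refl → refl }) (c ≟ᶜ c′)
horizontal c ≟ᵈ vertical c′   = no λ ()
vertical c   ≟ᵈ horizontal c′ = no λ ()
vertical c   ≟ᵈ vertical c′   = map′ (cong vertical) (λ { refl → refl }) (c ≟ᶜ c′)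

covers? : ∀ d c → Dec (Covers d c)
covers? (horizontal (x , y)) c with c ≟ᶜ (x , y) | c ≟ᶜ (x + 1ℤ , y)
... | yes p | _     = yes (inj₁ p)
... | no ¬p | yes q = yes (inj₂ q)
... | no ¬p | no ¬q = no [ ¬p , ¬q ]′
covers? (vertical (x , y)) c with c ≟ᶜ (x , y) | c ≟ᶜ (x , y + 1ℤ)
... | yes p | _     = yes (inj₁ p)
... | no ¬p | yes q = yes (inj₂ q)
... | no ¬p | no ¬q = no [ ¬p , ¬q ]′

anchor : Domino → Cell
anchor (horizontal c) = c
anchor (vertical c)   = c

covers-anchor : ∀ d → Covers d (anchor d)
covers-anchor (horizontal c) = inj₁ refl
covers-anchor (vertical c)   = inj₁ refl

infixl 6 _∖_
_∖_ : (Cell → Set) → Domino → Cell → Set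
(R ∖ d) c = R c × ¬ Covers d c

T-∧ : ∀ {a b} → T a → T b → T (a ∧ b)
T-∧ {true} {true} _ _ = tt

T-∧ˡ : ∀ {a b} → T (a ∧ b) → T a
T-∧ˡ {true} _ = tt

T-∧ʳ : ∀ {a b} → T (a ∧ b) → T b
T-∧ʳ {true} p = p

T-∨ : ∀ {a b} → T (a ∨ b) → T a ⊎ T b
T-∨ {true}  _ = inj₁ tt
T-∨ {false} p = inj₂ p

T-∨ˡ : ∀ {a b} → T a → T (a ∨ b)
T-∨ˡ {true} _ = tt

T-∨ʳ : ∀ {a b} → T b → T (a ∨ b)
T-∨ʳ {true}  _ = tt
T-∨ʳ {false} p = p

T-does : ∀ {A : Set} (a? : Dec A) → T (does a?) → A
T-does (yes a) _ = a

does-T : ∀ {A : Set} (a? : Dec A) → A → T (does a?)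
does-T (yes _) _ = tt
does-T (no ¬a) a = ¬a a

T-not : ∀ {A : Set} (a? : Dec A) → T (not (does a?)) → ¬ A
T-not (no ¬a) _ = ¬a

not-T : ∀ {A : Set} (a? : Dec A) → ¬ A → T (not (does a?))
not-T (yes a) ¬a = ¬a a
not-T (no _)  _  = tt

module _ {R : Cell → Set} (d : Domino) where

  remove : (t : TilingOf R) → T (uses t d) → TilingOf (R ∖ d)
  remove t ud .uses e = uses t e ∧ not (does (e ≟ᵈ d))
  remove t ud .inside e u c cov =
    inside t e (T-∧ˡ u) c cov , λ cov′ →
      let (_ , _ , unique) = tiles t c (inside t d ud c cov′) in
      T-not (e ≟ᵈ d) (T-∧ʳ {uses t e} u)
        (trans (sym (unique (T-∧ˡ u , cov))) (unique (ud , cov′)))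
  remove t ud .tiles c (r , ¬cov) =
    let (e , (u , cov) , unique) = tiles t c r in
    e , (T-∧ u (not-T (e ≟ᵈ d) λ { refl → ¬cov cov }) , cov) ,
    λ { (u′ , cov′) → unique (T-∧ˡ u′ , cov′) }

  add : (∀ c → Covers d c → R c) → TilingOf (R ∖ d) → TilingOf R
  add d⊆R t .uses e = uses t e ∨ does (e ≟ᵈ d)
  add d⊆R t .inside e u c cov with T-∨ {uses t e} u
  ... | inj₁ u′ = proj₁ (inside t e u′ c cov)
  ... | inj₂ p with refl ← T-does (e ≟ᵈ d) p = d⊆R c cov
  add d⊆R t .tiles c r with covers? d c
  ... | yes cov = d , (T-∨ʳ {uses t d} (does-T (d ≟ᵈ d) refl) , cov) , unique
    where
    unique : ∀ {e} → T (uses t e ∨ does (e ≟ᵈ d)) × Covers e c → d ≡ e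
    unique {e} (u , cov′) with T-∨ {uses t e} u
    ... | inj₁ u′ = contradiction cov (proj₂ (inside t e u′ c cov′))
    ... | inj₂ p  = sym (T-does (e ≟ᵈ d) p)
  ... | no ¬cov =
    let (e , (u , cov) , unique) = tiles t c (r , ¬cov) in
    e , (T-∨ˡ u , cov) , λ {e′} → λ { (u′ , cov′) →
      [ (λ u″ → unique (u″ , cov′))
      , (λ p → contradiction (subst (λ e → Covers e c) (T-does (e′ ≟ᵈ d) p) cov′) ¬cov)
      ]′ (T-∨ {uses t e′} u′) }

  count-with : ∀ {z} → (∀ c → Covers d c → R c) → Count (R ∖ d) z →
               HasCount (tilingsWith R d) z
  count-with d⊆R = count-↔ record
    { to        = λ { (t , u) → remove t u }
    ; from      = λ t → add d⊆R t , T-∨ʳ {uses t d} (does-T (d ≟ᵈ d) refl)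
    ; to-cong   = λ t≈t′ e → cong (_∧ _) (t≈t′ e)
    ; from-cong = λ t≈t′ e → cong (_∨ _) (t≈t′ e)
    ; inverse   = (λ {t} {t′} t′≈ e → trans (cong (_∧ _) (t′≈ e)) (remove-add t e))
                , (λ { {t , u} {t′} t′≈ e → trans (cong (_∨ _) (t′≈ e)) (add-remove t u e) })
    }
    where
    remove-add : ∀ t e → (uses t e ∨ does (e ≟ᵈ d)) ∧ not (does (e ≟ᵈ d)) ≡ uses t e
    remove-add t e with e ≟ᵈ d
    ... | no _ = trans (Bool.∧-identityʳ _) (Bool.∨-identityʳ _)
    ... | yes refl with uses t d in eq
    ...   | false = refl
    ...   | true  = contradiction (covers-anchor d)
                      (proj₂ (inside t d (subst T (sym eq) tt) _ (covers-anchor d)))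
    add-remove : ∀ t → T (uses t d) → ∀ e →
                 (uses t e ∧ not (does (e ≟ᵈ d))) ∨ does (e ≟ᵈ d) ≡ uses t e
    add-remove t u e with e ≟ᵈ d
    ... | no _ = trans (Bool.∨-identityʳ _) (Bool.∧-identityʳ _)
    ... | yes refl with uses t d
    ...   | true = refl

  count-without : ∀ c → Covers d c → ¬ R c → HasCount (tilingsWith R d) 0ℤ
  count-without c cov ¬r = count-empty λ { (t , u) → ¬r (inside t d u c cov) }

-- The cell (x , y) is lowest and then leftmost in R, so the domino covering it starts there.
module _ {R : Cell → Set} {x y : ℤ} (here : R (x , y))
         (first : ∀ c → R c → y ℤ.≤ proj₂ c × (proj₂ c ≡ y → x ℤ.≤ proj₁ c)) where

  private
    H V : Domino
    H = horizontal (x , y)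
    V = vertical (x , y)

  H-or-V : (t : TilingOf R) → T (uses t H) ⊎ T (uses t V)
  H-or-V t with tiles t (x , y) here
  ... | horizontal _ , (u , inj₁ refl) , _ = inj₁ u
  ... | vertical _   , (u , inj₁ refl) , _ = inj₂ u
  ... | horizontal c , (u , inj₂ refl) , _ =
    contradiction (proj₂ (first c (inside t _ u c (inj₁ refl))) refl) (ℤ.<⇒≱ (i<i+1 _))
  ... | vertical c   , (u , inj₂ refl) , _ =
    contradiction (proj₁ (first c (inside t _ u c (inj₁ refl)))) (ℤ.<⇒≱ (i<i+1 _))

  not-H-and-V : (t : TilingOf R) → T (uses t H) → T (uses t V) → ⊥
  not-H-and-V t uH uV =
    let (_ , _ , unique) = tiles t (x , y) here in
    contradiction (trans (sym (unique (uH , inj₁ refl))) (unique (uV , inj₁ refl))) λ ()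

  private
    Carrier = Setoid.Carrier

    classify : (t : TilingOf R) → T (uses t H) ⊎ T (uses t V) →
               Carrier (tilingsWith R H ⊎ₛ tilingsWith R V)
    classify t (inj₁ u) = inj₁ (t , u)
    classify t (inj₂ u) = inj₂ (t , u)

    forget : Carrier (tilingsWith R H ⊎ₛ tilingsWith R V) → TilingOf R
    forget (inj₁ (t , _)) = t
    forget (inj₂ (t , _)) = t

    -- `H-or-V` reads the proof components of a tiling, whereas equality sees only the indicator
    -- function. If equal tilings were classified differently, one of them would use both `H` and
    -- `V`.
    classify-cong : ∀ {t t′} o o′ → (∀ d → uses t d ≡ uses t′ d) →
      Setoid._≈_ (tilingsWith R H ⊎ₛ tilingsWith R V) (classify t o) (classify t′ o′)
    classify-cong (inj₁ _) (inj₁ _) t≈ = inj₁ t≈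
    classify-cong (inj₂ _) (inj₂ _) t≈ = inj₂ t≈
    classify-cong {t} {t′} (inj₁ u) (inj₂ v) t≈ =
      ⊥-elim (not-H-and-V t u (subst T (sym (t≈ V)) v))
    classify-cong {t} {t′} (inj₂ u) (inj₁ v) t≈ =
      ⊥-elim (not-H-and-V t (subst T (sym (t≈ H)) v) u)

    classify-forget : ∀ a t o → (∀ d → uses t d ≡ uses (forget a) d) →
      Setoid._≈_ (tilingsWith R H ⊎ₛ tilingsWith R V) (classify t o) a
    classify-forget (inj₁ (t′ , u)) t o = classify-cong o (inj₁ u)
    classify-forget (inj₂ (t′ , u)) t o = classify-cong o (inj₂ u)

    forget-classify : ∀ t o → forget (classify t o) ≡ t
    forget-classify t (inj₁ _) = refl
    forget-classify t (inj₂ _) = refl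

    forget-cong : ∀ {a b} → Setoid._≈_ (tilingsWith R H ⊎ₛ tilingsWith R V) a b →
                  ∀ d → uses (forget a) d ≡ uses (forget b) d
    forget-cong (inj₁ p) = p
    forget-cong (inj₂ p) = p

  count-split : ∀ {u v} → HasCount (tilingsWith R H) u → HasCount (tilingsWith R V) v →
                Count R (u + v)
  count-split cH cV = count-↔ record
    { to        = λ t → classify t (H-or-V t)
    ; from      = forget
    ; to-cong   = λ {t} {t′} → classify-cong (H-or-V t) (H-or-V t′)
    ; from-cong = forget-cong
    ; inverse   = (λ {a} {t} → classify-forget a t (H-or-V t))
                , (λ {t} {a} a≈ d → trans (forget-cong a≈ d)
                     (cong (λ t → uses t d) (forget-classify t (H-or-V t))))
    } (count-⊎ cH cV)

count-∅ : ∀ {R} → (∀ c → ¬ R c) → Count R 1ℤ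
count-∅ {R} e = 1 , record
  { to        = λ _ → zero
  ; from      = λ _ → record { uses = λ _ → false ; inside = λ _ () ; tiles = λ c r → ⊥-elim (e c r) }
  ; to-cong   = λ _ → refl
  ; from-cong = λ _ _ → refl
  ; inverse   = (λ { {zero} _ → refl }) , λ {t} _ d → sym (unused t d)
  } , refl
  where
  unused : ∀ t d → uses t d ≡ false
  unused t d with uses t d in eq
  ... | false = refl
  ... | true  = ⊥-elim (e _ (inside t d (subst T (sym eq) tt) _ (covers-anchor d)))

-- Row transfer

ones : ∀ {k} → Vec Bool k
ones = replicate _ true

-- The sum, over the ways to place dominoes on the cells of a row with indicator p (horizontally,
-- or vertically onto cells with indicator ms of the next row), of W at what is left of the next row.
mutual
  rowSum : ∀ {k} → Vec Bool k → Vec Bool k → (Vec Bool k → ℤ) → ℤ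
  rowSum []          []       W = W []
  rowSum (false ∷ p) (m ∷ ms) W = rowSum p ms (W ∘ (m ∷_))
  rowSum (true ∷ p)  (m ∷ ms) W =
    across p ms (W ∘ (m ∷_)) + (if m then rowSum p ms (W ∘ (false ∷_)) else 0ℤ)

  across : ∀ {k} → Vec Bool k → Vec Bool k → (Vec Bool k → ℤ) → ℤ
  across []          _        W = 0ℤ
  across (false ∷ p) _        W = 0ℤ
  across (true ∷ p)  (m ∷ ms) W = rowSum p ms (W ∘ (m ∷_))

InRow : ∀ {k} → ℤ → ℤ → Vec Bool k → Cell → Set
InRow x y []       c = ⊥
InRow x y (b ∷ bs) c = (T b × c ≡ (x , y)) ⊎ InRow (x + 1ℤ) y bs c

inRow-y : ∀ {k x y} (bs : Vec Bool k) {c} → InRow x y bs c → proj₂ c ≡ y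
inRow-y (b ∷ bs) (inj₁ (_ , refl)) = refl
inRow-y (b ∷ bs) (inj₂ r)          = inRow-y bs r

inRow-x : ∀ {k x y} (bs : Vec Bool k) {c} → InRow x y bs c → x ℤ.≤ proj₁ c
inRow-x (b ∷ bs) (inj₁ (_ , refl)) = ℤ.≤-refl
inRow-x (b ∷ bs) (inj₂ r)          = ℤ.≤-trans (ℤ.<⇒≤ (i<i+1 _)) (inRow-x bs r)

inRow-x≢ : ∀ {k x x′ y} (bs : Vec Bool k) {c} → x′ ℤ.< x → InRow x y bs c → proj₁ c ≢ x′
inRow-x≢ bs lt r refl = ℤ.<⇒≱ lt (inRow-x bs r)

i≢i+1 : ∀ i → i ≢ i + 1ℤ
i≢i+1 i = ℤ.<⇒≢ (i<i+1 i)

i<i+1+1 : ∀ i → i ℤ.< i + 1ℤ + 1ℤ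
i<i+1+1 i = ℤ.<-trans (i<i+1 i) (i<i+1 _)

inRow-ones : ∀ {k x y} (bs : Vec Bool k) {c} → InRow x y bs c → InRow x y (ones {k}) c
inRow-ones (b ∷ bs) (inj₁ (_ , e)) = inj₁ (tt , e)
inRow-ones (b ∷ bs) (inj₂ r)       = inj₂ (inRow-ones bs r)

-- `Z` is what the scan of a row leaves alone: higher rows, and the cells of the next row that lie
-- outside the window still to be scanned.
record Outside (x y : ℤ) (k : ℕ) (Z : Cell → Set) : Set where
  field
    above   : ∀ c → Z c → y ℤ.< proj₂ c
    outside : ∀ c → Z c → ¬ InRow x (y + 1ℤ) (ones {k}) c

open Outside

-- Once the scan has passed a column, what is left of the next row in this column joins `Z`.
withCell : Bool → Cell → (Cell → Set) → Cell → Set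
withCell b c₀ Z c = (T b × c ≡ c₀) ⊎ Z c

outside-tail : ∀ {x y k Z} m → Outside x y (suc k) Z →
               Outside (x + 1ℤ) y k (withCell m (x , y + 1ℤ) Z)
outside-tail m o .above c (inj₁ (_ , refl)) = i<i+1 _
outside-tail m o .above c (inj₂ z) = above o c z
outside-tail m o .outside c (inj₁ (_ , refl)) r = inRow-x≢ ones (i<i+1 _) r refl
outside-tail m o .outside c (inj₂ z) r = outside o c z (inj₂ r)

State : ∀ {k} → ℤ → ℤ → Vec Bool k → Vec Bool k → (Cell → Set) → Cell → Set
State x y p ms Z c = InRow x y p c ⊎ InRow x (y + 1ℤ) ms c ⊎ Z c

state-first : ∀ {k x y Z} (p ms : Vec Bool k) → Outside x y k Z →
              ∀ c → State x y p ms Z c → y ℤ.≤ proj₂ c × (proj₂ c ≡ y → x ℤ.≤ proj₁ c)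
state-first p ms o c (inj₁ r) = ℤ.≤-reflexive (sym (inRow-y p r)) , λ _ → inRow-x p r
state-first p ms o c (inj₂ (inj₁ r)) =
  ℤ.≤-trans (ℤ.<⇒≤ (i<i+1 _)) (ℤ.≤-reflexive (sym (inRow-y ms r))) , λ _ → inRow-x ms r
state-first p ms o c (inj₂ (inj₂ z)) =
  ℤ.<⇒≤ (above o c z) , λ e → contradiction (sym e) (ℤ.<⇒≢ (above o c z))

state-not-right : ∀ {k x y Z} (p ms : Vec Bool k) b m → Outside x y (suc k) Z →
  ¬ InRow (x + 1ℤ) y p (x + 1ℤ , y) → ¬ State x y (b ∷ p) (m ∷ ms) Z (x + 1ℤ , y)
state-not-right p ms b m o np (inj₁ (inj₁ (_ , e))) = i≢i+1 _ (sym (cong proj₁ e))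
state-not-right p ms b m o np (inj₁ (inj₂ r)) = np r
state-not-right p ms b m o np (inj₂ (inj₁ r)) = i≢i+1 _ (inRow-y (m ∷ ms) r)
state-not-right p ms b m o np (inj₂ (inj₂ z)) = ℤ.<⇒≢ (above o _ z) refl

state-not-up : ∀ {k x y Z} (p ms : Vec Bool k) b → Outside x y (suc k) Z →
  ¬ State x y (b ∷ p) (false ∷ ms) Z (x , y + 1ℤ)
state-not-up p ms b o (inj₁ r) = i≢i+1 _ (sym (inRow-y (b ∷ p) r))
state-not-up p ms b o (inj₂ (inj₁ (inj₂ r))) = inRow-x≢ ms (i<i+1 _) r refl
state-not-up p ms b o (inj₂ (inj₂ z)) = outside o _ z (inj₁ (tt , refl))

remove-vertical : ∀ {k x y Z} (p ms : Vec Bool k) → Outside x y (suc k) Z →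
  State (x + 1ℤ) y p ms (withCell false (x , y + 1ℤ) Z) ≐
  State x y (true ∷ p) (true ∷ ms) Z ∖ vertical (x , y)
remove-vertical {x = x} {y} {Z} p ms o = to , from
  where
  to : ∀ c → State (x + 1ℤ) y p ms (withCell false (x , y + 1ℤ) Z) c →
       (State x y (true ∷ p) (true ∷ ms) Z ∖ vertical (x , y)) c
  to c (inj₁ r) = inj₁ (inj₂ r) , λ
    { (inj₁ refl) → inRow-x≢ p (i<i+1 _) r refl
    ; (inj₂ refl) → inRow-x≢ p (i<i+1 _) r refl }
  to c (inj₂ (inj₁ r)) = inj₂ (inj₁ (inj₂ r)) , λ
    { (inj₁ refl) → inRow-x≢ ms (i<i+1 _) r refl
    ; (inj₂ refl) → inRow-x≢ ms (i<i+1 _) r refl }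
  to c (inj₂ (inj₂ (inj₂ z))) = inj₂ (inj₂ z) , λ
    { (inj₁ refl) → ℤ.<⇒≢ (above o _ z) refl
    ; (inj₂ refl) → outside o _ z (inj₁ (tt , refl)) }
  from : ∀ c → (State x y (true ∷ p) (true ∷ ms) Z ∖ vertical (x , y)) c →
         State (x + 1ℤ) y p ms (withCell false (x , y + 1ℤ) Z) c
  from c (inj₁ (inj₁ (_ , e)) , n) = contradiction (inj₁ e) n
  from c (inj₁ (inj₂ r) , n) = inj₁ r
  from c (inj₂ (inj₁ (inj₁ (_ , e))) , n) = contradiction (inj₂ e) n
  from c (inj₂ (inj₁ (inj₂ r)) , n) = inj₂ (inj₁ r)
  from c (inj₂ (inj₂ z) , n) = inj₂ (inj₂ (inj₂ z))

remove-horizontal : ∀ {k x y Z} (p ms : Vec Bool k) m → Outside x y (suc (suc k)) Z → ∀ m′ →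
  State (x + 1ℤ) y (false ∷ p) (m′ ∷ ms) (withCell m (x , y + 1ℤ) Z) ≐
  State x y (true ∷ true ∷ p) (m ∷ m′ ∷ ms) Z ∖ horizontal (x , y)
remove-horizontal {x = x} {y} {Z} p ms m o m′ = to , from
  where
  to : ∀ c → State (x + 1ℤ) y (false ∷ p) (m′ ∷ ms) (withCell m (x , y + 1ℤ) Z) c →
       (State x y (true ∷ true ∷ p) (m ∷ m′ ∷ ms) Z ∖ horizontal (x , y)) c
  to c (inj₁ (inj₂ r)) = inj₁ (inj₂ (inj₂ r)) , λ
    { (inj₁ refl) → inRow-x≢ p (i<i+1+1 _) r refl
    ; (inj₂ refl) → inRow-x≢ p (i<i+1 _) r refl }
  to c (inj₂ (inj₁ r)) = inj₂ (inj₁ (inj₂ r)) , λ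
    { (inj₁ refl) → i≢i+1 _ (inRow-y (m′ ∷ ms) r)
    ; (inj₂ refl) → i≢i+1 _ (inRow-y (m′ ∷ ms) r) }
  to c (inj₂ (inj₂ (inj₁ (b , e)))) = inj₂ (inj₁ (inj₁ (b , e))) , λ
    { (inj₁ refl) → i≢i+1 _ (cong proj₂ e)
    ; (inj₂ refl) → i≢i+1 _ (cong proj₂ e) }
  to c (inj₂ (inj₂ (inj₂ z))) = inj₂ (inj₂ z) , λ
    { (inj₁ refl) → ℤ.<⇒≢ (above o _ z) refl
    ; (inj₂ refl) → ℤ.<⇒≢ (above o _ z) refl }
  from : ∀ c → (State x y (true ∷ true ∷ p) (m ∷ m′ ∷ ms) Z ∖ horizontal (x , y)) c →
         State (x + 1ℤ) y (false ∷ p) (m′ ∷ ms) (withCell m (x , y + 1ℤ) Z) c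
  from c (inj₁ (inj₁ (_ , e)) , n) = contradiction (inj₁ e) n
  from c (inj₁ (inj₂ (inj₁ (_ , e))) , n) = contradiction (inj₂ e) n
  from c (inj₁ (inj₂ (inj₂ r)) , n) = inj₁ (inj₂ r)
  from c (inj₂ (inj₁ (inj₁ e)) , n) = inj₂ (inj₂ (inj₁ e))
  from c (inj₂ (inj₁ (inj₂ r)) , n) = inj₂ (inj₁ r)
  from c (inj₂ (inj₂ z) , n) = inj₂ (inj₂ (inj₂ z))

skip-cell : ∀ {k x y Z} (p ms : Vec Bool k) m →
  State (x + 1ℤ) y p ms (withCell m (x , y + 1ℤ) Z) ≐ State x y (false ∷ p) (m ∷ ms) Z
skip-cell p ms m =
  (λ { c (inj₁ r) → inj₁ (inj₂ r)
     ; c (inj₂ (inj₁ r)) → inj₂ (inj₁ (inj₂ r))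
     ; c (inj₂ (inj₂ (inj₁ e))) → inj₂ (inj₁ (inj₁ e))
     ; c (inj₂ (inj₂ (inj₂ z))) → inj₂ (inj₂ z) }) ,
  (λ { c (inj₁ (inj₂ r)) → inj₁ r
     ; c (inj₂ (inj₁ (inj₁ e))) → inj₂ (inj₂ (inj₁ e))
     ; c (inj₂ (inj₁ (inj₂ r))) → inj₂ (inj₁ r)
     ; c (inj₂ (inj₂ z)) → inj₂ (inj₂ (inj₂ z)) })

Next : ∀ {k} → ℤ → ℤ → Vec Bool k → (Cell → Set) → Cell → Set
Next x y q Z c = InRow x (y + 1ℤ) q c ⊎ Z c

next-tail : ∀ {k} x y {Z z} (q ms : Vec Bool k) b b′ m → b ∧ m ≡ b′ →
  Count (Next x y (zipWith _∧_ (b ∷ q) (m ∷ ms)) Z) z →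
  Count (Next (x + 1ℤ) y (zipWith _∧_ q ms) (withCell b′ (x , y + 1ℤ) Z)) z
next-tail x y q ms b b′ m refl = count-cong
  ( (λ { c (inj₁ (inj₁ e)) → inj₂ (inj₁ e) ; c (inj₁ (inj₂ r)) → inj₁ r
       ; c (inj₂ z) → inj₂ (inj₂ z) })
  , (λ { c (inj₁ r) → inj₁ (inj₂ r) ; c (inj₂ (inj₁ e)) → inj₁ (inj₁ e)
       ; c (inj₂ (inj₂ z)) → inj₂ z }) )

-- `rowSum` evaluates `W` only at subsets of `ms`. Masking `q` in the hypothesis makes it meaningful
-- for all `q` and avoids carrying a proof of inclusion.
count-row : ∀ k {x y Z} (p ms : Vec Bool k) {W} → Outside x y k Z →
  (∀ q → Count (Next x y (zipWith _∧_ q ms) Z) (W q)) → Count (State x y p ms Z) (rowSum p ms W)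
count-row zero [] [] o h =
  count-cong ((λ { c (inj₂ z) → inj₂ (inj₂ z) }) , λ { c (inj₂ (inj₂ z)) → inj₂ z }) (h [])
count-row (suc k) {x} {y} (false ∷ p) (m ∷ ms) o h =
  count-cong (skip-cell p ms m)
    (count-row k p ms (outside-tail m o) λ q → next-tail x y q ms m m m (Bool.∧-idem m) (h (m ∷ q)))
count-row (suc k) {x} {y} {Z} (true ∷ p) (m ∷ ms) {W} o h =
  count-split (inj₁ (inj₁ (tt , refl))) (state-first (true ∷ p) (m ∷ ms) o) (horizontally p ms o h) (vertically m o h)
  where
  vertically : ∀ m → Outside x y (suc k) Z →
    (∀ q → Count (Next x y (zipWith _∧_ q (m ∷ ms)) Z) (W q)) →
    HasCount (tilingsWith (State x y (true ∷ p) (m ∷ ms) Z) (vertical (x , y)))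
             (if m then rowSum p ms (W ∘ (false ∷_)) else 0ℤ)
  vertically false o h =
    count-without _ (x , y + 1ℤ) (inj₂ refl) (state-not-up p ms true o)
  vertically true o h =
    count-with _ (λ { c (inj₁ e) → inj₁ (inj₁ (tt , e)) ; c (inj₂ e) → inj₂ (inj₁ (inj₁ (tt , e))) })
      (count-cong (remove-vertical p ms o)
        (count-row k p ms (outside-tail false o) λ q → next-tail x y q ms false false true refl (h (false ∷ q))))
  horizontally : (p ms : Vec Bool k) → Outside x y (suc k) Z →
    (∀ q → Count (Next x y (zipWith _∧_ q (m ∷ ms)) Z) (W q)) →
    HasCount (tilingsWith (State x y (true ∷ p) (m ∷ ms) Z) (horizontal (x , y)))
             (across p ms (W ∘ (m ∷_)))
  horizontally [] [] o h =
    count-without _ (x + 1ℤ , y) (inj₂ refl) (state-not-right [] [] true m o λ ())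
  horizontally (false ∷ p) ms o h =
    count-without _ (x + 1ℤ , y) (inj₂ refl) (state-not-right (false ∷ p) ms true m o
      λ { (inj₂ r) → inRow-x≢ p (i<i+1 _) r refl })
  horizontally (true ∷ p) (m′ ∷ ms) o h =
    count-with _ (λ { c (inj₁ e) → inj₁ (inj₁ (tt , e)) ; c (inj₂ e) → inj₁ (inj₂ (inj₁ (tt , e))) })
      (count-cong (remove-horizontal p ms m o m′)
        -- The domino has used up the next cell as well, and `across` is the row sum with that cell
        -- cleared.
        (count-row k (false ∷ p) (m′ ∷ ms) (outside-tail m o)
          λ q → next-tail x y q (m′ ∷ ms) m m m (Bool.∧-idem m) (h (m ∷ q))))

-- The pillow, row by row

double : ℕ → ℕ
double zero    = zero
double (suc n) = suc (suc (double n))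

-- The lower half of the pillow, from its top row (with leftmost cell (x , y)) downwards.
Lower : ℕ → ℤ → ℤ → Cell → Set
Lower zero          x y c = ⊥
Lower (suc zero)    x y c = InRow x y (ones {2}) c
Lower (suc (suc m)) x y c = InRow x y (ones {double (suc (suc m))}) c ⊎ Lower m (x + 1ℤ) (y - 1ℤ) c

-- The upper half of the pillow, without its bottom row (with leftmost cell (x , y)).
Upper : ℕ → ℤ → ℤ → Cell → Set
Upper zero          x y c = ⊥
Upper (suc zero)    x y c = ⊥
Upper (suc (suc m)) x y c =
  InRow (x + 1ℤ + 1ℤ + 1ℤ) (y + 1ℤ) (ones {double m}) c ⊎ Upper m (x + 1ℤ + 1ℤ + 1ℤ) (y + 1ℤ) c

-- A row overhangs the row beneath by one cell on the left and three on the right; nothing below can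
-- have covered these four cells.
pad : ∀ {k} → Vec Bool k → Vec Bool (suc (suc (suc (suc k))))
pad b = true ∷ (b ∷ʳ true ∷ʳ true ∷ʳ true)

-- Written with a continuation: the lowest row is tiled before all others, and `W` receives what is
-- left of the row above the half. That row has the extent of the top row of the half, so the
-- recursive call yields only the inner part `b` of the next row.
lowerSum : ∀ n → (Vec Bool (double n) → ℤ) → ℤ
lowerSum zero          W = W []
lowerSum (suc zero)    W = rowSum ones ones W
lowerSum (suc (suc m)) W = lowerSum m (λ b → rowSum (pad b) ones W)

mid : ∀ {k} → Vec Bool (suc (suc (suc (suc k)))) → Vec Bool k
mid (_ ∷ _ ∷ _ ∷ q) = init q

-- Upwards the rows lose three cells on the left and one on the right; the masked positions are no
-- cells of the next row.
innerMask : ∀ {k} → Vec Bool (suc (suc (suc (suc k))))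
innerMask = false ∷ false ∷ false ∷ (ones ∷ʳ false)

upperSum : ∀ n → Vec Bool (double n) → ℤ
upperSum zero          p = 1ℤ
upperSum (suc zero)    p = rowSum p (false ∷ false ∷ []) (λ _ → 1ℤ)
upperSum (suc (suc m)) p = rowSum p innerMask (λ q → upperSum m (mid q))

inRow-snoc : ∀ {k x y} (b : Vec Bool k) v →
  (∀ c → InRow x y b c → InRow x y (b ∷ʳ v) c) ×
  (∀ c → InRow x y (b ∷ʳ v) c → InRow x y b c ⊎ (T v × ¬ InRow x y (ones {k}) c))
inRow-snoc [] v = (λ c ()) , λ { c (inj₁ (t , e)) → inj₂ (t , λ ()) }
inRow-snoc {x = x} {y} (a ∷ b) v = to , from
  where
  to : ∀ c → InRow x y (a ∷ b) c → InRow x y (a ∷ (b ∷ʳ v)) c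
  to c (inj₁ e) = inj₁ e
  to c (inj₂ r) = inj₂ (proj₁ (inRow-snoc b v) c r)
  from : ∀ c → InRow x y (a ∷ (b ∷ʳ v)) c →
         InRow x y (a ∷ b) c ⊎ (T v × ¬ InRow x y (ones {suc _}) c)
  from c (inj₁ e) = inj₁ (inj₁ e)
  from c (inj₂ r) with proj₂ (inRow-snoc b v) c r
  ... | inj₁ r′ = inj₁ (inj₂ r′)
  ... | inj₂ (t , n) = inj₂ (t , λ
    { (inj₁ (_ , refl)) → inRow-x≢ (b ∷ʳ v) (i<i+1 _) r refl
    ; (inj₂ r′) → n r′ })

ones-snoc : ∀ k → ones {suc k} ≡ ones {k} ∷ʳ true
ones-snoc zero    = refl
ones-snoc (suc k) = cong (true ∷_) (ones-snoc k)

pad-ones : ∀ {k} → pad (ones {k}) ≡ ones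
pad-ones {k} = cong (true ∷_) (sym
  (trans (ones-snoc _) (cong (_∷ʳ true) (trans (ones-snoc _) (cong (_∷ʳ true) (ones-snoc k))))))

Margin : ℕ → ℤ → ℤ → Cell → Set
Margin k x y c = InRow x y (ones {suc (suc (suc (suc k)))}) c × ¬ InRow (x + 1ℤ) y (ones {k}) c

inRow-pad : ∀ {k x y} (b : Vec Bool k) →
  InRow x y (pad b) ≐ λ c → InRow (x + 1ℤ) y b c ⊎ Margin k x y c
inRow-pad {k} {x} {y} b = to , from
  where
  to : ∀ c → InRow x y (pad b) c → InRow (x + 1ℤ) y b c ⊎ Margin k x y c
  to c (inj₁ (_ , refl)) = inj₂ (inj₁ (tt , refl) , λ r → inRow-x≢ ones (i<i+1 _) r refl)
  to c r₀@(inj₂ r₃) with proj₂ (inRow-snoc (b ∷ʳ true ∷ʳ true) true) c r₃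
  ... | inj₂ (_ , n) = inj₂ (inRow-ones (pad b) r₀ , λ r → n (subst (λ v → InRow (x + 1ℤ) y v c)
          (trans (cong (_∷ʳ true) (sym (ones-snoc k))) (sym (ones-snoc (suc k))))
          (proj₁ (inRow-snoc (ones ∷ʳ true) true) c (proj₁ (inRow-snoc ones true) c r))))
  ... | inj₁ r₂ with proj₂ (inRow-snoc (b ∷ʳ true) true) c r₂
  ...   | inj₂ (_ , n) = inj₂ (inRow-ones (pad b) r₀ , λ r → n (subst (λ v → InRow (x + 1ℤ) y v c)
            (sym (ones-snoc k)) (proj₁ (inRow-snoc ones true) c r)))
  ...   | inj₁ r₁ with proj₂ (inRow-snoc b true) c r₁
  ...     | inj₂ (_ , n) = inj₂ (inRow-ones (pad b) r₀ , n)
  ...     | inj₁ r = inj₁ r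
  from : ∀ c → InRow (x + 1ℤ) y b c ⊎ Margin k x y c → InRow x y (pad b) c
  from c (inj₁ r) = inj₂ (proj₁ (inRow-snoc _ true) c (proj₁ (inRow-snoc _ true) c (proj₁ (inRow-snoc _ true) c r)))
  from c (inj₂ (r , n)) = margin b (subst (λ v → InRow x y v c) (sym (pad-ones {k})) r) n
    where
    snoc⁻ : ∀ {k x} (a b : Vec Bool k) → InRow x y (a ∷ʳ true) c →
            InRow x y a c ⊎ InRow x y (b ∷ʳ true) c
    snoc⁻ []      []      r = inj₂ r
    snoc⁻ (_ ∷ a) (_ ∷ b) (inj₁ e) = inj₁ (inj₁ e)
    snoc⁻ (_ ∷ a) (_ ∷ b) (inj₂ r) with snoc⁻ a b r
    ... | inj₁ r′ = inj₁ (inj₂ r′)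
    ... | inj₂ r′ = inj₂ (inj₂ r′)
    margin : (b : Vec Bool k) → InRow x y (pad (ones {k})) c → ¬ InRow (x + 1ℤ) y (ones {k}) c → InRow x y (pad b) c
    margin b (inj₁ e) n = inj₁ e
    margin b (inj₂ r) n with snoc⁻ (ones ∷ʳ true ∷ʳ true) (b ∷ʳ true ∷ʳ true) r
    ... | inj₂ r′ = inj₂ r′
    ... | inj₁ r₂ with snoc⁻ (ones ∷ʳ true) (b ∷ʳ true) r₂
    ...   | inj₂ r′ = inj₂ (proj₁ (inRow-snoc _ true) c r′)
    ...   | inj₁ r₁ with snoc⁻ ones b r₁
    ...     | inj₂ r′ = inj₂ (proj₁ (inRow-snoc _ true) c (proj₁ (inRow-snoc _ true) c r′))
    ...     | inj₁ r′ = contradiction r′ n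

i-1+1 : ∀ i → i - 1ℤ + 1ℤ ≡ i
i-1+1 = solve-∀

zipWith-ones : ∀ {k} (q : Vec Bool k) → zipWith _∧_ q ones ≡ q
zipWith-ones []      = refl
zipWith-ones (b ∷ q) = cong₂ _∷_ (Bool.∧-identityʳ b) (zipWith-ones q)

count-lower : ∀ n {x y Z W} → Outside x y (double n) Z →
  (∀ q → Count (Next x y q Z) (W q)) →
  Count (λ c → Lower n x y c ⊎ InRow x (y + 1ℤ) (ones {double n}) c ⊎ Z c) (lowerSum n W)
count-lower zero o h =
  count-cong ((λ { c (inj₂ z) → inj₂ (inj₂ z) }) , λ { c (inj₂ (inj₂ z)) → inj₂ z }) (h [])
count-lower (suc zero) {x} {y} {Z} {W} o h =
  count-row 2 ones ones o λ q → subst (λ q′ → Count (Next x y q′ Z) (W q)) (sym (zipWith-ones q)) (h q)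
count-lower (suc (suc m)) {x} {y} {Z} {W} o h =
  -- To the smaller half, the margin of its neighbouring row and everything above that row form one
  -- outer region `Z′`. Once `b` is known, margin and `b` together are the row `pad b`.
  count-cong (to , from) (count-lower m {x + 1ℤ} {y - 1ℤ} {Z′} o′ λ b →
    count-cong (to′ b , from′ b)
      (count-row (double (suc (suc m))) (pad b) ones o λ q →
        subst (λ q′ → Count (Next x y q′ Z) (W q)) (sym (zipWith-ones q)) (h q)))
  where
  Row : Cell → Set
  Row = InRow x (y + 1ℤ) (ones {double (suc (suc m))})
  Z′ : Cell → Set
  Z′ c = Margin (double m) x y c ⊎ Row c ⊎ Z c
  o′ : Outside (x + 1ℤ) (y - 1ℤ) (double m) Z′
  o′ .above c (inj₁ (r , _)) rewrite inRow-y (ones {double (suc (suc m))}) r =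
    subst (y - 1ℤ ℤ.<_) (i-1+1 y) (i<i+1 _)
  o′ .above c (inj₂ (inj₁ r)) rewrite inRow-y (ones {double (suc (suc m))}) r =
    ℤ.<-trans (subst (y - 1ℤ ℤ.<_) (i-1+1 y) (i<i+1 _)) (i<i+1 y)
  o′ .above c (inj₂ (inj₂ z)) = ℤ.<-trans (subst (y - 1ℤ ℤ.<_) (i-1+1 y) (i<i+1 _)) (above o c z)
  o′ .outside c z r rewrite i-1+1 y with z
  ... | inj₁ (_ , n) = n r
  ... | inj₂ (inj₁ r′) =
    i≢i+1 y (trans (sym (inRow-y (ones {double m}) r)) (inRow-y (ones {double (suc (suc m))}) r′))
  ... | inj₂ (inj₂ z′) = ℤ.<⇒≢ (above o c z′) (sym (inRow-y (ones {double m}) r))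
  to′ : ∀ b c → State x y (pad b) ones Z c → Next (x + 1ℤ) (y - 1ℤ) b Z′ c
  to′ b c r rewrite i-1+1 y with r
  ... | inj₂ r′ = inj₂ (inj₂ r′)
  ... | inj₁ r′ with proj₁ (inRow-pad b) c r′
  ...   | inj₁ r″ = inj₁ r″
  ...   | inj₂ r″ = inj₂ (inj₁ r″)
  from′ : ∀ b c → Next (x + 1ℤ) (y - 1ℤ) b Z′ c → State x y (pad b) ones Z c
  from′ b c r rewrite i-1+1 y with r
  ... | inj₁ r′ = inj₁ (proj₂ (inRow-pad b) c (inj₁ r′))
  ... | inj₂ (inj₁ r′) = inj₁ (proj₂ (inRow-pad b) c (inj₂ r′))
  ... | inj₂ (inj₂ r′) = inj₂ r′
  to : ∀ c → Lower m (x + 1ℤ) (y - 1ℤ) c ⊎ InRow (x + 1ℤ) (y - 1ℤ + 1ℤ) (ones {double m}) c ⊎ Z′ c →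
       Lower (suc (suc m)) x y c ⊎ Row c ⊎ Z c
  to c r rewrite i-1+1 y with r
  ... | inj₁ l = inj₁ (inj₂ l)
  ... | inj₂ (inj₁ r′) = inj₁ (inj₁ (subst (λ v → InRow x y v c) pad-ones (proj₂ (inRow-pad ones) c (inj₁ r′))))
  ... | inj₂ (inj₂ (inj₁ (r′ , _))) = inj₁ (inj₁ r′)
  ... | inj₂ (inj₂ (inj₂ r′)) = inj₂ r′
  from : ∀ c → Lower (suc (suc m)) x y c ⊎ Row c ⊎ Z c →
       Lower m (x + 1ℤ) (y - 1ℤ) c ⊎ InRow (x + 1ℤ) (y - 1ℤ + 1ℤ) (ones {double m}) c ⊎ Z′ c
  from c r rewrite i-1+1 y with r
  ... | inj₁ (inj₂ l) = inj₁ l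
  ... | inj₂ r′ = inj₂ (inj₂ (inj₂ r′))
  ... | inj₁ (inj₁ r′) with proj₁ (inRow-pad {x = x} {y} (ones {double m})) c (subst (λ v → InRow x y v c) (sym pad-ones) r′)
  ...   | inj₁ r″ = inj₂ (inj₁ r″)
  ...   | inj₂ r″ = inj₂ (inj₂ (inj₁ r″))

upper-y : ∀ n {x y} c → Upper n x y c → y ℤ.< proj₂ c
upper-y (suc (suc m)) c (inj₁ r) rewrite inRow-y (ones {double m}) r = i<i+1 _
upper-y (suc (suc m)) c (inj₂ u) = ℤ.<-trans (i<i+1 _) (upper-y m c u)

zipWith-∷ʳ : ∀ {k} (q r : Vec Bool k) a b → zipWith _∧_ (q ∷ʳ a) (r ∷ʳ b) ≡ zipWith _∧_ q r ∷ʳ (a ∧ b)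
zipWith-∷ʳ []      []      a b = refl
zipWith-∷ʳ (_ ∷ q) (_ ∷ r) a b = cong (_ ∷_) (zipWith-∷ʳ q r a b)

inRow-inner : ∀ {k x y} (q : Vec Bool (suc k)) →
  InRow x y (init q) ≐ InRow x y (zipWith _∧_ q (ones ∷ʳ false))
inRow-inner {x = x} {y} q with Data.Vec.initLast q
... | q′ , l , refl rewrite zipWith-∷ʳ q′ ones l false | zipWith-ones q′ | Bool.∧-zeroʳ l =
  proj₁ (inRow-snoc q′ false) ,
  λ c r → [ id , (λ { (() , _) }) ]′ (proj₂ (inRow-snoc q′ false) c r)

count-upper : ∀ n {x y} p → Count (λ c → InRow x y p c ⊎ Upper n x y c) (upperSum n p)
count-upper zero [] = count-∅ λ { c (inj₁ ()) ; c (inj₂ ()) }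
count-upper (suc zero) {x} {y} p =
  count-cong ((λ { c (inj₁ r) → inj₁ r ; c (inj₂ (inj₂ ())) ; c (inj₂ (inj₁ (inj₁ (() , _))))
                 ; c (inj₂ (inj₁ (inj₂ (inj₁ (() , _))))) ; c (inj₂ (inj₁ (inj₂ (inj₂ ())))) }) ,
              λ { c (inj₁ r) → inj₁ r ; c (inj₂ ()) })
    (count-row 2 {Z = λ _ → ⊥} p (false ∷ false ∷ []) (record { above = λ _ () ; outside = λ _ () })
      λ q → count-∅ λ c → λ { (inj₁ r) → none q c r ; (inj₂ ()) })
  where
  none : ∀ q c → ¬ InRow x (y + 1ℤ) (zipWith _∧_ q (false ∷ false ∷ [])) c
  none (a ∷ b ∷ []) c (inj₁ (t , _)) = T-∧ʳ {a} t
  none (a ∷ b ∷ []) c (inj₂ (inj₁ (t , _))) = T-∧ʳ {b} t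
count-upper (suc (suc m)) {x} {y} p =
  count-cong ((λ { c (inj₁ r) → inj₁ r ; c (inj₂ (inj₁ r)) → inj₂ (inj₁ (from-inner c r))
                 ; c (inj₂ (inj₂ u)) → inj₂ (inj₂ u) }) ,
              (λ { c (inj₁ r) → inj₁ r ; c (inj₂ (inj₁ r)) → inj₂ (inj₁ (to-inner c r))
                 ; c (inj₂ (inj₂ u)) → inj₂ (inj₂ u) }))
    (count-row (double (suc (suc m))) p innerMask o next)
  where
  x₃ = x + 1ℤ + 1ℤ + 1ℤ
  o : Outside x y (double (suc (suc m))) (Upper m x₃ (y + 1ℤ))
  o .above c u = ℤ.<-trans (i<i+1 _) (upper-y m c u)
  o .outside c u r = ℤ.<⇒≢ (upper-y m c u) (sym (inRow-y (ones {double (suc (suc m))}) r))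
  to-inner : ∀ c → InRow x₃ (y + 1ℤ) (ones {double m}) c → InRow x (y + 1ℤ) (innerMask {double m}) c
  to-inner c r = inj₂ (inj₂ (inj₂ (proj₁ (inRow-snoc _ false) c r)))
  from-inner : ∀ c → InRow x (y + 1ℤ) (innerMask {double m}) c → InRow x₃ (y + 1ℤ) (ones {double m}) c
  from-inner c (inj₂ (inj₂ (inj₂ r))) with proj₂ (inRow-snoc ones false) c r
  ... | inj₁ r′ = r′
  next : ∀ q → Count (Next x y (zipWith _∧_ q innerMask) (Upper m x₃ (y + 1ℤ))) (upperSum m (mid q))
  next (b₁ ∷ b₂ ∷ b₃ ∷ q) = count-cong (to , from) (count-upper m (init q))
    where
    to : ∀ c → InRow x₃ (y + 1ℤ) (init q) c ⊎ Upper m x₃ (y + 1ℤ) c →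
         Next x y (zipWith _∧_ (b₁ ∷ b₂ ∷ b₃ ∷ q) innerMask) (Upper m x₃ (y + 1ℤ)) c
    to c (inj₁ r) = inj₁ (inj₂ (inj₂ (inj₂ (proj₁ (inRow-inner q) c r))))
    to c (inj₂ u) = inj₂ u
    from : ∀ c → Next x y (zipWith _∧_ (b₁ ∷ b₂ ∷ b₃ ∷ q) innerMask) (Upper m x₃ (y + 1ℤ)) c →
           InRow x₃ (y + 1ℤ) (init q) c ⊎ Upper m x₃ (y + 1ℤ) c
    from c (inj₂ u) = inj₂ u
    from c (inj₁ (inj₁ (t , _))) = ⊥-elim (T-∧ʳ {b₁} t)
    from c (inj₁ (inj₂ (inj₁ (t , _)))) = ⊥-elim (T-∧ʳ {b₂} t)
    from c (inj₁ (inj₂ (inj₂ (inj₁ (t , _))))) = ⊥-elim (T-∧ʳ {b₃} t)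
    from c (inj₁ (inj₂ (inj₂ (inj₂ r)))) = inj₁ (proj₂ (inRow-inner q) c r)

-- The pillow as the union of its halves

infix 4 0≤_
0≤_ : ℤ → Set
0≤ i = 0ℤ ℤ.≤ i

-- Linear inequalities are proved by certificates: a sum of nonnegative terms, formed with `⊕`, is
-- identified with the goal by the ring solver.
0≤-by : ∀ {i j} → 0≤ i → i ≡ j → 0≤ j
0≤-by p refl = p

0≤+ : ∀ {k} → 0≤ (+ k)
0≤+ = ℤ.+≤+ z≤n

infixl 6 _⊕_
_⊕_ : ∀ {i j} → 0≤ i → 0≤ j → 0≤ (i + j)
p ⊕ q = ℤ.+-mono-≤ p q

0≰-1 : ∀ {A : Set} k → 0≤ -[1+ k ] → A
0≰-1 k ()

abs⇒ : ∀ k i → ∣ i ∣ ≤ k → 0≤ (+ k + i) × 0≤ (+ k - i)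
abs⇒ k (+ n)    le = 0≤+ , ℤ.i≤j⇒0≤j-i (ℤ.+≤+ le)
abs⇒ k -[1+ n ] le = ℤ.i≤j⇒0≤j-i (ℤ.+≤+ le) , 0≤+

abs⇐ : ∀ k i → 0≤ (+ k + i) → 0≤ (+ k - i) → ∣ i ∣ ≤ k
abs⇐ k (+ n)    p q = ℤ.drop‿+≤+ (ℤ.0≤i-j⇒j≤i {+ k} {+ n} q)
abs⇐ k -[1+ n ] p q = ℤ.drop‿+≤+ (ℤ.0≤i-j⇒j≤i {+ k} {+ suc n} p)

-- Each inequality is required only at the vertex of the cell where it is tightest: `(a , b)`,
-- `(a + 1 , b + 1)`, `(a + 1 , b)` and `(a , b + 1)`, in this order.
record Bounds (N a b : ℤ) : Set where
  constructor bounds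
  field
    b₁ : 0≤ (N + 1ℤ + (a + b))
    b₂ : 0≤ (N - 1ℤ - (a + b))
    b₃ : 0≤ (N + + 2 + (+ 3 * b - a))
    b₄ : 0≤ (N - (+ 3 * b - a))

inAP⇒bounds : ∀ n a b → InAP n (a , b) → Bounds (+ n) a b
inAP⇒bounds n a b ((v₁ , _) , (_ , v₂) , (_ , v₃) , (v₄ , _)) = bounds
  (proj₁ (abs⇒ _ (a + b) v₁))
  (0≤-by (proj₂ (abs⇒ _ (a + 1ℤ + (b + 1ℤ)) v₄)) (e₂ (+ n) a b))
  (0≤-by (proj₁ (abs⇒ _ (+ 3 * b - (a + 1ℤ)) v₂)) (e₃ (+ n) a b))
  (0≤-by (proj₂ (abs⇒ _ (+ 3 * (b + 1ℤ) - a) v₃)) (e₄ (+ n) a b))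
  where
  e₂ : ∀ N a b → N + 1ℤ - (a + 1ℤ + (b + 1ℤ)) ≡ N - 1ℤ - (a + b)
  e₂ = solve-∀
  e₃ : ∀ N a b → N + + 3 + (+ 3 * b - (a + 1ℤ)) ≡ N + + 2 + (+ 3 * b - a)
  e₃ = solve-∀
  e₄ : ∀ N a b → N + + 3 - (+ 3 * (b + 1ℤ) - a) ≡ N - (+ 3 * b - a)
  e₄ = solve-∀

allowed : ∀ n x y → 0≤ (+ n + 1ℤ + (x + y)) → 0≤ (+ n + 1ℤ - (x + y)) →
          0≤ (+ n + + 3 + (+ 3 * y - x)) → 0≤ (+ n + + 3 - (+ 3 * y - x)) → AllowedVertex n x y
allowed n x y p q r t = abs⇐ _ (x + y) p q , abs⇐ _ (+ 3 * y - x) r t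

bounds⇒inAP : ∀ n a b → Bounds (+ n) a b → InAP n (a , b)
bounds⇒inAP n a b (bounds p q r t) =
  allowed n a b p
    (0≤-by (q ⊕ 0≤+) (e1 (+ n) a b))
    (0≤-by (r ⊕ 0≤+) (e2 (+ n) a b))
    (0≤-by (t ⊕ 0≤+) (e3 (+ n) a b)) ,
  allowed n (a + 1ℤ) b (0≤-by (p ⊕ 0≤+) (e4 (+ n) a b))
    (0≤-by (q ⊕ 0≤+) (e5 (+ n) a b))
    (0≤-by r (e6 (+ n) a b))
    (0≤-by (t ⊕ 0≤+) (e7 (+ n) a b)) ,
  allowed n a (b + 1ℤ) (0≤-by (p ⊕ 0≤+) (e8 (+ n) a b))
    (0≤-by (q ⊕ 0≤+) (e9 (+ n) a b))
    (0≤-by (r ⊕ 0≤+) (e10 (+ n) a b))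
    (0≤-by t (e11 (+ n) a b)) ,
  allowed n (a + 1ℤ) (b + 1ℤ) (0≤-by (p ⊕ 0≤+) (e12 (+ n) a b))
    (0≤-by q (e13 (+ n) a b))
    (0≤-by (r ⊕ 0≤+) (e14 (+ n) a b))
    (0≤-by (t ⊕ 0≤+) (e15 (+ n) a b))
  where
  e1 : ∀ N a b → N - 1ℤ - (a + b) + + 2 ≡ N + 1ℤ - (a + b)
  e1 = solve-∀
  e2 : ∀ N a b → N + + 2 + (+ 3 * b - a) + + 1 ≡ N + + 3 + (+ 3 * b - a)
  e2 = solve-∀
  e3 : ∀ N a b → N - (+ 3 * b - a) + + 3 ≡ N + + 3 - (+ 3 * b - a)
  e3 = solve-∀
  e4 : ∀ N a b → N + 1ℤ + (a + b) + + 1 ≡ N + 1ℤ + (a + 1ℤ + b)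
  e4 = solve-∀
  e5 : ∀ N a b → N - 1ℤ - (a + b) + + 1 ≡ N + 1ℤ - (a + 1ℤ + b)
  e5 = solve-∀
  e6 : ∀ N a b → N + + 2 + (+ 3 * b - a) ≡ N + + 3 + (+ 3 * b - (a + 1ℤ))
  e6 = solve-∀
  e7 : ∀ N a b → N - (+ 3 * b - a) + + 4 ≡ N + + 3 - (+ 3 * b - (a + 1ℤ))
  e7 = solve-∀
  e8 : ∀ N a b → N + 1ℤ + (a + b) + + 1 ≡ N + 1ℤ + (a + (b + 1ℤ))
  e8 = solve-∀
  e9 : ∀ N a b → N - 1ℤ - (a + b) + + 1 ≡ N + 1ℤ - (a + (b + 1ℤ))
  e9 = solve-∀
  e10 : ∀ N a b → N + + 2 + (+ 3 * b - a) + + 4 ≡ N + + 3 + (+ 3 * (b + 1ℤ) - a)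
  e10 = solve-∀
  e11 : ∀ N a b → N - (+ 3 * b - a) ≡ N + + 3 - (+ 3 * (b + 1ℤ) - a)
  e11 = solve-∀
  e12 : ∀ N a b → N + 1ℤ + (a + b) + + 2 ≡ N + 1ℤ + (a + 1ℤ + (b + 1ℤ))
  e12 = solve-∀
  e13 : ∀ N a b → N - 1ℤ - (a + b) ≡ N + 1ℤ - (a + 1ℤ + (b + 1ℤ))
  e13 = solve-∀
  e14 : ∀ N a b → N + + 2 + (+ 3 * b - a) + + 3 ≡ N + + 3 + (+ 3 * (b + 1ℤ) - (a + 1ℤ))
  e14 = solve-∀
  e15 : ∀ N a b → N - (+ 3 * b - a) + + 1 ≡ N + + 3 - (+ 3 * (b + 1ℤ) - (a + 1ℤ))
  e15 = solve-∀

0≤-absurd : ∀ {A : Set} {i j} k → 0≤ i → 0≤ j → i + j ≡ -[1+ k ] → A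
0≤-absurd k p q eq = 0≰-1 k (0≤-by (p ⊕ q) eq)

0≤-suc : ∀ {i j} → 0≤ (i - j) → i ≢ j → 0≤ (i - j - 1ℤ)
0≤-suc {i} {j} p ne =
  0≤-by (ℤ.i≤j⇒0≤j-i (ℤ.i<j⇒suc[i]≤j (ℤ.≤∧≢⇒< (ℤ.0≤i-j⇒j≤i p) (ne ∘ sym)))) (e i j)
  where
  e : ∀ i j → i - (1ℤ + j) ≡ i - j - 1ℤ
  e = solve-∀

inRow⇒ : ∀ k {x y a b} → InRow x y (ones {k}) (a , b) →
         b ≡ y × 0≤ (a - x) × 0≤ (x + + k - 1ℤ - a)
inRow⇒ (suc k) {x} {a = a} (inj₁ (_ , refl)) =
  refl , 0≤-by (0≤+ {0}) (e₁ x) , 0≤-by (0≤+ {k}) (e₂ x (+ k))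
  where
  e₁ : ∀ x → 0ℤ ≡ x - x
  e₁ = solve-∀
  e₂ : ∀ x k → k ≡ x + (1ℤ + k) - 1ℤ - x
  e₂ = solve-∀
inRow⇒ (suc k) {x} {a = a} (inj₂ r) with inRow⇒ k r
... | e , p , q = e , 0≤-by (p ⊕ 0≤+ {1}) (e₁ x a) , 0≤-by q (e₂ x a (+ k))
  where
  e₁ : ∀ x a → a - (x + 1ℤ) + + 1 ≡ a - x
  e₁ = solve-∀
  e₂ : ∀ x a k → x + 1ℤ + k - 1ℤ - a ≡ x + (1ℤ + k) - 1ℤ - a
  e₂ = solve-∀

inRow⇐ : ∀ k {x a} b → 0≤ (a - x) → 0≤ (x + + k - 1ℤ - a) → InRow x b (ones {k}) (a , b)
inRow⇐ zero {x} {a} b p q = 0≤-absurd 0 p q (e x a)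
  where
  e : ∀ x a → a - x + (x + 0ℤ - 1ℤ - a) ≡ -1ℤ
  e = solve-∀
inRow⇐ (suc k) {x} {a} b p q with a ℤ.≟ x
... | yes refl = inj₁ (tt , refl)
... | no ne = inj₂ (inRow⇐ k b (0≤-by (0≤-suc p ne) (e₁ x a)) (0≤-by q (e₂ x a (+ k))))
  where
  e₁ : ∀ x a → a - x - 1ℤ ≡ a - (x + 1ℤ)
  e₁ = solve-∀
  e₂ : ∀ x a k → x + (1ℤ + k) - 1ℤ - a ≡ x + 1ℤ + k - 1ℤ - a
  e₂ = solve-∀

double-+ : ∀ n → + double n ≡ + n + + n
double-+ zero    = refl
double-+ (suc n) = trans (cong (λ i → 1ℤ + (1ℤ + i)) (double-+ n)) (e (+ n))
  where
  e : ∀ n → 1ℤ + (1ℤ + (n + n)) ≡ 1ℤ + n + (1ℤ + n)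
  e = solve-∀

-- Per unit of depth `y - b` the left end moves in by one cell and the right end by three. Hence
-- passing to `x + 1`, `y - 1`, `N - 2` leaves the last two bounds unchanged.
record LowerBounds (N x y a b : ℤ) : Set where
  constructor bounds
  field
    b₁ : 0≤ (y - b)
    b₂ : 0≤ (a - x - (y - b))
    b₃ : 0≤ (x + (N + N) - 1ℤ - + 3 * (y - b) - a)

rowLower : ∀ n {x y} c → InRow x y (ones {double n}) c → LowerBounds (+ n) x y (proj₁ c) (proj₂ c)
rowLower n {x} (a , b) r with inRow⇒ (double n) r
... | refl , p , q rewrite double-+ n =
  bounds (0≤-by (0≤+ {0}) (e₁ b)) (0≤-by p (e₂ x a b)) (0≤-by q (e₃ (+ n) x a b))
  where
  e₁ : ∀ b → 0ℤ ≡ b - b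
  e₁ = solve-∀
  e₂ : ∀ x a b → a - x ≡ a - x - (b - b)
  e₂ = solve-∀
  e₃ : ∀ n x a b → x + (n + n) - 1ℤ - a ≡ x + (n + n) - 1ℤ - + 3 * (b - b) - a
  e₃ = solve-∀

lower⇒ : ∀ n {x y} c → Lower n x y c → LowerBounds (+ n) x y (proj₁ c) (proj₂ c)
lower⇒ (suc zero) c r = rowLower 1 c r
lower⇒ (suc (suc m)) c (inj₁ r) = rowLower (suc (suc m)) c r
lower⇒ (suc (suc m)) {x} {y} (a , b) (inj₂ l) with lower⇒ m (a , b) l
... | bounds p q r = bounds
  (0≤-by (p ⊕ 0≤+ {1}) (e₁ y b)) (0≤-by q (e₂ x y a b)) (0≤-by r (e₃ (+ m) x y a b))
  where
  e₁ : ∀ y b → y - 1ℤ - b + + 1 ≡ y - b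
  e₁ = solve-∀
  e₂ : ∀ x y a b → a - (x + 1ℤ) - (y - 1ℤ - b) ≡ a - x - (y - b)
  e₂ = solve-∀
  e₃ : ∀ m x y a b → x + 1ℤ + (m + m) - 1ℤ - + 3 * (y - 1ℤ - b) - a ≡
       x + (1ℤ + (1ℤ + m) + (1ℤ + (1ℤ + m))) - 1ℤ - + 3 * (y - b) - a
  e₃ = solve-∀

lowerRow : ∀ n {x} a b → LowerBounds (+ n) x b a b → InRow x b (ones {double n}) (a , b)
lowerRow n {x} a b (bounds p q r) =
  inRow⇐ (double n) b (0≤-by q (e₂ x a b))
    (0≤-by r (trans (e₃ (+ n) x a b) (cong (λ i → x + i - 1ℤ - a) (sym (double-+ n)))))
  where
  e₂ : ∀ x a b → a - x - (b - b) ≡ a - x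
  e₂ = solve-∀
  e₃ : ∀ n x a b → x + (n + n) - 1ℤ - + 3 * (b - b) - a ≡ x + (n + n) - 1ℤ - a
  e₃ = solve-∀

lower⇐ : ∀ n {x y} a b → LowerBounds (+ n) x y a b → Lower n x y (a , b)
-- Rows shrink by four cells per unit of depth, so four copies of `p` cancel the depth in the sum of
-- the two horizontal bounds.
lower⇐ zero {x} {y} a b (bounds p q r) = 0≤-absurd 0 (p ⊕ p ⊕ p ⊕ p) (q ⊕ r) (e x y a b)
  where
  e : ∀ x y a b → y - b + (y - b) + (y - b) + (y - b) +
      (a - x - (y - b) + (x + (0ℤ + 0ℤ) - 1ℤ - + 3 * (y - b) - a)) ≡ -1ℤ
  e = solve-∀
lower⇐ (suc zero) {x} {y} a b l@(bounds p q r) with y ℤ.≟ b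
... | yes refl = lowerRow 1 a b l
... | no ne = 0≤-absurd 2 (p′ ⊕ p′ ⊕ p′ ⊕ p′) (q ⊕ r) (e x y a b)
  where
  p′ = 0≤-suc p ne
  e : ∀ x y a b → y - b - 1ℤ + (y - b - 1ℤ) + (y - b - 1ℤ) + (y - b - 1ℤ) +
      (a - x - (y - b) + (x + (1ℤ + 1ℤ) - 1ℤ - + 3 * (y - b) - a)) ≡ -[1+ 2 ]
  e = solve-∀
lower⇐ (suc (suc m)) {x} {y} a b l@(bounds p q r) with y ℤ.≟ b
... | yes refl = inj₁ (lowerRow (suc (suc m)) a b l)
... | no ne = inj₂ (lower⇐ m a b (bounds
  (0≤-by (0≤-suc p ne) (e₁ y b)) (0≤-by q (e₂ x y a b)) (0≤-by r (e₃ (+ m) x y a b))))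
  where
  e₁ : ∀ y b → y - b - 1ℤ ≡ y - 1ℤ - b
  e₁ = solve-∀
  e₂ : ∀ x y a b → a - x - (y - b) ≡ a - (x + 1ℤ) - (y - 1ℤ - b)
  e₂ = solve-∀
  e₃ : ∀ m x y a b →
       x + (1ℤ + (1ℤ + m) + (1ℤ + (1ℤ + m))) - 1ℤ - + 3 * (y - b) - a ≡
       x + 1ℤ + (m + m) - 1ℤ - + 3 * (y - 1ℤ - b) - a
  e₃ = solve-∀

-- The slopes of `LowerBounds` with left and right exchanged. The bottom row itself is excluded,
-- whence the `- 1ℤ` in the height.
record UpperBounds (N x y a b : ℤ) : Set where
  constructor bounds
  field
    b₁ : 0≤ (b - y - 1ℤ)
    b₂ : 0≤ (a - x - + 3 * (b - y))
    b₃ : 0≤ (x + (N + N) - 1ℤ - (b - y) - a)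

upper⇒ : ∀ n {x y} c → Upper n x y c → UpperBounds (+ n) x y (proj₁ c) (proj₂ c)
upper⇒ (suc (suc m)) {x} {y} (a , b) (inj₁ r) with inRow⇒ (double m) r
... | refl , p , q rewrite double-+ m =
  bounds (0≤-by (0≤+ {0}) (e₁ y)) (0≤-by p (e₂ x a y)) (0≤-by q (e₃ (+ m) x a y))
  where
  e₁ : ∀ y → 0ℤ ≡ y + 1ℤ - y - 1ℤ
  e₁ = solve-∀
  e₂ : ∀ x a y → a - (x + 1ℤ + 1ℤ + 1ℤ) ≡ a - x - + 3 * (y + 1ℤ - y)
  e₂ = solve-∀
  e₃ : ∀ m x a y → x + 1ℤ + 1ℤ + 1ℤ + (m + m) - 1ℤ - a ≡
       x + (1ℤ + (1ℤ + m) + (1ℤ + (1ℤ + m))) - 1ℤ - (y + 1ℤ - y) - a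
  e₃ = solve-∀
upper⇒ (suc (suc m)) {x} {y} (a , b) (inj₂ u) with upper⇒ m (a , b) u
... | bounds p q r = bounds
  (0≤-by (p ⊕ 0≤+ {1}) (e₁ y b)) (0≤-by q (e₂ x y a b)) (0≤-by r (e₃ (+ m) x y a b))
  where
  e₁ : ∀ y b → b - (y + 1ℤ) - 1ℤ + + 1 ≡ b - y - 1ℤ
  e₁ = solve-∀
  e₂ : ∀ x y a b → a - (x + 1ℤ + 1ℤ + 1ℤ) - + 3 * (b - (y + 1ℤ)) ≡ a - x - + 3 * (b - y)
  e₂ = solve-∀
  e₃ : ∀ m x y a b → x + 1ℤ + 1ℤ + 1ℤ + (m + m) - 1ℤ - (b - (y + 1ℤ)) - a ≡
       x + (1ℤ + (1ℤ + m) + (1ℤ + (1ℤ + m))) - 1ℤ - (b - y) - a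
  e₃ = solve-∀

upper⇐ : ∀ n {x y} a b → UpperBounds (+ n) x y a b → Upper n x y (a , b)
upper⇐ zero {x} {y} a b (bounds p q r) = 0≤-absurd 4 (p ⊕ p ⊕ p ⊕ p) (q ⊕ r) (e x y a b)
  where
  e : ∀ x y a b → b - y - 1ℤ + (b - y - 1ℤ) + (b - y - 1ℤ) + (b - y - 1ℤ) +
      (a - x - + 3 * (b - y) + (x + (0ℤ + 0ℤ) - 1ℤ - (b - y) - a)) ≡ -[1+ 4 ]
  e = solve-∀
upper⇐ (suc zero) {x} {y} a b (bounds p q r) = 0≤-absurd 2 (p ⊕ p ⊕ p ⊕ p) (q ⊕ r) (e x y a b)
  where
  e : ∀ x y a b → b - y - 1ℤ + (b - y - 1ℤ) + (b - y - 1ℤ) + (b - y - 1ℤ) +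
      (a - x - + 3 * (b - y) + (x + (1ℤ + 1ℤ) - 1ℤ - (b - y) - a)) ≡ -[1+ 2 ]
  e = solve-∀
upper⇐ (suc (suc m)) {x} {y} a b (bounds p q r) with b ℤ.≟ y + 1ℤ
... | yes refl = inj₁ (inRow⇐ (double m) _ (0≤-by q (e₂ x a y))
        (0≤-by r (trans (e₃ (+ m) x a y)
          (cong (λ i → x + 1ℤ + 1ℤ + 1ℤ + i - 1ℤ - a) (sym (double-+ m))))))
  where
  e₂ : ∀ x a y → a - x - + 3 * (y + 1ℤ - y) ≡ a - (x + 1ℤ + 1ℤ + 1ℤ)
  e₂ = solve-∀
  e₃ : ∀ m x a y → x + (1ℤ + (1ℤ + m) + (1ℤ + (1ℤ + m))) - 1ℤ - (y + 1ℤ - y) - a ≡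
       x + 1ℤ + 1ℤ + 1ℤ + (m + m) - 1ℤ - a
  e₃ = solve-∀
... | no ne = inj₂ (upper⇐ m a b (bounds
  (0≤-suc (0≤-by p (e₁ y b)) ne) (0≤-by q (e₂ x y a b)) (0≤-by r (e₃ (+ m) x y a b))))
  where
  e₁ : ∀ y b → b - y - 1ℤ ≡ b - (y + 1ℤ)
  e₁ = solve-∀
  e₂ : ∀ x y a b → a - x - + 3 * (b - y) ≡ a - (x + 1ℤ + 1ℤ + 1ℤ) - + 3 * (b - (y + 1ℤ))
  e₂ = solve-∀
  e₃ : ∀ m x y a b → x + (1ℤ + (1ℤ + m) + (1ℤ + (1ℤ + m))) - 1ℤ - (b - y) - a ≡
       x + 1ℤ + 1ℤ + 1ℤ + (m + m) - 1ℤ - (b - (y + 1ℤ)) - a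
  e₃ = solve-∀

Rows : ℕ → Cell → Set
Rows n c = Lower n (- + n) -1ℤ c ⊎ InRow (- + n) 0ℤ (ones {double n}) c ⊎ Upper n (- + n) 0ℤ c

rows⇒inAP : ∀ n c → Rows n c → InAP n c
rows⇒inAP n (a , b) (inj₁ l) with lower⇒ n (a , b) l
... | bounds p q r = bounds⇒inAP n a b (bounds
  (0≤-by q (e₁ (+ n) a b))
  (0≤-by (r ⊕ (p ⊕ p ⊕ p ⊕ p ⊕ 0≤+ {1})) (e₂ (+ n) a b))
  (0≤-by r (e₃ (+ n) a b))
  (0≤-by (q ⊕ (p ⊕ p ⊕ p ⊕ p ⊕ 0≤+ {3})) (e₄ (+ n) a b)))
  where
  e₁ : ∀ N a b → a - (- N) - (-1ℤ - b) ≡ N + 1ℤ + (a + b)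
  e₁ = solve-∀
  e₂ : ∀ N a b → - N + (N + N) - 1ℤ - + 3 * (-1ℤ - b) - a +
       (-1ℤ - b + (-1ℤ - b) + (-1ℤ - b) + (-1ℤ - b) + + 1) ≡ N - 1ℤ - (a + b)
  e₂ = solve-∀
  e₃ : ∀ N a b → - N + (N + N) - 1ℤ - + 3 * (-1ℤ - b) - a ≡ N + + 2 + (+ 3 * b - a)
  e₃ = solve-∀
  e₄ : ∀ N a b → a - (- N) - (-1ℤ - b) +
       (-1ℤ - b + (-1ℤ - b) + (-1ℤ - b) + (-1ℤ - b) + + 3) ≡ N - (+ 3 * b - a)
  e₄ = solve-∀
rows⇒inAP n (a , b) (inj₂ (inj₁ r)) with inRow⇒ (double n) r
... | refl , p , q rewrite double-+ n = bounds⇒inAP n a 0ℤ (bounds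
  (0≤-by (p ⊕ 0≤+ {1}) (e₁ (+ n) a))
  (0≤-by q (e₂ (+ n) a))
  (0≤-by (q ⊕ 0≤+ {3}) (e₃ (+ n) a))
  (0≤-by p (e₄ (+ n) a)))
  where
  e₁ : ∀ N a → a - (- N) + + 1 ≡ N + 1ℤ + (a + 0ℤ)
  e₁ = solve-∀
  e₂ : ∀ N a → - N + (N + N) - 1ℤ - a ≡ N - 1ℤ - (a + 0ℤ)
  e₂ = solve-∀
  e₃ : ∀ N a → - N + (N + N) - 1ℤ - a + + 3 ≡ N + + 2 + (0ℤ - a)
  e₃ = solve-∀
  e₄ : ∀ N a → a - (- N) ≡ N - (0ℤ - a)
  e₄ = solve-∀
rows⇒inAP n (a , b) (inj₂ (inj₂ u)) with upper⇒ n (a , b) u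
... | bounds p q r = bounds⇒inAP n a b (bounds
  (0≤-by (q ⊕ (p ⊕ p ⊕ p ⊕ p ⊕ 0≤+ {5})) (e₁ (+ n) a b))
  (0≤-by r (e₂ (+ n) a b))
  (0≤-by (r ⊕ (p ⊕ p ⊕ p ⊕ p ⊕ 0≤+ {7})) (e₃ (+ n) a b))
  (0≤-by q (e₄ (+ n) a b)))
  where
  e₁ : ∀ N a b → a - (- N) - + 3 * (b - 0ℤ) +
       (b - 0ℤ - 1ℤ + (b - 0ℤ - 1ℤ) + (b - 0ℤ - 1ℤ) + (b - 0ℤ - 1ℤ) + + 5) ≡ N + 1ℤ + (a + b)
  e₁ = solve-∀
  e₂ : ∀ N a b → - N + (N + N) - 1ℤ - (b - 0ℤ) - a ≡ N - 1ℤ - (a + b)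
  e₂ = solve-∀
  e₃ : ∀ N a b → - N + (N + N) - 1ℤ - (b - 0ℤ) - a +
       (b - 0ℤ - 1ℤ + (b - 0ℤ - 1ℤ) + (b - 0ℤ - 1ℤ) + (b - 0ℤ - 1ℤ) + + 7) ≡ N + + 2 + (+ 3 * b - a)
  e₃ = solve-∀
  e₄ : ∀ N a b → a - (- N) - + 3 * (b - 0ℤ) ≡ N - (+ 3 * b - a)
  e₄ = solve-∀

inAP⇒rows : ∀ n c → InAP n c → Rows n c
inAP⇒rows n (a , b@(-[1+ k ])) i with inAP⇒bounds n a b i
... | bounds p q r t = inj₁ (lower⇐ n a b (bounds
  (0≤+ {k}) (0≤-by p (e₁ (+ n) a b)) (0≤-by r (e₃ (+ n) a b))))
  where
  e₁ : ∀ N a b → N + 1ℤ + (a + b) ≡ a - (- N) - (-1ℤ - b)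
  e₁ = solve-∀
  e₃ : ∀ N a b → N + + 2 + (+ 3 * b - a) ≡ - N + (N + N) - 1ℤ - + 3 * (-1ℤ - b) - a
  e₃ = solve-∀
inAP⇒rows n (a , + zero) i with inAP⇒bounds n a 0ℤ i
... | bounds p q r t = inj₂ (inj₁ (inRow⇐ (double n) 0ℤ (0≤-by t (e₄ (+ n) a))
    (0≤-by q (trans (e₂ (+ n) a) (cong (λ i → - + n + i - 1ℤ - a) (sym (double-+ n)))))))
  where
  e₂ : ∀ N a → N - 1ℤ - (a + 0ℤ) ≡ - N + (N + N) - 1ℤ - a
  e₂ = solve-∀
  e₄ : ∀ N a → N - (0ℤ - a) ≡ a - (- N)
  e₄ = solve-∀
inAP⇒rows n (a , b@(+ suc k)) i with inAP⇒bounds n a b i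
... | bounds p q r t = inj₂ (inj₂ (upper⇐ n a b (bounds
  (0≤-by (0≤+ {k}) (e₀ (+ k))) (0≤-by t (e₄ (+ n) a b)) (0≤-by q (e₂ (+ n) a b)))))
  where
  e₀ : ∀ k → k ≡ 1ℤ + k - 0ℤ - 1ℤ
  e₀ = solve-∀
  e₄ : ∀ N a b → N - (+ 3 * b - a) ≡ a - (- N) - + 3 * (b - 0ℤ)
  e₄ = solve-∀
  e₂ : ∀ N a b → N - 1ℤ - (a + b) ≡ - N + (N + N) - 1ℤ - (b - 0ℤ) - a
  e₂ = solve-∀

count-pillow : ∀ n → Count (InAP n) (lowerSum n (upperSum n))
count-pillow n = count-cong (rows⇒inAP n , inAP⇒rows n)
  (count-lower n {y = -1ℤ}
    (record { above = λ c u → ℤ.<-trans ℤ.-<+ (upper-y n c u)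
            ; outside = λ c u r → ℤ.<⇒≢ (upper-y n c u) (sym (inRow-y (ones {double n}) r)) })
    (count-upper n))

count-tilings : ∀ n → HasCount (tilings n) (lowerSum n (upperSum n))
count-tilings n = count-↔ record
  { to        = λ t → record { Tiling t }
  ; from      = λ t → record { TilingOf t }
  ; to-cong   = id
  ; from-cong = id
  ; inverse   = id , id
  } (count-pillow n)

-- Linear functionals and the symmetry of the row transfer

-- Sums over partial tilings are treated as functionals of the weight, so that they can be
-- interchanged and scaled without enumerating tilings.
record Linear {A : Set} (Φ : (A → ℤ) → ℤ) : Set where
  field
    ext   : ∀ {W W′} → (∀ a → W a ≡ W′ a) → Φ W ≡ Φ W′
    plus  : ∀ W W′ → Φ (λ a → W a + W′ a) ≡ Φ W + Φ W′
    scale : ∀ u W → Φ (λ a → u * W a) ≡ u * Φ W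

  null : Φ (λ _ → 0ℤ) ≡ 0ℤ
  null = scale 0ℤ (λ _ → 0ℤ)

open Linear

linear-eval : ∀ {A : Set} (a : A) → Linear (λ W → W a)
linear-eval a = record { ext = λ e → e a ; plus = λ _ _ → refl ; scale = λ _ _ → refl }

linear-0 : ∀ {A : Set} → Linear {A} (λ _ → 0ℤ)
linear-0 = record { ext = λ _ → refl ; plus = λ _ _ → refl ; scale = λ u _ → sym (ℤ.*-zeroʳ u) }

linear-∘ : ∀ {A B : Set} {Φ : (B → ℤ) → ℤ} (f : B → A) → Linear Φ → Linear (λ W → Φ (W ∘ f))
linear-∘ f l = record { ext = λ e → ext l (e ∘ f) ; plus = λ W W′ → plus l _ _ ; scale = λ u W → scale l u _ }

linear-+ : ∀ {A : Set} {Φ Ψ : (A → ℤ) → ℤ} → Linear Φ → Linear Ψ → Linear (λ W → Φ W + Ψ W)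
linear-+ {Φ = Φ} {Ψ} l m = record
  { ext   = λ e → cong₂ _+_ (ext l e) (ext m e)
  ; plus  = λ W W′ → trans (cong₂ _+_ (plus l W W′) (plus m W W′)) (swap (Φ W) _ _ _)
  ; scale = λ u W → trans (cong₂ _+_ (scale l u W) (scale m u W)) (sym (ℤ.*-distribˡ-+ u _ _))
  }
  where
  swap : ∀ a b c d → a + b + (c + d) ≡ a + c + (b + d)
  swap = solve-∀

linear-bind : ∀ {A B : Set} {Φ : (B → ℤ) → ℤ} {Ψ : B → (A → ℤ) → ℤ} →
              Linear Φ → (∀ b → Linear (Ψ b)) → Linear (λ W → Φ (λ b → Ψ b W))
linear-bind l m = record
  { ext   = λ e → ext l λ b → ext (m b) e
  ; plus  = λ W W′ → trans (ext l λ b → plus (m b) W W′) (plus l _ _)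
  ; scale = λ u W → trans (ext l λ b → scale (m b) u W) (scale l u _)
  }

mutual
  rowSum-linear : ∀ {k} (p ms : Vec Bool k) → Linear (rowSum p ms)
  rowSum-linear []          []           = linear-eval []
  rowSum-linear (false ∷ p) (m ∷ ms)     = linear-∘ (m ∷_) (rowSum-linear p ms)
  rowSum-linear (true ∷ p)  (true ∷ ms)  =
    linear-+ (linear-∘ (true ∷_) (across-linear p ms)) (linear-∘ (false ∷_) (rowSum-linear p ms))
  rowSum-linear (true ∷ p)  (false ∷ ms) =
    linear-+ (linear-∘ (false ∷_) (across-linear p ms)) linear-0

  across-linear : ∀ {k} (p ms : Vec Bool k) → Linear (across p ms)
  across-linear []          ms       = linear-0
  across-linear (false ∷ p) ms       = linear-0
  across-linear (true ∷ p)  (m ∷ ms) = linear-∘ (m ∷_) (rowSum-linear p ms)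

lowerSum-linear : ∀ n → Linear (lowerSum n)
lowerSum-linear zero          = linear-eval []
lowerSum-linear (suc zero)    = rowSum-linear (ones {2}) ones
lowerSum-linear (suc (suc m)) = linear-bind (lowerSum-linear m) (λ b → rowSum-linear (pad b) ones)

module _ {A : Set} {Φ : (A → ℤ) → ℤ} (l : Linear Φ) where mutual

  -- A row sum is built from evaluations by addition, so it commutes with every linear functional.
  -- This reconciles the opposite orders in which the two halves process their rows.
  rowSum-comm : ∀ {k} (p ms : Vec Bool k) (W : Vec Bool k → A → ℤ) →
                rowSum p ms (λ q → Φ (W q)) ≡ Φ (λ a → rowSum p ms (λ q → W q a))
  rowSum-comm []          []           W = refl
  rowSum-comm (false ∷ p) (m ∷ ms)     W = rowSum-comm p ms (W ∘ (m ∷_))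
  rowSum-comm (true ∷ p)  (true ∷ ms)  W =
    trans (cong₂ _+_ (across-comm p ms (W ∘ (true ∷_))) (rowSum-comm p ms (W ∘ (false ∷_))))
          (sym (plus l _ _))
  rowSum-comm (true ∷ p)  (false ∷ ms) W =
    trans (cong₂ _+_ (across-comm p ms (W ∘ (false ∷_))) (sym (null l))) (sym (plus l _ _))

  across-comm : ∀ {k} (p ms : Vec Bool k) (W : Vec Bool k → A → ℤ) →
                across p ms (λ q → Φ (W q)) ≡ Φ (λ a → across p ms (λ q → W q a))
  across-comm []          ms       W = sym (null l)
  across-comm (false ∷ p) ms       W = sym (null l)
  across-comm (true ∷ p)  (m ∷ ms) W = rowSum-comm p ms (W ∘ (m ∷_))

-- Symmetry of the row transfer under reversal

δ : ∀ {k} → Vec Bool k → Vec Bool k → ℤ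
δ []      []      = 1ℤ
δ (a ∷ p) (b ∷ q) = if a xor b then 0ℤ else δ p q

δ-refl : ∀ {k} (p : Vec Bool k) → δ p p ≡ 1ℤ
δ-refl []          = refl
δ-refl (true ∷ p)  = δ-refl p
δ-refl (false ∷ p) = δ-refl p

δ-≢ : ∀ {k} (p q : Vec Bool k) → p ≢ q → δ p q ≡ 0ℤ
δ-≢ []          []          ne = contradiction refl ne
δ-≢ (true ∷ p)  (true ∷ q)  ne = δ-≢ p q (ne ∘ cong (true ∷_))
δ-≢ (true ∷ p)  (false ∷ q) ne = refl
δ-≢ (false ∷ p) (true ∷ q)  ne = refl
δ-≢ (false ∷ p) (false ∷ q) ne = δ-≢ p q (ne ∘ cong (false ∷_))

δ-reverse : ∀ {k} (p q : Vec Bool k) → δ p (reverse q) ≡ δ q (reverse p)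
δ-reverse p q with Vec.≡-dec Bool._≟_ p (reverse q)
... | yes refl = trans (δ-refl p) (sym (trans (cong (δ q) (Vec.reverse-involutive q)) (δ-refl q)))
... | no ne = trans (δ-≢ p _ ne) (sym (δ-≢ q _ λ { refl → ne (sym (Vec.reverse-involutive p)) }))

-- Automaton for the pairs (p , q) such that p can be tiled by horizontal dominoes and vertical
-- dominoes onto the complement of q; state true means that a horizontal domino is to be completed.
-- Its transition matrices are symmetric.
step : Bool → Bool → Bool → (Bool → ℤ) → ℤ
step true  true  s F = F (not s)
step true  false s F = if s then 0ℤ else F false
step false true  s F = if s then 0ℤ else F false
step false false s F = 0ℤ

run : ∀ {k} → Bool → Bool → Vec Bool k → Vec Bool k → ℤ
run s s′ []      []      = if s xor s′ then 0ℤ else 1ℤ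
run s s′ (a ∷ p) (b ∷ q) = step a b s (λ u → run u s′ p q)

step-cong : ∀ a b s {F G} → (∀ u → F u ≡ G u) → step a b s F ≡ step a b s G
step-cong true  true  s     e = e (not s)
step-cong true  false true  e = refl
step-cong true  false false e = e false
step-cong false true  true  e = refl
step-cong false true  false e = e false
step-cong false false s     e = refl

step-sym : ∀ a b s F → step a b s F ≡ step b a s F
step-sym true  true  s F = refl
step-sym true  false s F = refl
step-sym false true  s F = refl
step-sym false false s F = refl

step-0 : ∀ a b s → step a b s (λ _ → 0ℤ) ≡ 0ℤ
step-0 true  true  s     = refl
step-0 true  false true  = refl
step-0 true  false false = refl
step-0 false true  true  = refl
step-0 false true  false = refl
step-0 false false s     = refl

step-comm : ∀ a b a′ b′ s s′ (F : Bool → Bool → ℤ) →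
  step a b s (λ u → step a′ b′ s′ (F u)) ≡ step a′ b′ s′ (λ u′ → step a b s (λ u → F u u′))
step-comm true  true  a′ b′ s     s′ F = refl
step-comm true  false a′ b′ true  s′ F = sym (step-0 a′ b′ s′)
step-comm true  false a′ b′ false s′ F = refl
step-comm false true  a′ b′ true  s′ F = sym (step-0 a′ b′ s′)
step-comm false true  a′ b′ false s′ F = refl
step-comm false false a′ b′ s     s′ F = sym (step-0 a′ b′ s′)

-- The last letter acts on the final state. That it acts by the same `step` as on an initial state
-- is the symmetry of the transition matrices; `step-comm` carries it past the preceding letters.
run-∷ʳ : ∀ {k} s s′ (p q : Vec Bool k) a b →
  run s s′ (p ∷ʳ a) (q ∷ʳ b) ≡ step a b s′ (λ u → run s u p q)
run-∷ʳ s     s′    (a′ ∷ p) (b′ ∷ q) a b =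
  trans (step-cong a′ b′ s (λ u → run-∷ʳ u s′ p q a b)) (step-comm a′ b′ a b s s′ _)
run-∷ʳ false false [] [] true  true  = refl
run-∷ʳ false true  [] [] true  true  = refl
run-∷ʳ true  false [] [] true  true  = refl
run-∷ʳ true  true  [] [] true  true  = refl
run-∷ʳ false false [] [] true  false = refl
run-∷ʳ false true  [] [] true  false = refl
run-∷ʳ true  false [] [] true  false = refl
run-∷ʳ true  true  [] [] true  false = refl
run-∷ʳ false false [] [] false true  = refl
run-∷ʳ false true  [] [] false true  = refl
run-∷ʳ true  false [] [] false true  = refl
run-∷ʳ true  true  [] [] false true  = refl
run-∷ʳ s     s′    [] [] false false = refl

run-reverse : ∀ {k} s s′ (p q : Vec Bool k) → run s s′ (reverse p) (reverse q) ≡ run s′ s p q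
run-reverse false false [] [] = refl
run-reverse false true  [] [] = refl
run-reverse true  false [] [] = refl
run-reverse true  true  [] [] = refl
run-reverse s s′ (a ∷ p) (b ∷ q) rewrite Vec.reverse-∷ a p | Vec.reverse-∷ b q =
  trans (run-∷ʳ s s′ (reverse p) (reverse q) a b) (step-cong a b s′ (λ u → run-reverse s u p q))

run-sym : ∀ {k} s s′ (p q : Vec Bool k) → run s s′ p q ≡ run s s′ q p
run-sym s s′ []      []      = refl
run-sym s s′ (a ∷ p) (b ∷ q) = trans (step-cong a b s (λ u → run-sym u s′ p q)) (step-sym a b s _)

mutual
  rowSum-δ : ∀ {k} (p q : Vec Bool k) → rowSum p ones (λ r → δ r q) ≡ run false false p q
  rowSum-δ []          []          = refl
  rowSum-δ (false ∷ p) (true ∷ q)  = rowSum-δ p q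
  rowSum-δ (false ∷ p) (false ∷ q) = null (rowSum-linear p ones)
  rowSum-δ (true ∷ p)  (true ∷ q)  =
    trans (cong₂ _+_ (across-δ p q) (null (rowSum-linear p ones))) (ℤ.+-identityʳ _)
  rowSum-δ (true ∷ p)  (false ∷ q) =
    trans (cong₂ _+_ (null (across-linear p ones)) (rowSum-δ p q)) (ℤ.+-identityˡ _)

  across-δ : ∀ {k} (p q : Vec Bool k) → across p ones (λ r → δ r q) ≡ run true false p q
  across-δ []          []          = refl
  across-δ (false ∷ p) (true ∷ q)  = refl
  across-δ (false ∷ p) (false ∷ q) = refl
  across-δ (true ∷ p)  (true ∷ q)  = rowSum-δ p q
  across-δ (true ∷ p)  (false ∷ q) = null (rowSum-linear p ones)

-- A masked position is simulated by a present cell that no domino may cover from below: `q` has to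
-- contain it, and `W` is told that it is absent. Row sums with a mask thereby reduce to row sums
-- without one.
guard : ∀ {k} → Vec Bool k → Vec Bool k → (Vec Bool k → ℤ) → ℤ
guard []           []          W = W []
guard (true ∷ ms)  (a ∷ q)     W = guard ms q (W ∘ (a ∷_))
guard (false ∷ ms) (true ∷ q)  W = guard ms q (W ∘ (false ∷_))
guard (false ∷ ms) (false ∷ q) W = 0ℤ

mutual
  rowSum-guard : ∀ {k} (p ms : Vec Bool k) W → rowSum p ms W ≡ rowSum p ones (λ q → guard ms q W)
  rowSum-guard []          []           W = refl
  rowSum-guard (false ∷ p) (true ∷ ms)  W = rowSum-guard p ms _
  rowSum-guard (false ∷ p) (false ∷ ms) W = rowSum-guard p ms _
  rowSum-guard (true ∷ p)  (true ∷ ms)  W = cong₂ _+_ (across-guard p ms _) (rowSum-guard p ms _)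
  rowSum-guard (true ∷ p)  (false ∷ ms) W =
    cong₂ _+_ (across-guard p ms _) (sym (null (rowSum-linear p ones)))

  across-guard : ∀ {k} (p ms : Vec Bool k) W → across p ms W ≡ across p ones (λ q → guard ms q W)
  across-guard []          []           W = refl
  across-guard (false ∷ p) ms           W = refl
  across-guard (true ∷ p)  (true ∷ ms)  W = rowSum-guard p ms _
  across-guard (true ∷ p)  (false ∷ ms) W = rowSum-guard p ms _

init-∷ : ∀ {k} (a : Bool) (q : Vec Bool (suc k)) → init (a ∷ q) ≡ a ∷ init q
init-∷ a q with Data.Vec.initLast q
... | q′ , l , refl = refl

guard-ext : ∀ {k} (ms q : Vec Bool k) {W W′} → (∀ r → W r ≡ W′ r) → guard ms q W ≡ guard ms q W′
guard-ext []           []          e = e []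
guard-ext (true ∷ ms)  (a ∷ q)     e = guard-ext ms q (λ r → e (a ∷ r))
guard-ext (false ∷ ms) (true ∷ q)  e = guard-ext ms q (λ r → e (false ∷ r))
guard-ext (false ∷ ms) (false ∷ q) e = refl

guard-0 : ∀ {k} (ms q : Vec Bool k) → guard ms q (λ _ → 0ℤ) ≡ 0ℤ
guard-0 []           []          = refl
guard-0 (true ∷ ms)  (a ∷ q)     = guard-0 ms q
guard-0 (false ∷ ms) (true ∷ q)  = guard-0 ms q
guard-0 (false ∷ ms) (false ∷ q) = refl

guard-init : ∀ {k} (q : Vec Bool (suc k)) r →
             guard (ones ∷ʳ false) q (λ q′ → δ (init q′) r) ≡ δ q (r ∷ʳ true)
guard-init {zero}  (true ∷ [])  []      = refl
guard-init {zero}  (false ∷ []) []      = refl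
guard-init {suc k} (a ∷ q)      (b ∷ r) =
  trans (guard-ext (ones ∷ʳ false) q (λ q′ → cong (λ v → δ v (b ∷ r)) (init-∷ a q′))) (first a b)
  where
  first : ∀ a b → guard (ones ∷ʳ false) q (λ q′ → δ (a ∷ init q′) (b ∷ r)) ≡ δ (a ∷ q) (b ∷ (r ∷ʳ true))
  first true  true  = guard-init q r
  first true  false = guard-0 (ones ∷ʳ false) q
  first false true  = guard-0 (ones ∷ʳ false) q
  first false false = guard-init q r

guard-mid : ∀ {k} (q : Vec Bool (suc (suc (suc (suc k))))) r →
            guard innerMask q (λ q′ → δ (mid q′) r) ≡ δ q (true ∷ true ∷ true ∷ (r ∷ʳ true))
guard-mid (true ∷ true ∷ true ∷ q)  r = guard-init q r
guard-mid (true ∷ true ∷ false ∷ q) r = refl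
guard-mid (true ∷ false ∷ _ ∷ q)    r = refl
guard-mid (false ∷ _ ∷ _ ∷ q)       r = refl

reverse-∷ʳ : ∀ {A : Set} {k} (v : Vec A k) a → reverse (v ∷ʳ a) ≡ a ∷ reverse v
reverse-∷ʳ []      a = refl
reverse-∷ʳ (b ∷ v) a
  rewrite Vec.reverse-∷ b (v ∷ʳ a) | reverse-∷ʳ v a | Vec.reverse-∷ b v = refl

reverse-pad : ∀ {k} (b : Vec Bool k) → reverse (pad b) ≡ true ∷ true ∷ true ∷ (reverse b ∷ʳ true)
reverse-pad b
  rewrite Vec.reverse-∷ true (b ∷ʳ true ∷ʳ true ∷ʳ true) | reverse-∷ʳ (b ∷ʳ true ∷ʳ true) true
        | reverse-∷ʳ (b ∷ʳ true) true | reverse-∷ʳ b true = refl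

-- This is the rotation by 180°, on the level of weights. `upperSum` works from the middle outwards
-- and `lowerSum` from the outside inwards, so the row sum is first exchanged with the functional of
-- the smaller half. What remains concerns two adjacent rows: `run` is invariant under reversing
-- both and under exchanging them.
upperSum-lowerSum : ∀ n p → upperSum n p ≡ lowerSum n (λ q → δ p (reverse q))
upperSum-lowerSum zero [] = refl
upperSum-lowerSum (suc zero) (true ∷ true ∷ [])   = refl
upperSum-lowerSum (suc zero) (true ∷ false ∷ [])  = refl
upperSum-lowerSum (suc zero) (false ∷ true ∷ [])  = refl
upperSum-lowerSum (suc zero) (false ∷ false ∷ []) = refl
upperSum-lowerSum (suc (suc m)) p = begin
  rowSum p innerMask (λ q → upperSum m (mid q))
    ≡⟨ ext (rowSum-linear p innerMask) (λ q → upperSum-lowerSum m (mid q)) ⟩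
  rowSum p innerMask (λ q → lowerSum m (λ b → δ (mid q) (reverse b)))
    ≡⟨ rowSum-comm (lowerSum-linear m) p innerMask _ ⟩
  lowerSum m (λ b → rowSum p innerMask (λ q → δ (mid q) (reverse b)))
    ≡⟨ ext (lowerSum-linear m) same ⟩
  lowerSum m (λ b → rowSum (pad b) ones (λ q → δ p (reverse q))) ∎
  where
  open ≡-Reasoning
  same : ∀ b → rowSum p innerMask (λ q → δ (mid q) (reverse b)) ≡
               rowSum (pad b) ones (λ q → δ p (reverse q))
  same b = begin
    rowSum p innerMask (λ q → δ (mid q) (reverse b))
      ≡⟨ rowSum-guard p innerMask _ ⟩
    -- The three masked cells on the left and the one on the right are the reversed margin of
    -- `pad b`, so the guard completes `reverse b` to `reverse (pad b)`.
    rowSum p ones (λ q → guard innerMask q (λ q′ → δ (mid q′) (reverse b)))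
      ≡⟨ ext (rowSum-linear p ones) (λ q → guard-mid q (reverse b)) ⟩
    rowSum p ones (λ q → δ q (true ∷ true ∷ true ∷ (reverse b ∷ʳ true)))
      ≡⟨ cong (λ v → rowSum p ones (λ q → δ q v)) (reverse-pad b) ⟨
    rowSum p ones (λ q → δ q (reverse (pad b)))
      ≡⟨ rowSum-δ p (reverse (pad b)) ⟩
    run false false p (reverse (pad b))
      ≡⟨ cong (λ v → run false false v (reverse (pad b))) (Vec.reverse-involutive p) ⟨
    run false false (reverse (reverse p)) (reverse (pad b))
      ≡⟨ run-reverse false false (reverse p) (pad b) ⟩
    run false false (reverse p) (pad b)
      ≡⟨ run-sym false false (reverse p) (pad b) ⟩
    run false false (pad b) (reverse p)
      ≡⟨ rowSum-δ (pad b) (reverse p) ⟨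
    rowSum (pad b) ones (λ q → δ q (reverse p))
      ≡⟨ ext (rowSum-linear (pad b) ones) (λ q → δ-reverse q p) ⟩
    rowSum (pad b) ones (λ q → δ p (reverse q)) ∎

-- Alternating forms

infixl 6 _⊞_
infixr 7 _⊡_

_⊞_ : ∀ {N} → Vec ℤ N → Vec ℤ N → Vec ℤ N
_⊞_ = zipWith _+_

_⊡_ : ∀ {N} → ℤ → Vec ℤ N → Vec ℤ N
a ⊡ v = Data.Vec.map (a *_) v

𝟎 : ∀ {N} → Vec ℤ N
𝟎 = replicate _ 0ℤ

-- Defined on lists of every length, so that fixing vectors at the front or at the end gives a form
-- of the same kind. Adjacent repetitions suffice as an axiom; the others follow by swaps.
record Alternating {N} (D : List (Vec ℤ N) → ℤ) : Set where
  field
    additive    : ∀ xs u v ys → D (xs ⧺ (u ⊞ v) ∷ ys) ≡ D (xs ⧺ u ∷ ys) + D (xs ⧺ v ∷ ys)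
    homogeneous : ∀ xs a v ys → D (xs ⧺ (a ⊡ v) ∷ ys) ≡ a * D (xs ⧺ v ∷ ys)
    alternates  : ∀ xs v ys → D (xs ⧺ v ∷ v ∷ ys) ≡ 0ℤ

open Alternating

σ : ℕ → ℤ
σ zero    = 1ℤ
σ (suc k) = - σ k

σ² : ∀ k → σ k * σ k ≡ 1ℤ
σ² zero    = refl
σ² (suc k) = trans (e (σ k)) (σ² k)
  where
  e : ∀ a → - a * - a ≡ a * a
  e = solve-∀

module _ {N} {D : List (Vec ℤ N) → ℤ} (alt : Alternating D) where

  alternating-∷ : ∀ x → Alternating (D ∘ (x ∷_))
  alternating-∷ x = record
    { additive    = λ xs → additive alt (x ∷ xs)
    ; homogeneous = λ xs → homogeneous alt (x ∷ xs)
    ; alternates  = λ xs → alternates alt (x ∷ xs)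
    }

  alternating-⧺ : ∀ zs → Alternating (λ xs → D (xs ⧺ zs))
  alternating-⧺ zs = record
    { additive    = λ xs u v ys →
        trans (cong D (assoc xs _ ys)) (trans (additive alt xs u v (ys ⧺ zs))
          (cong₂ _+_ (cong D (sym (assoc xs u ys))) (cong D (sym (assoc xs v ys)))))
    ; homogeneous = λ xs a v ys →
        trans (cong D (assoc xs _ ys)) (trans (homogeneous alt xs a v (ys ⧺ zs))
          (cong (λ ws → a * D ws) (sym (assoc xs v ys))))
    ; alternates  = λ xs v ys →
        trans (cong D (assoc xs v (v ∷ ys))) (alternates alt xs v (ys ⧺ zs))
    }
    where
    assoc : ∀ xs (v : Vec ℤ N) ys → (xs ⧺ v ∷ ys) ⧺ zs ≡ xs ⧺ v ∷ (ys ⧺ zs)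
    assoc xs v ys = List.++-assoc xs (v ∷ ys) zs

  alternating-𝟎 : ∀ ys → D (𝟎 ∷ ys) ≡ 0ℤ
  alternating-𝟎 ys = trans (cong (λ v → D (v ∷ ys)) (sym (zero-⊡ N))) (homogeneous alt [] 0ℤ 𝟎 ys)
    where
    zero-⊡ : ∀ N → 0ℤ ⊡ 𝟎 {N} ≡ 𝟎
    zero-⊡ zero    = refl
    zero-⊡ (suc N) = cong (0ℤ ∷_) (zero-⊡ N)

  alternating-swap : ∀ u v ys → D (u ∷ v ∷ ys) ≡ - D (v ∷ u ∷ ys)
  alternating-swap u v ys = cancel (D (u ∷ v ∷ ys)) (D (v ∷ u ∷ ys)) (begin
    D (u ∷ v ∷ ys) + D (v ∷ u ∷ ys)
      ≡⟨ cong₂ _+_ (trans (sym (ℤ.+-identityˡ (D (u ∷ v ∷ ys)))) (cong (_+ D (u ∷ v ∷ ys)) (sym (alternates alt [] u ys))))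
                   (trans (sym (ℤ.+-identityʳ (D (v ∷ u ∷ ys)))) (cong (λ z → D (v ∷ u ∷ ys) + z) (sym (alternates alt [] v ys)))) ⟩
    (D (u ∷ u ∷ ys) + D (u ∷ v ∷ ys)) + (D (v ∷ u ∷ ys) + D (v ∷ v ∷ ys))
      ≡⟨ cong₂ _+_ (additive alt (u ∷ []) u v ys) (additive alt (v ∷ []) u v ys) ⟨
    D (u ∷ (u ⊞ v) ∷ ys) + D (v ∷ (u ⊞ v) ∷ ys)
      ≡⟨ additive alt [] u v ((u ⊞ v) ∷ ys) ⟨
    D ((u ⊞ v) ∷ (u ⊞ v) ∷ ys)
      ≡⟨ alternates alt [] (u ⊞ v) ys ⟩
    0ℤ ∎)
    where
    open ≡-Reasoning
    cancel : ∀ a b → a + b ≡ 0ℤ → a ≡ - b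
    cancel a b e = trans (sym (ring a b)) (trans (cong (_- b) e) (ℤ.+-identityˡ (- b)))
      where
      ring : ∀ a b → a + b - b ≡ a
      ring = solve-∀

alternating-prefix : ∀ {N} {D : List (Vec ℤ N) → ℤ} → Alternating D → ∀ zs → Alternating (D ∘ (zs ⧺_))
alternating-prefix alt []       = alt
alternating-prefix alt (z ∷ zs) = alternating-prefix (alternating-∷ alt z) zs

alternating-repeat : ∀ {N} {D : List (Vec ℤ N) → ℤ} → Alternating D →
                     ∀ v xs ys → D (v ∷ xs ⧺ v ∷ ys) ≡ 0ℤ
alternating-repeat alt v []       ys = alternates alt [] v ys
alternating-repeat alt v (x ∷ xs) ys =
  trans (alternating-swap alt v x _) (cong -_ (alternating-repeat (alternating-∷ alt x) v xs ys))

alternating-move : ∀ {N} {D : List (Vec ℤ N) → ℤ} → Alternating D →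
                   ∀ v xs ys → D (xs ⧺ v ∷ ys) ≡ σ (length xs) * D (v ∷ xs ⧺ ys)
alternating-move alt v []       ys = sym (ℤ.*-identityˡ _)
alternating-move {D = D} alt v (x ∷ xs) ys =
  trans (alternating-move (alternating-∷ alt x) v xs ys)
    (trans (cong (σ (length xs) *_) (alternating-swap alt x v (xs ⧺ ys)))
           (e (σ (length xs)) (D (v ∷ x ∷ xs ⧺ ys))))
  where
  e : ∀ a b → a * - b ≡ - a * b
  e = solve-∀

-- Sites along a row carry vectors and alternate in colour; a site is selected when its bit
-- differs from its colour.
sel : ∀ {N k} → Bool → Vec (Vec ℤ N) k → Vec Bool k → List (Vec ℤ N)
sel c []       []       = []
sel c (a ∷ as) (b ∷ bs) = if b xor c then a ∷ sel (not c) as bs else sel (not c) as bs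

-- The vector of the right neighbour. The zero vector at the end of the row annihilates horizontal
-- dominoes that would stick out.
next : ∀ {N} n → Vec (Vec ℤ N) (double n) → Vec ℤ N
next zero    _       = 𝟎
next (suc n) (w ∷ _) = w

-- The three summands of the second vector of a pair are the ways to cover that cell: upwards,
-- together with its left neighbour, together with its right neighbour.
transfer : ∀ {N} n → Vec (Vec ℤ N) (double n) → Vec (Vec ℤ N) (double n)
transfer zero    []          = []
transfer (suc n) (w ∷ b ∷ a) = w ∷ (b ⊞ w ⊞ next n a) ∷ transfer n a

-- Selections behave like wedge products, and the row transfer acts on them through a linear map
-- of the vectors: the unwanted products contain a vector twice.
mutual
  rowSum-alternating : ∀ {N} n {D : List (Vec ℤ N) → ℤ} → Alternating D → ∀ a p →
    rowSum p ones (λ q → D (sel false a q)) ≡ D (sel true (transfer n a) p)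
  rowSum-alternating zero alt [] [] = refl
  rowSum-alternating (suc n) alt (w ∷ b ∷ a) (false ∷ false ∷ p) =
    rowSum-alternating n (alternating-∷ alt w) a p
  rowSum-alternating (suc n) {D} alt (w ∷ b ∷ a) (true ∷ false ∷ p) =
    trans (ℤ.+-identityˡ _) (rowSum-alternating n alt a p)
  rowSum-alternating (suc n) {D} alt (w ∷ b ∷ a) (false ∷ true ∷ p) = begin
    across p ones (λ q → D (w ∷ sel false a q)) + rowSum p ones (λ q → D (w ∷ b ∷ sel false a q))
      ≡⟨ cong₂ _+_ (across-alternating n altw a p)
                   (rowSum-alternating n (alternating-∷ altw b) a p) ⟩
    D (w ∷ next n a ∷ r) + D (w ∷ b ∷ r)
      ≡⟨ e (D (w ∷ next n a ∷ r)) (D (w ∷ b ∷ r)) ⟩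
    D (w ∷ b ∷ r) + 0ℤ + D (w ∷ next n a ∷ r)
      -- The left neighbour is already covered, so no domino joins it; its summand may still be
      -- added, because `w` then occurs twice.
      ≡⟨ cong (λ z → D (w ∷ b ∷ r) + z + D (w ∷ next n a ∷ r)) (alternates alt [] w r) ⟨
    D (w ∷ b ∷ r) + D (w ∷ w ∷ r) + D (w ∷ next n a ∷ r)
      ≡⟨ cong (_+ D (w ∷ next n a ∷ r)) (additive alt (w ∷ []) b w r) ⟨
    D (w ∷ (b ⊞ w) ∷ r) + D (w ∷ next n a ∷ r)
      ≡⟨ additive alt (w ∷ []) (b ⊞ w) (next n a) r ⟨
    D (w ∷ (b ⊞ w ⊞ next n a) ∷ r) ∎
    where
    open ≡-Reasoning
    altw = alternating-∷ alt w
    r = sel true (transfer n a) p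
    e : ∀ x y → x + y ≡ y + 0ℤ + x
    e = solve-∀
  rowSum-alternating (suc n) {D} alt (w ∷ b ∷ a) (true ∷ true ∷ p) = begin
    rowSum p ones (λ q → D (w ∷ sel false a q)) +
    (across p ones (λ q → D (sel false a q)) + rowSum p ones (λ q → D (b ∷ sel false a q)))
      ≡⟨ cong₂ _+_ (rowSum-alternating n (alternating-∷ alt w) a p)
           (cong₂ _+_ (across-alternating n alt a p) (rowSum-alternating n (alternating-∷ alt b) a p)) ⟩
    D (w ∷ r) + (D (next n a ∷ r) + D (b ∷ r))
      ≡⟨ e (D (w ∷ r)) (D (next n a ∷ r)) (D (b ∷ r)) ⟩
    D (b ∷ r) + D (w ∷ r) + D (next n a ∷ r)
      ≡⟨ cong (_+ D (next n a ∷ r)) (additive alt [] b w r) ⟨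
    D ((b ⊞ w) ∷ r) + D (next n a ∷ r)
      ≡⟨ additive alt [] (b ⊞ w) (next n a) r ⟨
    D ((b ⊞ w ⊞ next n a) ∷ r) ∎
    where
    open ≡-Reasoning
    r = sel true (transfer n a) p
    e : ∀ x y z → x + (y + z) ≡ z + x + y
    e = solve-∀

  across-alternating : ∀ {N} n {D : List (Vec ℤ N) → ℤ} → Alternating D → ∀ a p →
    across p ones (λ q → D (sel false a q)) ≡ D (next n a ∷ sel true (transfer n a) p)
  across-alternating zero    alt []          []          = sym (alternating-𝟎 alt [])
  -- The pending domino finds its second cell covered. Correspondingly `w` is both the pending
  -- vector and a selected one.
  across-alternating (suc n) alt (w ∷ b ∷ a) (false ∷ p) = sym (alternates alt [] w _)
  across-alternating (suc n) alt (w ∷ b ∷ a) (true ∷ p)  =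
    rowSum-alternating (suc n) alt (w ∷ b ∷ a) (false ∷ p)

-- Indices count from the right, so that the wide margin on the right takes up the indices 0 and 1
-- and the others are merely shifted.
sites : ∀ {N} n → (ℕ → Vec ℤ N) → (ℕ → Vec ℤ N) → Vec (Vec ℤ N) (double n)
sites zero    w b = []
sites (suc n) w b = w n ∷ b n ∷ sites n w b

sites-cong : ∀ {N} n {w w′ b b′ : ℕ → Vec ℤ N} → (∀ j → j ℕ.< n → w j ≡ w′ j) →
  (∀ j → j ℕ.< n → b j ≡ b′ j) → sites n w b ≡ sites n w′ b′
sites-cong zero    e f = refl
sites-cong (suc n) e f = cong₂ _∷_ (e n ℕ.≤-refl) (cong₂ _∷_ (f n ℕ.≤-refl)
  (sites-cong n (λ j lt → e j (ℕ.m<n⇒m<1+n lt)) (λ j lt → f j (ℕ.m<n⇒m<1+n lt))))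

transferred : ∀ {N} → (ℕ → Vec ℤ N) → (ℕ → Vec ℤ N) → ℕ → Vec ℤ N
transferred w b zero    = b zero ⊞ w zero ⊞ 𝟎
transferred w b (suc j) = b (suc j) ⊞ w (suc j) ⊞ w j

transfer-sites : ∀ {N} n (w b : ℕ → Vec ℤ N) → transfer n (sites n w b) ≡ sites n w (transferred w b)
transfer-sites zero          w b = refl
transfer-sites (suc zero)    w b = refl
transfer-sites (suc (suc n)) w b = cong₂ _∷_ refl (cong₂ _∷_ refl (transfer-sites (suc n) w b))

sites-pad : ∀ {N} m (w b : ℕ → Vec ℤ N) → sites (suc (suc m)) w b ≡
  w (suc m) ∷ (sites m (λ j → b (suc (suc j))) (λ j → w (suc j)) ∷ʳ b 1 ∷ʳ w 0 ∷ʳ b 0)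
sites-pad zero    w b = refl
sites-pad (suc m) w b = cong₂ _∷_ refl (cong₂ _∷_ refl (sites-pad m w b))

-- All four margin cells are still uncovered, so those of one colour are selected whatever `q` is.
-- The single cell on the left shifts the colours of the inner part.
sel-pad : ∀ {N} m (a : Vec (Vec ℤ N) (double m)) v x y z q →
  sel true (v ∷ (a ∷ʳ x ∷ʳ y ∷ʳ z)) (pad q) ≡ sel false a q ⧺ x ∷ z ∷ []
sel-pad zero    []            v x y z []                   = refl
sel-pad (suc m) (a₁ ∷ a₂ ∷ a) v x y z (true ∷ true ∷ q)   = cong (a₁ ∷_) (sel-pad m a v x y z q)
sel-pad (suc m) (a₁ ∷ a₂ ∷ a) v x y z (true ∷ false ∷ q)  = cong (λ l → a₁ ∷ a₂ ∷ l) (sel-pad m a v x y z q)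
sel-pad (suc m) (a₁ ∷ a₂ ∷ a) v x y z (false ∷ true ∷ q)  = sel-pad m a v x y z q
sel-pad (suc m) (a₁ ∷ a₂ ∷ a) v x y z (false ∷ false ∷ q) = cong (a₂ ∷_) (sel-pad m a v x y z q)

-- Modified Schröder numbers

-- The contribution of the empty path to `(j , j)`. On the diagonal, `at i i j` also serves as the
-- Kronecker delta.
at : ℕ → ℕ → ℕ → ℤ
at x y j = if (x ℕ.≡ᵇ j) ∧ (y ℕ.≡ᵇ j) then 1ℤ else 0ℤ

adm : ℕ → ℕ → Bool
adm x y = does (admissible? (x , y))

-- The number of paths from `(x , y)` to `(j , j)` with at most as many steps as the first argument
-- says, by recursion on the first step.
walks : ℕ → ℕ → ℕ → ℕ → ℤ
walks zero    j x y = if adm x y then at x y j else 0ℤ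
walks (suc k) j x y = if adm x y
  then at x y j + (walks k j x (suc y) + (walks k j (suc x) y + walks k j (suc x) (suc y)))
  else 0ℤ

# : Point → Point → List (List Step) → ℤ
# p q []       = 0ℤ
# p q (w ∷ ws) = (if does (isPath? p q w) then 1ℤ else 0ℤ) + # p q ws

#-filter : ∀ p q ws → + length (filter (isPath? p q) ws) ≡ # p q ws
#-filter p q [] = refl
#-filter p q (w ∷ ws) with does (isPath? p q w)
... | false = trans (#-filter p q ws) (sym (ℤ.+-identityˡ _))
... | true  = cong (λ i → 1ℤ + i) (#-filter p q ws)

#-⧺ : ∀ p q us ws → # p q (us ⧺ ws) ≡ # p q us + # p q ws
#-⧺ p q []       ws = sym (ℤ.+-identityˡ _)
#-⧺ p q (u ∷ us) ws =
  trans (cong (λ i → (if does (isPath? p q u) then 1ℤ else 0ℤ) + i) (#-⧺ p q us ws)) (sym (ℤ.+-assoc (if does (isPath? p q u) then 1ℤ else 0ℤ) _ _))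

#-map : ∀ x y q a ws → # (x , y) q (mapᴸ (a ∷_) ws) ≡ (if adm x y then # (move a (x , y)) q ws else 0ℤ)
#-map x y q a [] with adm x y
... | true  = refl
... | false = refl
#-map x y q a (w ∷ ws) with adm x y | #-map x y q a ws
... | false | ih = trans (ℤ.+-identityˡ _) ih
... | true  | ih = cong (λ i → (if does (isPath? (move a (x , y)) q w) then 1ℤ else 0ℤ) + i) ih

steps : ℕ → ℕ → (Point → ℤ) → ℤ
steps x y g = g (x , suc y) + (g (suc x , y) + g (suc x , suc y))

#-suc : ∀ x y q l →
  # (x , y) q (words (suc l)) ≡ (if adm x y then steps x y (λ p → # p q (words l)) else 0ℤ)
#-suc x y q l = trans
  (trans (#-⧺ (x , y) q (mapᴸ (north ∷_) (words l)) _) (cong₂ _+_ (#-map x y q north (words l))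
    (trans (#-⧺ (x , y) q (mapᴸ (east ∷_) (words l)) _) (cong₂ _+_ (#-map x y q east (words l))
      (trans (cong (# (x , y) q) (List.++-identityʳ (mapᴸ (diagonal ∷_) (words l)))) (#-map x y q diagonal (words l)))))))
  factor
  where
  factor : (if adm x y then # (x , suc y) q (words l) else 0ℤ) +
           ((if adm x y then # (suc x , y) q (words l) else 0ℤ) +
            (if adm x y then # (suc x , suc y) q (words l) else 0ℤ)) ≡
           (if adm x y then steps x y (λ p → # p q (words l)) else 0ℤ)
  factor with adm x y
  ... | true  = refl
  ... | false = refl

#-upTo-suc : ∀ x y q f k →
  # (x , y) q (concatMap words (applyUpTo (suc ∘ f) k)) ≡
  (if adm x y then steps x y (λ p → # p q (concatMap words (applyUpTo f k))) else 0ℤ)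
#-upTo-suc x y q f zero with adm x y
... | true  = refl
... | false = refl
#-upTo-suc x y q f (suc k)
  rewrite #-⧺ (x , y) q (words (suc (f 0))) (concatMap words (applyUpTo (suc ∘ f ∘ suc) k))
        | #-suc x y q (f 0) | #-upTo-suc x y q (f ∘ suc) k
        | #-⧺ (x , suc y) q (words (f 0)) (concatMap words (applyUpTo (f ∘ suc) k))
        | #-⧺ (suc x , y) q (words (f 0)) (concatMap words (applyUpTo (f ∘ suc) k))
        | #-⧺ (suc x , suc y) q (words (f 0)) (concatMap words (applyUpTo (f ∘ suc) k))
  with adm x y
... | false = refl
... | true  = e (# (x , suc y) q (words (f 0))) (# (suc x , y) q (words (f 0))) (# (suc x , suc y) q (words (f 0))) _ _ _
  where
  e : ∀ a b c a′ b′ c′ → a + (b + c) + (a′ + (b′ + c′)) ≡ a + a′ + (b + b′ + (c + c′))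
  e = solve-∀

at-≡ : ∀ j → at j j j ≡ 1ℤ
at-≡ zero    = refl
at-≡ (suc j) = at-≡ j

at-≢ : ∀ x y j → (x , y) ≢ (j , j) → at x y j ≡ 0ℤ
at-≢ x y j ne with x ℕ.≟ j | y ℕ.≟ j
... | no x≢j   | _        = if-∧ˡ (dec-false (x ℕ.≟ j) x≢j)
  where
  if-∧ˡ : ∀ {a b} → a ≡ false → (if a ∧ b then 1ℤ else 0ℤ) ≡ 0ℤ
  if-∧ˡ refl = refl
... | yes refl | no y≢j = if-∧ʳ (x ℕ.≡ᵇ x) (dec-false (y ℕ.≟ x) y≢j)
  where
  if-∧ʳ : ∀ a {b} → b ≡ false → (if a ∧ b then 1ℤ else 0ℤ) ≡ 0ℤ
  if-∧ʳ true  refl = refl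
  if-∧ʳ false refl = refl
... | yes refl | yes refl = contradiction refl ne

#-[] : ∀ x y j → # (x , y) (j , j) ([] ∷ []) ≡ (if adm x y then at x y j else 0ℤ)
#-[] x y j with adm x y
... | false = refl
... | true with ≡-dec ℕ._≟_ ℕ._≟_ (x , y) (j , j)
...   | no ne    = sym (at-≢ x y j ne)
...   | yes refl = sym (at-≡ x)

#-upTo : ∀ k j x y → # (x , y) (j , j) (concatMap words (upTo (suc k))) ≡ walks k j x y
#-upTo zero    j x y = #-[] x y j
#-upTo (suc k) j x y
  rewrite #-⧺ (x , y) (j , j) ([] ∷ []) (concatMap words (applyUpTo suc (suc k)))
        | #-[] x y j | #-upTo-suc x y (j , j) id (suc k)
        | #-upTo k j x (suc y) | #-upTo k j (suc x) y | #-upTo k j (suc x) (suc y)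
  with adm x y
... | true  = refl
... | false = refl

walks-off : ∀ k j x y → ¬ Admissible (x , y) → walks k j x y ≡ 0ℤ
walks-off zero    j x y ¬a rewrite dec-false (admissible? (x , y)) ¬a = refl
walks-off (suc k) j x y ¬a rewrite dec-false (admissible? (x , y)) ¬a = refl

at-beyond : ∀ x y j → j ℕ.+ j ℕ.< x ℕ.+ y → at x y j ≡ 0ℤ
at-beyond x y j lt = at-≢ x y j λ { refl → ℕ.<-irrefl refl lt }

walks-beyond : ∀ k j x y → j ℕ.+ j ℕ.< x ℕ.+ y → walks k j x y ≡ 0ℤ
walks-beyond zero j x y lt rewrite at-beyond x y j lt with adm x y
... | true  = refl
... | false = refl
walks-beyond (suc k) j x y lt
  rewrite at-beyond x y j lt
        | walks-beyond k j x (suc y) (ℕ.<-trans lt (ℕ.+-monoʳ-< x ℕ.≤-refl))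
        | walks-beyond k j (suc x) y (ℕ.m<n⇒m<1+n lt)
        | walks-beyond k j (suc x) (suc y) (ℕ.m<n⇒m<1+n (ℕ.<-trans lt (ℕ.+-monoʳ-< x ℕ.≤-refl)))
  with adm x y
... | true  = refl
... | false = refl

≤⇒<+suc : ∀ x y {i} → i ≤ x ℕ.+ y → i ℕ.< x ℕ.+ suc y
≤⇒<+suc x y le = ℕ.≤-trans (s≤s le) (ℕ.≤-reflexive (sym (ℕ.+-suc x y)))

-- Every step raises `x + y` by at least one, so a path that reaches `(j , j)` has at most `k`
-- steps.
walks-stable : ∀ k j x y → j ℕ.+ j ≤ x ℕ.+ y ℕ.+ k → walks (suc k) j x y ≡ walks k j x y
walks-stable zero j x y le
  rewrite walks-beyond 0 j x (suc y) (≤⇒<+suc x y (ℕ.≤-trans le (ℕ.≤-reflexive (ℕ.+-identityʳ _))))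
        | walks-beyond 0 j (suc x) y (s≤s (ℕ.≤-trans le (ℕ.≤-reflexive (ℕ.+-identityʳ _))))
        | walks-beyond 0 j (suc x) (suc y) (ℕ.m<n⇒m<1+n (≤⇒<+suc x y (ℕ.≤-trans le (ℕ.≤-reflexive (ℕ.+-identityʳ _)))))
        | ℤ.+-identityʳ (at x y j) = refl
walks-stable (suc k) j x y le
  rewrite walks-stable k j x (suc y) (ℕ.≤-trans le (ℕ.≤-reflexive
            (trans (ℕ.+-suc (x ℕ.+ y) k) (cong (ℕ._+ k) (sym (ℕ.+-suc x y))))))
        | walks-stable k j (suc x) y (ℕ.≤-trans le (ℕ.≤-reflexive (ℕ.+-suc (x ℕ.+ y) k)))
        | walks-stable k j (suc x) (suc y) (ℕ.≤-trans (ℕ.m≤n⇒m≤1+n le) (ℕ.≤-reflexive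
            (cong suc (trans (ℕ.+-suc (x ℕ.+ y) k) (cong (ℕ._+ k) (sym (ℕ.+-suc x y)))))))
  = refl

walks-stable+ : ∀ d k j x y → j ℕ.+ j ≤ x ℕ.+ y ℕ.+ k → walks (d ℕ.+ k) j x y ≡ walks k j x y
walks-stable+ zero    k j x y le = refl
walks-stable+ (suc d) k j x y le =
  trans (walks-stable (d ℕ.+ k) j x y (ℕ.≤-trans le (ℕ.+-monoʳ-≤ (x ℕ.+ y) (ℕ.m≤n+m k d))))
        (walks-stable+ d k j x y le)

-- The bound `2 * j` suffices from every starting point, which frees the path recursion from a step
-- counter.
paths : ℕ → ℕ → ℕ → ℤ
paths j x y = walks (2 ℕ.* j) j x y

paths-off : ∀ j x y → ¬ Admissible (x , y) → paths j x y ≡ 0ℤ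
paths-off j = walks-off (2 ℕ.* j) j

paths-beyond : ∀ j x y → j ℕ.+ j ℕ.< x ℕ.+ y → paths j x y ≡ 0ℤ
paths-beyond j = walks-beyond (2 ℕ.* j) j

paths-step : ∀ j x y → Admissible (x , y) →
  paths j x y ≡ at x y j + (paths j x (suc y) + (paths j (suc x) y + paths j (suc x) (suc y)))
paths-step j x y a = trans (sym (walks-stable (2 ℕ.* j) j x y
  (ℕ.≤-trans (ℕ.≤-reflexive (cong (j ℕ.+_) (sym (ℕ.+-identityʳ j)))) (ℕ.m≤n+m (2 ℕ.* j) (x ℕ.+ y)))))
  (step-adm a)
  where
  step-adm : Admissible (x , y) → walks (suc (2 ℕ.* j)) j x y ≡
    at x y j + (paths j x (suc y) + (paths j (suc x) y + paths j (suc x) (suc y)))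
  step-adm a rewrite dec-true (admissible? (x , y)) a = refl

sᶻ : ℕ → ℕ → ℤ
sᶻ i j = + s i j

sᶻ-paths : ∀ i j → sᶻ i j ≡ paths j i i
sᶻ-paths i j = trans (#-filter (i , i) (j , j) (concatMap words (upTo (suc (2 ℕ.* (j ℕ.∸ i))))))
  (trans (#-upTo (2 ℕ.* (j ℕ.∸ i)) j i i)
  (trans (sym (walks-stable+ (2 ℕ.* j ℕ.∸ 2 ℕ.* (j ℕ.∸ i)) _ j i i enough))
         (cong (λ k → walks k j i i) (ℕ.m∸n+n≡m (ℕ.*-monoʳ-≤ 2 (ℕ.m∸n≤m j i))))))
  where
  enough : j ℕ.+ j ≤ i ℕ.+ i ℕ.+ 2 ℕ.* (j ℕ.∸ i)
  enough = ℕ.≤-trans (ℕ.+-mono-≤ (ℕ.m≤n+m∸n j i) (ℕ.m≤n+m∸n j i)) (ℕ.≤-reflexive (e i (j ℕ.∸ i)))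
    where
    e : ∀ a b → a ℕ.+ b ℕ.+ (a ℕ.+ b) ≡ a ℕ.+ a ℕ.+ 2 ℕ.* b
    e = ℕ-solve-∀

sᶻ-upper : ∀ i j → j ℕ.< i → sᶻ i j ≡ 0ℤ
sᶻ-upper i j lt = trans (sᶻ-paths i j) (paths-beyond j i i (ℕ.+-mono-< lt lt))

sum-0 : ∀ {M} (f : Fin M → ℤ) → (∀ i → f i ≡ 0ℤ) → sum f ≡ 0ℤ
sum-0 {M} f e = trans (sum-cong-≗ e) (sum-replicate-zero M)

sum-at : ∀ {M} x (g : ℕ → ℤ) → (∀ k → M ≤ k → g k ≡ 0ℤ) →
         sum {M} (λ k → at x x (toℕ k) * g (toℕ k)) ≡ g x
sum-at {zero}  x       g e = sym (e x z≤n)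
sum-at {suc M} zero    g e = trans (cong (λ i → 1ℤ * g 0 + i) (sum-0 {M} _ (λ i → refl)))
  (trans (ℤ.+-identityʳ _) (ℤ.*-identityˡ (g 0)))
sum-at {suc M} (suc x) g e =
  trans (ℤ.+-identityˡ _) (sum-at {M} x (g ∘ suc) (λ k le → e (suc k) (s≤s le)))

-- A nontrivial path ending at (j + 2 , j + 2) ends with a diagonal step, or leaves the diagonal for
-- the last time at some (k + 1 , k + 1). In the second case remove the first and the last step of
-- its last part and translate by (-2 , -1): the result is a path from (k , k) to (j , j).
module _ (M j : ℕ) (j<M : j ℕ.< M) where

  returns : ℕ → ℕ → ℤ
  returns x y = sum {M} (λ k → paths (suc (toℕ k)) x y * sᶻ (toℕ k) j)

  -- The paths to `(j + 2 , j + 2)` that are empty, that end with a diagonal step, or that leave the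
  -- diagonal for the last time at some `(k + 1 , k + 1)` on their way.
  decomposed : ℕ → ℕ → ℤ
  decomposed x y = at x y (2 ℕ.+ j) + (paths (suc j) x y + returns x y)

  sᶻ-far : ∀ k → M ≤ k → sᶻ k j ≡ 0ℤ
  sᶻ-far k le = sᶻ-upper k j (ℕ.<-≤-trans j<M le)

  returns-0 : ∀ x y → (∀ k → paths (suc k) x y ≡ 0ℤ) → returns x y ≡ 0ℤ
  returns-0 x y e = sum-0 {M} _ (λ k → cong (_* sᶻ (toℕ k) j) (e (toℕ k)))

  returns-step : ∀ x y → Admissible (x , y) → returns x y ≡
    sum {M} (λ k → at x y (suc (toℕ k)) * sᶻ (toℕ k) j) +
    (returns x (suc y) + (returns (suc x) y + returns (suc x) (suc y)))
  returns-step x y a = begin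
    sum {M} (λ k → p k x y * s′ k)
      ≡⟨ sum-cong-≗ {M} (λ k → trans (cong (_* s′ k) (paths-step (suc (toℕ k)) x y a))
           (e (at x y (suc (toℕ k))) (p k x (suc y)) (p k (suc x) y) (p k (suc x) (suc y)) (s′ k))) ⟩
    sum {M} (λ k → f₀ k + (f₁ k + (f₂ k + f₃ k)))
      ≡⟨ ∑-distrib-+ f₀ _ ⟩
    sum f₀ + sum {M} (λ k → f₁ k + (f₂ k + f₃ k))
      ≡⟨ cong (λ i → sum f₀ + i) (trans (∑-distrib-+ f₁ _) (cong (λ i → sum f₁ + i) (∑-distrib-+ f₂ f₃))) ⟩
    sum f₀ + (sum f₁ + (sum f₂ + sum f₃)) ∎
    where
    open ≡-Reasoning
    p : Fin M → ℕ → ℕ → ℤ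
    p k = paths (suc (toℕ k))
    s′ f₀ f₁ f₂ f₃ : Fin M → ℤ
    s′ k = sᶻ (toℕ k) j
    f₀ k = at x y (suc (toℕ k)) * s′ k
    f₁ k = p k x (suc y) * s′ k
    f₂ k = p k (suc x) y * s′ k
    f₃ k = p k (suc x) (suc y) * s′ k
    e : ∀ a b c d u → (a + (b + (c + d))) * u ≡ a * u + (b * u + (c * u + d * u))
    e = solve-∀

  -- The last two kinds of paths obey the recursion on the first step; the empty path does not, and
  -- its contribution at the three neighbours is subtracted.
  decomposed-step : ∀ x y → Admissible (x , y) → decomposed x y ≡
    at x y (2 ℕ.+ j) + (at x y (suc j) + sum {M} (λ k → at x y (suc (toℕ k)) * sᶻ (toℕ k) j)) +
    (decomposed x (suc y) - at x (suc y) (2 ℕ.+ j) +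
     (decomposed (suc x) y - at (suc x) y (2 ℕ.+ j) +
      (decomposed (suc x) (suc y) - at (suc x) (suc y) (2 ℕ.+ j))))
  decomposed-step x y a rewrite paths-step (suc j) x y a | returns-step x y a =
    e (at x y (2 ℕ.+ j)) (at x y (suc j)) (sum {M} (λ k → at x y (suc (toℕ k)) * sᶻ (toℕ k) j))
      (paths (suc j) x (suc y)) (paths (suc j) (suc x) y) (paths (suc j) (suc x) (suc y))
      (returns x (suc y)) (returns (suc x) y) (returns (suc x) (suc y))
      (at x (suc y) (2 ℕ.+ j)) (at (suc x) y (2 ℕ.+ j)) (at (suc x) (suc y) (2 ℕ.+ j))
    where
    e : ∀ a b c p₁ p₂ p₃ r₁ r₂ r₃ t₁ t₂ t₃ →
      a + (b + (p₁ + (p₂ + p₃)) + (c + (r₁ + (r₂ + r₃)))) ≡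
      a + (b + c) + (t₁ + (p₁ + r₁) - t₁ + (t₂ + (p₂ + r₂) - t₂ + (t₃ + (p₃ + r₃) - t₃)))
    e = solve-∀

  -- Recursion on the first step forces a version for starting points off the diagonal. Such a point
  -- may already lie inside the last part of the path; these paths, cut before their final north
  -- step and translated by `(-2 , -1)`, are counted by `paths j x y`. The translation preserves the
  -- line `y = x / 2` and turns `y < x` into `y ≤ x`.
  Decomposition : ℕ → ℕ → Set
  Decomposition x y = paths (2 ℕ.+ j) (2 ℕ.+ x) (suc y) ≡ decomposed (2 ℕ.+ x) (suc y) + paths j x y

  decomposed-off : ∀ x y → ¬ Admissible (x , y) → decomposed x y ≡ 0ℤ
  decomposed-off x y ¬a
    rewrite paths-off (suc j) x y ¬a
          | returns-0 x y (λ k → paths-off (suc k) x y ¬a)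
          | at-≢ x y (2 ℕ.+ j) (λ { refl → ¬a (ℕ.≤-refl , ℕ.m≤m+n _ _) }) = refl

  at-off : ∀ x y → ¬ Admissible (x , y) → at x y (2 ℕ.+ j) ≡ 0ℤ
  at-off x y ¬a = at-≢ x y (2 ℕ.+ j) λ { refl → ¬a (ℕ.≤-refl , ℕ.m≤m+n _ _) }

  diagonal-admissible : ∀ x → Admissible (x , x)
  diagonal-admissible x = ℕ.≤-refl , ℕ.m≤m+n x _

  above-off : ∀ x y → x ℕ.< y → ¬ Admissible (x , y)
  above-off x y lt (le , _) = ℕ.<⇒≱ lt le

  at-off-diagonal : ∀ x y j → x ≢ y → at x y j ≡ 0ℤ
  at-off-diagonal x y j ne = at-≢ x y j λ e → ne (trans (cong proj₁ e) (sym (cong proj₂ e)))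

  decomposition-diagonal : ∀ x → Decomposition x x → Decomposition x (suc x) →
    paths (2 ℕ.+ j) (suc x) (suc x) ≡ decomposed (suc x) (suc x)
  decomposition-diagonal x de dd = combine
    (at (suc x) (suc x) (2 ℕ.+ j)) (at x x j)
    (decomposed (2 ℕ.+ x) (suc x)) (decomposed (2 ℕ.+ x) (2 ℕ.+ x)) (paths j x x)
    (paths-step (2 ℕ.+ j) (suc x) (suc x) (diagonal-admissible (suc x)))
    (decomposed-step (suc x) (suc x) (diagonal-admissible (suc x)))
    (paths-off (2 ℕ.+ j) (suc x) (2 ℕ.+ x) (above-off (suc x) (2 ℕ.+ x) ℕ.≤-refl))
    (decomposed-off (suc x) (2 ℕ.+ x) (above-off (suc x) (2 ℕ.+ x) ℕ.≤-refl))
    (at-off (suc x) (2 ℕ.+ x) (above-off (suc x) (2 ℕ.+ x) ℕ.≤-refl))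
    de
    (at-off-diagonal (2 ℕ.+ x) (suc x) (2 ℕ.+ j) (ℕ.m≢1+n+m x {0} ∘ sym ∘ ℕ.suc-injective))
    dd
    (paths-off j x (suc x) (above-off x (suc x) ℕ.≤-refl))
    -- Leaving the diagonal here for the last time is the term `k = x` of `returns`; it equals the
    -- extra term `paths j x x` of the eastern neighbour.
    (trans (sum-at {M} x (λ k → sᶻ k j) sᶻ-far) (sᶻ-paths x j))
    where
    combine : ∀ a t dE dD q {X Y pN pE pD dN tN tE r u} →
      X ≡ a + (pN + (pE + pD)) → Y ≡ a + (t + u) + (dN - tN + (dE - tE + (dD - t))) →
      pN ≡ 0ℤ → dN ≡ 0ℤ → tN ≡ 0ℤ → pE ≡ dE + q → tE ≡ 0ℤ → pD ≡ dD + r → r ≡ 0ℤ → u ≡ q → X ≡ Y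
    combine a t dE dD q refl refl refl refl refl refl refl refl refl refl = e a dE q dD t
      where
      e : ∀ a d q d′ t → a + (0ℤ + (d + q + (d′ + 0ℤ))) ≡
          a + (t + q) + (0ℤ - 0ℤ + (d - 0ℤ + (d′ - t)))
      e = solve-∀

  -- Both sides obey the recursion on the first step. The empty path that `decomposed` loses at the
  -- northern neighbour is the final north step, and it reappears as the empty path in
  -- `paths j x y`.
  decomposition-below : ∀ x y → Admissible (x , y) →
    Decomposition x (suc y) → Decomposition (suc x) y → Decomposition (suc x) (suc y) →
    Decomposition x y
  decomposition-below x y a@(le , le′) dn de dd = combine
    (at x y j)
    (decomposed (2 ℕ.+ x) (2 ℕ.+ y)) (decomposed (3 ℕ.+ x) (suc y)) (decomposed (3 ℕ.+ x) (2 ℕ.+ y))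
    (paths j x (suc y)) (paths j (suc x) y) (paths j (suc x) (suc y))
    (paths-step (2 ℕ.+ j) (2 ℕ.+ x) (suc y) a′) (decomposed-step (2 ℕ.+ x) (suc y) a′)
    (paths-step j x y a) (off (2 ℕ.+ j)) (off (suc j))
    (sum-0 {M} _ (λ k → cong (_* sᶻ (toℕ k) j) (off (suc (toℕ k)))))
    dn de
    (at-off-diagonal (3 ℕ.+ x) (suc y) (2 ℕ.+ j)
      (λ e → ℕ.<⇒≱ (s≤s (ℕ.m≤n⇒m≤1+n le)) (ℕ.≤-reflexive (ℕ.suc-injective e))))
    dd
    (at-off-diagonal (3 ℕ.+ x) (2 ℕ.+ y) (2 ℕ.+ j)
      (λ e → ℕ.<⇒≱ (s≤s le) (ℕ.≤-reflexive (ℕ.suc-injective (ℕ.suc-injective e)))))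
    where
    a′ : Admissible (2 ℕ.+ x , suc y)
    a′ = s≤s (ℕ.m≤n⇒m≤1+n le) , subst (2 ℕ.+ x ≤_) (cong suc (sym (ℕ.+-suc y _))) (s≤s (s≤s le′))
    off : ∀ j → at (2 ℕ.+ x) (suc y) j ≡ 0ℤ
    off j = at-off-diagonal (2 ℕ.+ x) (suc y) j λ e → ℕ.<⇒≱ (s≤s le) (ℕ.≤-reflexive (ℕ.suc-injective e))
    combine : ∀ t dN dE dD qN qE qD {X Y Z a b u pN pE pD tE tD} →
      X ≡ a + (pN + (pE + pD)) → Y ≡ a + (b + u) + (dN - t + (dE - tE + (dD - tD))) →
      Z ≡ t + (qN + (qE + qD)) → a ≡ 0ℤ → b ≡ 0ℤ → u ≡ 0ℤ →
      pN ≡ dN + qN → pE ≡ dE + qE → tE ≡ 0ℤ → pD ≡ dD + qD → tD ≡ 0ℤ → X ≡ Y + Z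
    combine t dN dE dD qN qE qD refl refl refl refl refl refl refl refl refl refl refl =
      e t dN dE dD qN qE qD
      where
      e : ∀ t a b c u v w → 0ℤ + (a + u + (b + v + (c + w))) ≡
          0ℤ + (0ℤ + 0ℤ) + (a - t + (b - 0ℤ + (c - 0ℤ))) + (t + (u + (v + w)))
      e = solve-∀

  decomposition : ∀ d x y → 2 ℕ.+ (j ℕ.+ j) ≤ x ℕ.+ y ℕ.+ d → Decomposition x y
  decomposition zero x y le = begin
    paths (2 ℕ.+ j) (2 ℕ.+ x) (suc y)               ≡⟨ paths-beyond (2 ℕ.+ j) (2 ℕ.+ x) (suc y) (far (2 ℕ.+ j) ℕ.≤-refl) ⟩
    0ℤ + (0ℤ + 0ℤ) + 0ℤ                               ≡⟨ cong₂ _+_ (cong₂ _+_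
      (sym (at-beyond (2 ℕ.+ x) (suc y) (2 ℕ.+ j) (far (2 ℕ.+ j) ℕ.≤-refl)))
      (cong₂ _+_ (sym (paths-beyond (suc j) (2 ℕ.+ x) (suc y) (far (suc j) (ℕ.n≤1+n _))))
                 (sym (sum-0 {M} _ (λ k → term (toℕ k))))))
      (sym (paths-beyond j x y (ℕ.≤-trans (ℕ.n≤1+n _) le′))) ⟩
    decomposed (2 ℕ.+ x) (suc y) + paths j x y ∎
    where
    open ≡-Reasoning
    le′ : 2 ℕ.+ (j ℕ.+ j) ≤ x ℕ.+ y
    le′ = ℕ.≤-trans le (ℕ.≤-reflexive (ℕ.+-identityʳ _))
    far : ∀ i → i ≤ 2 ℕ.+ j → i ℕ.+ i ℕ.< 2 ℕ.+ x ℕ.+ suc y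
    far i i≤ = ℕ.≤-trans (s≤s (ℕ.+-mono-≤ i≤ i≤)) (ℕ.≤-trans (ℕ.≤-reflexive (e j))
      (ℕ.≤-trans (ℕ.+-monoʳ-≤ 3 le′) (ℕ.≤-reflexive (e′ x y))))
      where
      e : ∀ j → suc (2 ℕ.+ j ℕ.+ (2 ℕ.+ j)) ≡ 3 ℕ.+ (2 ℕ.+ (j ℕ.+ j))
      e = ℕ-solve-∀
      e′ : ∀ x y → 3 ℕ.+ (x ℕ.+ y) ≡ 2 ℕ.+ x ℕ.+ suc y
      e′ = ℕ-solve-∀
    term : ∀ k → paths (suc k) (2 ℕ.+ x) (suc y) * sᶻ k j ≡ 0ℤ
    term k with k ℕ.≤? j
    ... | yes k≤j = cong (_* sᶻ k j) (paths-beyond (suc k) (2 ℕ.+ x) (suc y) (far (suc k) (s≤s (ℕ.m≤n⇒m≤1+n k≤j))))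
    ... | no k≰j  = trans (cong (paths (suc k) (2 ℕ.+ x) (suc y) *_) (sᶻ-upper k j (ℕ.≰⇒> k≰j))) (ℤ.*-zeroʳ (paths (suc k) (2 ℕ.+ x) (suc y)))
  decomposition (suc d) x y le with admissible? (x , y) | admissible? (2 ℕ.+ x , suc y)
  ... | yes a | _ = decomposition-below x y a
    (decomposition d x (suc y) (ℕ.≤-trans le (ℕ.≤-reflexive (shift x y d))))
    (decomposition d (suc x) y (ℕ.≤-trans le (ℕ.≤-reflexive (ℕ.+-suc _ d))))
    (decomposition d (suc x) (suc y) (ℕ.≤-trans (ℕ.m≤n⇒m≤1+n le) (ℕ.≤-reflexive (cong suc (shift x y d)))))
    where
    shift : ∀ x y d → x ℕ.+ y ℕ.+ suc d ≡ x ℕ.+ suc y ℕ.+ d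
    shift = ℕ-solve-∀
  ... | no ¬a | no ¬a′ =
    trans (paths-off (2 ℕ.+ j) (2 ℕ.+ x) (suc y) ¬a′)
      (sym (cong₂ _+_ (decomposed-off (2 ℕ.+ x) (suc y) ¬a′) (paths-off j x y ¬a)))
  -- The translate of an admissible point leaves the region only across `y = x`, so the point itself
  -- is on the diagonal.
  ... | no ¬a | yes (le₁ , le₂) with y ℕ.≤? x
  ...   | yes y≤x = contradiction (y≤x , ℕ.s≤s⁻¹ (ℕ.s≤s⁻¹ (subst (2 ℕ.+ x ≤_) (cong suc (ℕ.+-suc y _)) le₂))) ¬a
  ...   | no y≰x with refl ← ℕ.≤-antisym (ℕ.s≤s⁻¹ le₁) (ℕ.≰⇒> y≰x) =
    trans (decomposition-diagonal (suc x)
            (decomposition d (suc x) (suc x) (ℕ.≤-trans le (ℕ.≤-reflexive (ℕ.+-suc _ d))))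
            (decomposition d (suc x) (2 ℕ.+ x) (ℕ.≤-trans (ℕ.m≤n⇒m≤1+n le) (ℕ.≤-reflexive (shift x d)))))
          (trans (sym (ℤ.+-identityʳ _)) (cong (λ i → decomposed (2 ℕ.+ x) (2 ℕ.+ x) + i) (sym (paths-off j x (suc x) ¬a))))
    where
    shift : ∀ x d → suc (x ℕ.+ suc x ℕ.+ suc d) ≡ suc x ℕ.+ (2 ℕ.+ x) ℕ.+ d
    shift = ℕ-solve-∀

  decomposition-all : ∀ x y → Decomposition x y
  decomposition-all x y = decomposition (2 ℕ.+ (j ℕ.+ j)) x y (ℕ.m≤n+m _ _)

  diagonal-decomposed : ∀ i → paths (2 ℕ.+ j) i i ≡ decomposed i i
  diagonal-decomposed (suc x) =
    decomposition-diagonal x (decomposition-all x x) (decomposition-all x (suc x))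
  -- From the origin only the diagonal step stays in the region.
  diagonal-decomposed zero = combine (decomposed 1 1) (diagonal-decomposed 1)
    (paths-step (2 ℕ.+ j) 0 0 (z≤n , z≤n)) (decomposed-step 0 0 (z≤n , z≤n))
    (paths-off (2 ℕ.+ j) 0 1 λ ()) (paths-off (2 ℕ.+ j) 1 0 λ ())
    (decomposed-off 0 1 λ ()) (decomposed-off 1 0 λ ())
    (sum-0 {M} _ (λ k → refl))
    where
    combine : ∀ d {X Y u pN pE p dN dE} → p ≡ d → X ≡ 0ℤ + (pN + (pE + p)) →
      Y ≡ 0ℤ + (0ℤ + u) + (dN - 0ℤ + (dE - 0ℤ + (d - 0ℤ))) →
      pN ≡ 0ℤ → pE ≡ 0ℤ → dN ≡ 0ℤ → dE ≡ 0ℤ → u ≡ 0ℤ → X ≡ Y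
    combine d refl refl refl refl refl refl refl refl = e d
      where
      e : ∀ d → 0ℤ + (0ℤ + (0ℤ + d)) ≡ 0ℤ + (0ℤ + 0ℤ) + (0ℤ - 0ℤ + (0ℤ - 0ℤ + (d - 0ℤ)))
      e = solve-∀

  sᶻ-recurrence : ∀ i → sᶻ i (2 ℕ.+ j) ≡
    at i i (2 ℕ.+ j) + (sᶻ i (suc j) + sum {M} (λ k → sᶻ i (suc (toℕ k)) * sᶻ (toℕ k) j))
  sᶻ-recurrence i = trans (sᶻ-paths i (2 ℕ.+ j)) (trans (diagonal-decomposed i)
    (cong (λ v → at i i (2 ℕ.+ j) + v) (cong₂ _+_ (sym (sᶻ-paths i (suc j)))
      (sum-cong-≗ {M} (λ k → cong (_* sᶻ (toℕ k) j) (sym (sᶻ-paths i (suc (toℕ k)))))))))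

-- The number of tilings of the lower half as a determinant

sum-at′ : ∀ {M} x (g : ℕ → ℤ) → x ℕ.< M → sum {M} (λ k → at (toℕ k) (toℕ k) x * g (toℕ k)) ≡ g x
sum-at′ {suc M} zero    g lt = trans (cong (λ i → 1ℤ * g 0 + i) (sum-0 {M} _ (λ i → refl)))
  (trans (ℤ.+-identityʳ _) (ℤ.*-identityˡ (g 0)))
sum-at′ {suc M} (suc x) g (s≤s lt) = trans (ℤ.+-identityˡ _) (sum-at′ {M} x (g ∘ suc) lt)

lin : ∀ {N M} → (Fin M → ℤ) → (Fin M → Vec ℤ N) → Vec ℤ N
lin {M = zero}  t x = 𝟎
lin {M = suc M} t x = (t zero ⊡ x zero) ⊞ lin (t ∘ suc) (x ∘ suc)

lookup-⊞ : ∀ {N} (u v : Vec ℤ N) i → lookup (u ⊞ v) i ≡ lookup u i + lookup v i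
lookup-⊞ u v i = Vec.lookup-zipWith _+_ i u v

lookup-⊡ : ∀ {N} a (v : Vec ℤ N) i → lookup (a ⊡ v) i ≡ a * lookup v i
lookup-⊡ a v i = Vec.lookup-map i (a *_) v

lookup-𝟎 : ∀ {N} (i : Fin N) → lookup 𝟎 i ≡ 0ℤ
lookup-𝟎 i = Vec.lookup-replicate i 0ℤ

lookup-lin : ∀ {N M} (t : Fin M → ℤ) (x : Fin M → Vec ℤ N) i →
             lookup (lin t x) i ≡ sum (λ k → t k * lookup (x k) i)
lookup-lin {M = zero}  t x i = lookup-𝟎 i
lookup-lin {M = suc M} t x i = trans (lookup-⊞ (t zero ⊡ x zero) _ i)
  (cong₂ _+_ (lookup-⊡ (t zero) (x zero) i) (lookup-lin (t ∘ suc) (x ∘ suc) i))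

lookup-ext : ∀ {N} {u v : Vec ℤ N} → (∀ i → lookup u i ≡ lookup v i) → u ≡ v
lookup-ext {u = u} {v} e =
  trans (sym (Vec.tabulate∘lookup u)) (trans (Vec.tabulate-cong e) (Vec.tabulate∘lookup v))

alternating-lin : ∀ {N M} {D : List (Vec ℤ N) → ℤ} → Alternating D → ∀ (t : Fin M → ℤ) x ys →
  (∀ k → t k * D (x k ∷ ys) ≡ 0ℤ) → D (lin t x ∷ ys) ≡ 0ℤ
alternating-lin {M = zero}  alt t x ys e = alternating-𝟎 alt ys
alternating-lin {M = suc M} alt t x ys e = trans (additive alt [] _ _ ys)
  (cong₂ _+_ (trans (homogeneous alt [] (t zero) (x zero) ys) (e zero)) (alternating-lin alt _ _ ys (e ∘ suc)))

down : ∀ {A : Set} → (ℕ → A) → ℕ → List A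
down = applyDownFrom

alternating-down : ∀ {N} {D : List (Vec ℤ N) → ℤ} → Alternating D → ∀ (x : ℕ → Vec ℤ N) {k n} →
  k ℕ.< n → D (x k ∷ down x n) ≡ 0ℤ
alternating-down alt x {k} {suc n} (s≤s le) with k ℕ.≟ n
... | yes refl = alternates alt [] (x k) (down x n)
... | no ne = trans (alternating-swap alt (x k) (x n) (down x n))
  (cong -_ (alternating-down (alternating-∷ alt (x n)) x (ℕ.≤∧≢⇒< le ne)))

signed : ∀ {N} → (ℕ → Vec ℤ N) → ℕ → Vec ℤ N
signed x j = σ j ⊡ x j

-- The columns and their recurrence

module _ (M : ℕ) where

  -- `column` in a single coordinate, where integer identities apply. Cutting the sum at `M` loses
  -- nothing for `j < M`, as `s i j` vanishes for `i > j`; so one `M` serves all rows.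
  coordinate : (ℕ → ℤ) → (ℕ → ℤ) → ℕ → ℤ
  coordinate w b j = w j + sum {M} (λ i → sᶻ (toℕ i) j * b (toℕ i))

  column : ∀ {N} → (ℕ → Vec ℤ N) → (ℕ → Vec ℤ N) → ℕ → Vec ℤ N
  column w b j = w j ⊞ lin {M = M} (λ i → sᶻ (toℕ i) j) (b ∘ toℕ)

  lookup-column : ∀ {N} (w b : ℕ → Vec ℤ N) j i →
    lookup (column w b j) i ≡ coordinate (λ j → lookup (w j) i) (λ j → lookup (b j) i) j
  lookup-column w b j i = trans (lookup-⊞ (w j) _ i)
    (cong (λ a → lookup (w j) i + a) (lookup-lin {M = M} _ _ i))

  coordinate-0 : 0 ℕ.< M → ∀ w b → coordinate w b 0 ≡ w 0 + b 0
  coordinate-0 lt w b = cong (λ a → w 0 + a)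
    (trans (sum-cong-≗ {M} (λ k → cong (_* b (toℕ k)) (s₀ (toℕ k)))) (sum-at′ {M} 0 b lt))
    where
    s₀ : ∀ i → sᶻ i 0 ≡ at i i 0
    s₀ zero    = refl
    s₀ (suc i) = sᶻ-upper (suc i) 0 (s≤s z≤n)

  coordinate-1 : 1 ℕ.< M → ∀ w b → coordinate w b 1 ≡ w 1 + (b 0 + b 1)
  coordinate-1 lt w b = cong (λ a → w 1 + a)
    (trans (sum-cong-≗ {M} (λ k → trans (cong (_* b (toℕ k)) (s₁ (toℕ k)))
             (ℤ.*-distribʳ-+ (b (toℕ k)) (at (toℕ k) (toℕ k) 0) (at (toℕ k) (toℕ k) 1))))
      (trans (∑-distrib-+ {M} _ _) (cong₂ _+_ (sum-at′ {M} 0 b (ℕ.<-trans (s≤s z≤n) lt)) (sum-at′ {M} 1 b lt))))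
    where
    s₁ : ∀ i → sᶻ i 1 ≡ at i i 0 + at i i 1
    s₁ zero          = refl
    s₁ (suc zero)    = refl
    s₁ (suc (suc i)) = sᶻ-upper (suc (suc i)) 1 (s≤s (s≤s z≤n))

  -- Inserting the recurrence into column `2 + j` produces the products `s i (k + 1) s k j`. The
  -- final sum cancels them and leaves the `w` part of the columns `k + 1`.
  coordinate-step : ∀ j → 2 ℕ.+ j ℕ.< M → ∀ w b →
    coordinate (λ j → b (2 ℕ.+ j) + w (2 ℕ.+ j) - w (suc j)) (λ j → - w (suc j)) j ≡
    coordinate w b (2 ℕ.+ j) - coordinate w b (suc j) -
    sum {M} (λ k → sᶻ (toℕ k) j * coordinate w b (suc (toℕ k)))
  coordinate-step j lt w b = begin
    b (2 ℕ.+ j) + w (2 ℕ.+ j) - w (suc j) + sum {M} (λ k → s′ k * - w (suc (toℕ k)))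
      ≡⟨ cong (λ a → b (2 ℕ.+ j) + w (2 ℕ.+ j) - w (suc j) + a) (trans
           (sum-cong-≗ {M} (λ k → e₁ (s′ k) (w (suc (toℕ k)))))
           (sym (*-distribˡ-sum {M} -1ℤ (λ k → s′ k * w (suc (toℕ k)))))) ⟩
    b (2 ℕ.+ j) + w (2 ℕ.+ j) - w (suc j) + -1ℤ * S₀
      ≡⟨ e₂ (b (2 ℕ.+ j)) (w (2 ℕ.+ j)) (w (suc j)) S₀ S₁ S₂ ⟩
    w (2 ℕ.+ j) + (b (2 ℕ.+ j) + (S₁ + S₂)) - (w (suc j) + S₁) - (S₀ + S₂)
      ≡⟨ cong₂ (λ u v → w (2 ℕ.+ j) + u - (w (suc j) + S₁) - v) (sym expand) (sym expand′) ⟩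
    coordinate w b (2 ℕ.+ j) - coordinate w b (suc j) -
      sum {M} (λ k → s′ k * coordinate w b (suc (toℕ k))) ∎
    where
    open ≡-Reasoning
    s′ : Fin M → ℤ
    s′ k = sᶻ (toℕ k) j
    r : Fin M → Fin M → ℤ
    r i k = sᶻ (toℕ i) (suc (toℕ k)) * s′ k * b (toℕ i)
    S₀ S₁ S₂ : ℤ
    S₀ = sum {M} (λ k → s′ k * w (suc (toℕ k)))
    S₁ = sum {M} (λ i → sᶻ (toℕ i) (suc j) * b (toℕ i))
    S₂ = sum {M} (λ i → sum {M} (r i))
    e₁ : ∀ a b → a * - b ≡ -1ℤ * (a * b)
    e₁ = solve-∀
    e₂ : ∀ a b c p q t → a + b - c + -1ℤ * p ≡ b + (a + (q + t)) - (c + q) - (p + t)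
    e₂ = solve-∀
    e₃ : ∀ x y z u → (x + (y + z)) * u ≡ x * u + (y * u + z * u)
    e₃ = solve-∀
    expand : sum {M} (λ i → sᶻ (toℕ i) (2 ℕ.+ j) * b (toℕ i)) ≡ b (2 ℕ.+ j) + (S₁ + S₂)
    expand = begin
      sum {M} (λ i → sᶻ (toℕ i) (2 ℕ.+ j) * b (toℕ i))
        ≡⟨ sum-cong-≗ {M} (λ i → trans
             (cong (_* b (toℕ i)) (sᶻ-recurrence M j (ℕ.<-trans (ℕ.<-trans ℕ.≤-refl ℕ.≤-refl) lt) (toℕ i)))
             (trans (e₃ (at (toℕ i) (toℕ i) (2 ℕ.+ j)) (sᶻ (toℕ i) (suc j))
               (sum {M} (λ k → sᶻ (toℕ i) (suc (toℕ k)) * s′ k)) (b (toℕ i)))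
               (cong (λ v → at (toℕ i) (toℕ i) (2 ℕ.+ j) * b (toℕ i) + (sᶻ (toℕ i) (suc j) * b (toℕ i) + v))
                 (*-distribʳ-sum {M} (b (toℕ i)) (λ k → sᶻ (toℕ i) (suc (toℕ k)) * s′ k))))) ⟩
      sum {M} (λ i → at (toℕ i) (toℕ i) (2 ℕ.+ j) * b (toℕ i) + (sᶻ (toℕ i) (suc j) * b (toℕ i) + sum (r i)))
        ≡⟨ trans (∑-distrib-+ {M} _ _) (cong₂ _+_ (sum-at′ {M} (2 ℕ.+ j) b lt) (∑-distrib-+ {M} _ _)) ⟩
      b (2 ℕ.+ j) + (S₁ + S₂) ∎
    expand′ : sum {M} (λ k → s′ k * coordinate w b (suc (toℕ k))) ≡ S₀ + S₂
    expand′ = begin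
      sum {M} (λ k → s′ k * coordinate w b (suc (toℕ k)))
        ≡⟨ sum-cong-≗ {M} (λ k → trans (ℤ.*-distribˡ-+ (s′ k) (w (suc (toℕ k))) (sum {M} (λ i → sᶻ (toℕ i) (suc (toℕ k)) * b (toℕ i))))
             (cong (λ v → s′ k * w (suc (toℕ k)) + v) (trans
               (*-distribˡ-sum {M} (s′ k) (λ i → sᶻ (toℕ i) (suc (toℕ k)) * b (toℕ i)))
               (sum-cong-≗ {M} (λ i → e₄ (s′ k) (sᶻ (toℕ i) (suc (toℕ k))) (b (toℕ i))))))) ⟩
      sum {M} (λ k → s′ k * w (suc (toℕ k)) + sum {M} (λ i → r i k))
        ≡⟨ trans (∑-distrib-+ {M} _ _) (cong (λ v → S₀ + v) (sym (∑-comm {M} {M} r))) ⟩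
      S₀ + S₂ ∎
      where
      e₄ : ∀ a b c → a * (b * c) ≡ b * a * c
      e₄ = solve-∀

  -- The vectors seen by the next smaller half after transfer and removal of the margin, with the
  -- alternating signs divided out. An index shift by one changes the sign, which explains the
  -- factors `-1ℤ`.
  w⁺ b⁺ : ∀ {N} → (ℕ → Vec ℤ N) → (ℕ → Vec ℤ N) → ℕ → Vec ℤ N
  w⁺ w b j = b (2 ℕ.+ j) ⊞ w (2 ℕ.+ j) ⊞ (-1ℤ ⊡ w (suc j))
  b⁺ w b j = -1ℤ ⊡ w (suc j)

  signed-column-step : ∀ {N} (w b : ℕ → Vec ℤ N) j → 2 ℕ.+ j ℕ.< M →
    signed (column (w⁺ w b) (b⁺ w b)) j ≡
    signed (column w b) (2 ℕ.+ j) ⊞ signed (column w b) (suc j) ⊞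
    lin {M = M} (λ k → - σ j * (sᶻ (toℕ k) j * σ (suc (toℕ k)))) (λ k → signed (column w b) (suc (toℕ k)))
  signed-column-step w b j lt = lookup-ext λ i → begin
    lookup (signed (column (w⁺ w b) (b⁺ w b)) j) i
      ≡⟨ lookup-⊡ (σ j) (column (w⁺ w b) (b⁺ w b) j) i ⟩
    σ j * lookup (column (w⁺ w b) (b⁺ w b) j) i
      ≡⟨ cong (σ j *_) (trans (lookup-column (w⁺ w b) (b⁺ w b) j i)
           (cong₂ _+_ (lookup-w⁺ i) (sum-cong-≗ {M} (λ k → cong (sᶻ (toℕ k) j *_) (lookup-b⁺ i (toℕ k)))))) ⟩
    σ j * coordinate (λ j → b′ i (2 ℕ.+ j) + w′ i (2 ℕ.+ j) - w′ i (suc j)) (λ j → - w′ i (suc j)) j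
      ≡⟨ cong (σ j *_) (coordinate-step j lt (w′ i) (b′ i)) ⟩
    σ j * (c i (2 ℕ.+ j) - c i (suc j) - sum {M} (λ k → sᶻ (toℕ k) j * c i (suc (toℕ k))))
      ≡⟨ e₁ (σ j) (c i (2 ℕ.+ j)) (c i (suc j)) (sum {M} (λ k → sᶻ (toℕ k) j * c i (suc (toℕ k)))) ⟩
    - - σ j * c i (2 ℕ.+ j) + - σ j * c i (suc j) + - σ j * sum {M} (λ k → sᶻ (toℕ k) j * c i (suc (toℕ k)))
      ≡⟨ cong₂ _+_ (cong₂ _+_ (lookup-signed i (2 ℕ.+ j)) (lookup-signed i (suc j)))
           (trans (trans (*-distribˡ-sum {M} (- σ j) (λ k → sᶻ (toℕ k) j * c i (suc (toℕ k))))
             (sum-cong-≗ {M} (λ k → trans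
               (e₂ (σ j) (sᶻ (toℕ k) j) (c i (suc (toℕ k))) (σ (suc (toℕ k))) (σ² (suc (toℕ k))))
               (cong (- σ j * (sᶻ (toℕ k) j * σ (suc (toℕ k))) *_) (lookup-signed i (suc (toℕ k)))))))
             (sym (lookup-lin {M = M} _ _ i))) ⟩
    lookup (signed (column w b) (2 ℕ.+ j)) i + lookup (signed (column w b) (suc j)) i + lookup l i
      ≡⟨ trans (lookup-⊞ (signed (column w b) (2 ℕ.+ j) ⊞ signed (column w b) (suc j)) l i)
           (cong (_+ lookup l i) (lookup-⊞ (signed (column w b) (2 ℕ.+ j)) _ i)) ⟨
    lookup (signed (column w b) (2 ℕ.+ j) ⊞ signed (column w b) (suc j) ⊞ l) i ∎
    where
    open ≡-Reasoning
    w′ b′ c : Fin _ → ℕ → ℤ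
    w′ i j = lookup (w j) i
    b′ i j = lookup (b j) i
    c i = coordinate (w′ i) (b′ i)
    l = lin {M = M} (λ k → - σ j * (sᶻ (toℕ k) j * σ (suc (toℕ k)))) (λ k → signed (column w b) (suc (toℕ k)))
    neg-lookup : ∀ v i → lookup (-1ℤ ⊡ v) i ≡ - lookup v i
    neg-lookup v i = trans (lookup-⊡ -1ℤ v i) (ℤ.-1*i≡-i (lookup v i))
    lookup-w⁺ : ∀ i → lookup (w⁺ w b j) i ≡ b′ i (2 ℕ.+ j) + w′ i (2 ℕ.+ j) - w′ i (suc j)
    lookup-w⁺ i = trans (lookup-⊞ (b (2 ℕ.+ j) ⊞ w (2 ℕ.+ j)) _ i)
      (cong₂ _+_ (lookup-⊞ (b (2 ℕ.+ j)) _ i) (neg-lookup (w (suc j)) i))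
    lookup-b⁺ : ∀ i k → lookup (b⁺ w b k) i ≡ - w′ i (suc k)
    lookup-b⁺ i k = neg-lookup (w (suc k)) i
    lookup-signed : ∀ i k → σ k * c i k ≡ lookup (signed (column w b) k) i
    lookup-signed i k = sym (trans (lookup-⊡ (σ k) (column w b k) i) (cong (σ k *_) (lookup-column w b k i)))
    e₁ : ∀ s a b d → s * (a - b - d) ≡ - - s * a + - s * b + - s * d
    e₁ = solve-∀
    e₂ : ∀ s a c t → t * t ≡ 1ℤ → - s * (a * c) ≡ - s * (a * t) * (t * c)
    e₂ s a c t e = trans (sym (ℤ.*-identityʳ _)) (trans (cong (- s * (a * c) *_) (sym e)) (e′ s a c t))
      where
      e′ : ∀ s a c t → - s * (a * c) * (t * t) ≡ - s * (a * t) * (t * c)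
      e′ = solve-∀

module _ (M : ℕ) {N : ℕ} (w b : ℕ → Vec ℤ N) where

  private
    c f : ℕ → Vec ℤ N
    c = signed (column M w b)
    f = transferred (signed w) (signed b)

    wᵢ bᵢ : Fin N → ℕ → ℤ
    wᵢ i j = lookup (w j) i
    bᵢ i j = lookup (b j) i

    lookup-c : ∀ j i → lookup (c j) i ≡ σ j * coordinate M (wᵢ i) (bᵢ i) j
    lookup-c j i = trans (lookup-⊡ (σ j) (column M w b j) i) (cong (σ j *_) (lookup-column M w b j i))

    lookup₃ : ∀ s t u v₁ v₂ v₃ i → lookup ((s ⊡ v₁) ⊞ (t ⊡ v₂) ⊞ (u ⊡ v₃)) i ≡
      s * lookup {n = N} v₁ i + t * lookup v₂ i + u * lookup v₃ i
    lookup₃ s t u v₁ v₂ v₃ i = trans (lookup-⊞ ((s ⊡ v₁) ⊞ (t ⊡ v₂)) (u ⊡ v₃) i)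
      (cong₂ _+_ (trans (lookup-⊞ (s ⊡ v₁) (t ⊡ v₂) i) (cong₂ _+_ (lookup-⊡ s v₁ i) (lookup-⊡ t v₂ i)))
                 (lookup-⊡ u v₃ i))

  transferred-0 : 0 ℕ.< M → f 0 ≡ c 0
  transferred-0 lt = lookup-ext λ i → begin
    lookup (f 0) i
      ≡⟨ trans (lookup-⊞ ((1ℤ ⊡ b 0) ⊞ (1ℤ ⊡ w 0)) 𝟎 i) (cong₂ _+_
           (trans (lookup-⊞ (1ℤ ⊡ b 0) (1ℤ ⊡ w 0) i) (cong₂ _+_ (lookup-⊡ 1ℤ (b 0) i) (lookup-⊡ 1ℤ (w 0) i)))
           (lookup-𝟎 i)) ⟩
    1ℤ * lookup (b 0) i + 1ℤ * lookup (w 0) i + 0ℤ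
      ≡⟨ e (lookup (b 0) i) (lookup (w 0) i) ⟩
    1ℤ * (lookup (w 0) i + lookup (b 0) i)
      ≡⟨ trans (lookup-c 0 i) (cong (1ℤ *_) (coordinate-0 M lt (wᵢ i) (bᵢ i))) ⟨
    lookup (c 0) i ∎
    where
    open ≡-Reasoning
    e : ∀ x y → 1ℤ * x + 1ℤ * y + 0ℤ ≡ 1ℤ * (y + x)
    e = solve-∀

  transferred-1 : 1 ℕ.< M → f 1 ≡ c 1 ⊞ c 0
  transferred-1 lt = lookup-ext λ i → begin
    lookup (f 1) i
      ≡⟨ lookup₃ -1ℤ -1ℤ 1ℤ (b 1) (w 1) (w 0) i ⟩
    -1ℤ * lookup (b 1) i + -1ℤ * lookup (w 1) i + 1ℤ * lookup (w 0) i
      ≡⟨ e (lookup (b 1) i) (lookup (w 1) i) (lookup (w 0) i) (lookup (b 0) i) ⟩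
    -1ℤ * (lookup (w 1) i + (lookup (b 0) i + lookup (b 1) i)) + 1ℤ * (lookup (w 0) i + lookup (b 0) i)
      ≡⟨ cong₂ _+_ (trans (lookup-c 1 i) (cong (-1ℤ *_) (coordinate-1 M lt (wᵢ i) (bᵢ i))))
                   (trans (lookup-c 0 i) (cong (1ℤ *_) (coordinate-0 M (ℕ.<-trans (s≤s z≤n) lt) (wᵢ i) (bᵢ i)))) ⟨
    lookup (c 1) i + lookup (c 0) i
      ≡⟨ lookup-⊞ (c 1) (c 0) i ⟨
    lookup (c 1 ⊞ c 0) i ∎
    where
    open ≡-Reasoning
    e : ∀ x y z u → -1ℤ * x + -1ℤ * y + 1ℤ * z ≡ -1ℤ * (y + (u + x)) + 1ℤ * (z + u)
    e = solve-∀

  transferred-2 : ∀ j → f (2 ℕ.+ j) ≡ signed (w⁺ M w b) j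
  transferred-2 j = lookup-ext λ i → begin
    lookup (f (2 ℕ.+ j)) i
      ≡⟨ lookup₃ (- - σ j) (- - σ j) (- σ j) (b (2 ℕ.+ j)) (w (2 ℕ.+ j)) (w (suc j)) i ⟩
    - - σ j * lookup (b (2 ℕ.+ j)) i + - - σ j * lookup (w (2 ℕ.+ j)) i + - σ j * lookup (w (suc j)) i
      ≡⟨ e (σ j) (lookup (b (2 ℕ.+ j)) i) (lookup (w (2 ℕ.+ j)) i) (lookup (w (suc j)) i) ⟩
    σ j * (lookup (b (2 ℕ.+ j)) i + lookup (w (2 ℕ.+ j)) i + -1ℤ * lookup (w (suc j)) i)
      ≡⟨ cong (σ j *_) (trans (lookup-⊞ (b (2 ℕ.+ j) ⊞ w (2 ℕ.+ j)) (-1ℤ ⊡ w (suc j)) i)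
           (cong₂ _+_ (lookup-⊞ (b (2 ℕ.+ j)) (w (2 ℕ.+ j)) i) (lookup-⊡ -1ℤ (w (suc j)) i))) ⟨
    σ j * lookup (w⁺ M w b j) i
      ≡⟨ lookup-⊡ (σ j) (w⁺ M w b j) i ⟨
    lookup (signed (w⁺ M w b) j) i ∎
    where
    open ≡-Reasoning
    e : ∀ s x y z → - - s * x + - - s * y + - s * z ≡ s * (x + y + -1ℤ * z)
    e = solve-∀

  signed-b⁺ : ∀ j → signed w (suc j) ≡ signed (b⁺ M w b) j
  signed-b⁺ j = lookup-ext λ i → begin
    lookup (signed w (suc j)) i         ≡⟨ lookup-⊡ (- σ j) (w (suc j)) i ⟩
    - σ j * lookup (w (suc j)) i        ≡⟨ e (σ j) (lookup (w (suc j)) i) ⟩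
    σ j * (-1ℤ * lookup (w (suc j)) i)  ≡⟨ cong (σ j *_) (lookup-⊡ -1ℤ (w (suc j)) i) ⟨
    σ j * lookup (-1ℤ ⊡ w (suc j)) i    ≡⟨ lookup-⊡ (σ j) (-1ℤ ⊡ w (suc j)) i ⟨
    lookup (signed (b⁺ M w b) j) i      ∎
    where
    open ≡-Reasoning
    e : ∀ s x → - s * x ≡ s * (-1ℤ * x)
    e = solve-∀

  -- The two families of columns differ by unitriangular column operations.
  reduce-columns : ∀ {D : List (Vec ℤ N) → ℤ} → Alternating D → ∀ k → 2 ℕ.+ k ≤ M →
    D (down (signed (column M (w⁺ M w b) (b⁺ M w b))) k ⧺ f 1 ∷ f 0 ∷ []) ≡ D (down c (2 ℕ.+ k))
  reduce-columns {D} alt zero le = begin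
    D (f 1 ∷ f 0 ∷ [])
      ≡⟨ cong₂ (λ u v → D (u ∷ v ∷ [])) (transferred-1 le) (transferred-0 (ℕ.<-trans (s≤s z≤n) le)) ⟩
    D ((c 1 ⊞ c 0) ∷ c 0 ∷ [])
      ≡⟨ additive alt [] (c 1) (c 0) (c 0 ∷ []) ⟩
    D (c 1 ∷ c 0 ∷ []) + D (c 0 ∷ c 0 ∷ [])
      ≡⟨ cong (λ z → D (c 1 ∷ c 0 ∷ []) + z) (alternates alt [] (c 0) []) ⟩
    D (c 1 ∷ c 0 ∷ []) + 0ℤ
      ≡⟨ ℤ.+-identityʳ _ ⟩
    D (c 1 ∷ c 0 ∷ []) ∎
    where open ≡-Reasoning
  reduce-columns {D} alt (suc k) le = begin
    D (c⁺ k ∷ (down c⁺ k ⧺ f 1 ∷ f 0 ∷ []))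
      ≡⟨ reduce-columns (alternating-∷ alt (c⁺ k)) k (ℕ.≤-trans (ℕ.n≤1+n _) le) ⟩
    D (c⁺ k ∷ r)
      ≡⟨ cong (λ v → D (v ∷ r)) (signed-column-step M w b k le) ⟩
    D ((c (2 ℕ.+ k) ⊞ c (suc k) ⊞ lin t x) ∷ r)
      ≡⟨ trans (additive alt [] (c (2 ℕ.+ k) ⊞ c (suc k)) (lin t x) r)
           (cong (_+ D (lin t x ∷ r)) (additive alt [] (c (2 ℕ.+ k)) (c (suc k)) r)) ⟩
    D (c (2 ℕ.+ k) ∷ r) + D (c (suc k) ∷ r) + D (lin t x ∷ r)
      ≡⟨ cong₂ (λ u v → D (c (2 ℕ.+ k) ∷ r) + u + v)
           (alternating-down alt c ℕ.≤-refl) (alternating-lin alt t x r (λ i → term (toℕ i))) ⟩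
    D (c (2 ℕ.+ k) ∷ r) + 0ℤ + 0ℤ
      ≡⟨ trans (ℤ.+-identityʳ _) (ℤ.+-identityʳ _) ⟩
    D (c (2 ℕ.+ k) ∷ r) ∎
    where
    open ≡-Reasoning
    c⁺ : ℕ → Vec ℤ N
    c⁺ = signed (column M (w⁺ M w b) (b⁺ M w b))
    r = down c (2 ℕ.+ k)
    t : Fin M → ℤ
    t i = - σ k * (sᶻ (toℕ i) k * σ (suc (toℕ i)))
    x : Fin M → Vec ℤ N
    x i = c (suc (toℕ i))
    term : ∀ i → - σ k * (sᶻ i k * σ (suc i)) * D (c (suc i) ∷ r) ≡ 0ℤ
    term i with i ℕ.≤? k
    ... | yes i≤k = trans (cong (- σ k * (sᶻ i k * σ (suc i)) *_) (alternating-down alt c (s≤s (s≤s i≤k))))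
                          (ℤ.*-zeroʳ (- σ k * (sᶻ i k * σ (suc i))))
    ... | no i≰k  = trans (cong (λ z → - σ k * (z * σ (suc i)) * D (c (suc i) ∷ r)) (sᶻ-upper i k (ℕ.≰⇒> i≰k)))
                          (cong (_* D (c (suc i) ∷ r)) (ℤ.*-zeroʳ (- σ k)))

-- One transfer and the removal of the margin reduce `n` by two. The margin vectors `f 1` and `f 0`
-- are absorbed into the form and return as the columns with indices 1 and 0.
lowerSum-alternating : ∀ M {N} n → n ≤ M → ∀ {D : List (Vec ℤ N) → ℤ} → Alternating D → ∀ w b →
  lowerSum n (λ q → D (sel false (sites n (signed w) (signed b)) q)) ≡ D (down (signed (column M w b)) n)
lowerSum-alternating M zero    le alt w b = refl
lowerSum-alternating M (suc zero) le {D} alt w b =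
  trans (rowSum-alternating 1 alt (sites 1 (signed w) (signed b)) ones)
        (cong (λ v → D (v ∷ [])) (transferred-0 M w b le))
lowerSum-alternating M (suc (suc m)) le {D} alt w b = begin
  lowerSum m (λ p → rowSum (pad p) ones (λ q → D (sel false (sites (2 ℕ.+ m) (signed w) (signed b)) q)))
    ≡⟨ ext (lowerSum-linear m) (λ p → trans
         (rowSum-alternating (2 ℕ.+ m) alt (sites (2 ℕ.+ m) (signed w) (signed b)) (pad p))
         (trans (cong (λ a → D (sel true a (pad p))) moved)
                (cong D (sel-pad m (sites m w′ b′) (signed w (suc m)) (f 1) (signed w 0) (f 0) p)))) ⟩
  lowerSum m (λ p → D (sel false (sites m w′ b′) p ⧺ f 1 ∷ f 0 ∷ []))
    ≡⟨ lowerSum-alternating M m (ℕ.≤-trans (ℕ.m≤n+m m 2) le) (alternating-⧺ alt (f 1 ∷ f 0 ∷ []))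
         (w⁺ M w b) (b⁺ M w b) ⟩
  D (down (signed (column M (w⁺ M w b) (b⁺ M w b))) m ⧺ f 1 ∷ f 0 ∷ [])
    ≡⟨ reduce-columns M w b alt m le ⟩
  D (down (signed (column M w b)) (2 ℕ.+ m)) ∎
  where
  open ≡-Reasoning
  f = transferred (signed w) (signed b)
  w′ = signed (w⁺ M w b)
  b′ = signed (b⁺ M w b)
  moved : transfer (2 ℕ.+ m) (sites (2 ℕ.+ m) (signed w) (signed b)) ≡
    signed w (suc m) ∷ (sites m w′ b′ ∷ʳ f 1 ∷ʳ signed w 0 ∷ʳ f 0)
  moved = begin
    transfer (2 ℕ.+ m) (sites (2 ℕ.+ m) (signed w) (signed b))
      ≡⟨ transfer-sites (2 ℕ.+ m) (signed w) (signed b) ⟩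
    sites (2 ℕ.+ m) (signed w) f
      ≡⟨ sites-pad m (signed w) f ⟩
    signed w (suc m) ∷ (sites m (λ j → f (2 ℕ.+ j)) (λ j → signed w (suc j)) ∷ʳ f 1 ∷ʳ signed w 0 ∷ʳ f 0)
      ≡⟨ cong (λ s → signed w (suc m) ∷ (s ∷ʳ f 1 ∷ʳ signed w 0 ∷ʳ f 0))
           (sites-cong m (λ j _ → transferred-2 M w b j) (λ j _ → signed-b⁺ M w b j)) ⟩
    signed w (suc m) ∷ (sites m w′ b′ ∷ʳ f 1 ∷ʳ signed w 0 ∷ʳ f 0) ∎

-- Pairing the two halves

HasArity : ∀ {N} → ℕ → (List (Vec ℤ N) → ℤ) → Set
HasArity k D = ∀ xs → length xs ≢ k → D xs ≡ 0ℤ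

arity-∷ : ∀ {N k} {D : List (Vec ℤ N) → ℤ} → HasArity (suc k) D → ∀ x → HasArity k (D ∘ (x ∷_))
arity-∷ ar x xs ne = ar (x ∷ xs) (ne ∘ ℕ.suc-injective)

arity-∷ʳ : ∀ {N k} {D : List (Vec ℤ N) → ℤ} → HasArity (suc k) D → ∀ x → HasArity k (λ xs → D (xs ⧺ x ∷ []))
arity-∷ʳ ar x xs ne = ar (xs ⧺ x ∷ []) λ e →
  ne (ℕ.suc-injective (trans (sym (trans (List.length-++ xs) (ℕ.+-comm _ 1))) e))

-- The signs that moving each vector from the end of a list of the following vectors to its front takes.
twist : ∀ {N k} → Vec (Vec ℤ N) k → Vec (Vec ℤ N) k
twist {k = zero}  []       = []
twist {k = suc k} (a ∷ as) = (σ k ⊡ a) ∷ twist as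

prepend : ∀ {A : Set} → Bool → A → List A → List A
prepend b x xs = if b then x ∷ xs else xs

-- Because the second selection is reversed, a first site sits at the front of one selection and at
-- the very end of the other; it can be split off by prefixing or by appending.
append-reverse : ∀ {A : Set} (xs ys : List A) y → xs ⧺ reverseᴸ (y ∷ ys) ≡ (xs ⧺ reverseᴸ ys) ⧺ y ∷ []
append-reverse xs ys y = trans (cong (xs ⧺_) (List.unfold-reverse y ys)) (sym (List.++-assoc xs (reverseᴸ ys) _))

alternating-both : ∀ {N} {D : List (Vec ℤ N) → ℤ} → Alternating D → ∀ s a xs ys →
  D (a ∷ xs ⧺ reverseᴸ ((s ⊡ a) ∷ ys)) ≡ 0ℤ
alternating-both {D = D} alt s a xs ys = begin
  D (a ∷ xs ⧺ reverseᴸ ((s ⊡ a) ∷ ys))       ≡⟨ cong (λ l → D (a ∷ l)) (append-reverse xs ys (s ⊡ a)) ⟩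
  D (a ∷ (xs ⧺ reverseᴸ ys) ⧺ (s ⊡ a) ∷ [])  ≡⟨ homogeneous alt (a ∷ xs ⧺ reverseᴸ ys) s a [] ⟩
  s * D (a ∷ (xs ⧺ reverseᴸ ys) ⧺ a ∷ [])    ≡⟨ cong (s *_) (alternating-repeat alt a (xs ⧺ reverseᴸ ys) []) ⟩
  s * 0ℤ                                     ≡⟨ ℤ.*-zeroʳ s ⟩
  0ℤ                                         ∎
  where open ≡-Reasoning

-- A site selected on both sides makes the product vanish. Otherwise at most `l` vectors occur, too
-- few for `D`.
pairing-short : ∀ {N k l} {D : List (Vec ℤ N) → ℤ} → Alternating D → HasArity k D → l ℕ.< k →
  ∀ c (a : Vec (Vec ℤ N) l) p q → D (sel c a p ⧺ reverseᴸ (sel (not c) (twist a) q)) ≡ 0ℤ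
pairing-short alt ar lt c [] [] [] = ar [] λ { refl → ℕ.<⇒≱ lt z≤n }
pairing-short {k = suc k} {l = suc l} {D} alt ar (s≤s lt) c (a ∷ as) (p₀ ∷ p) (q₀ ∷ q) =
  go (p₀ xor c) (q₀ xor not c)
  where
  X = sel (not c) as p
  Y = sel (not (not c)) (twist as) q
  go : ∀ s t → D (prepend s a X ⧺ reverseᴸ (prepend t (σ l ⊡ a) Y)) ≡ 0ℤ
  go true  true  = alternating-both alt (σ l) a X Y
  go true  false = pairing-short (alternating-∷ alt a) (arity-∷ ar a) lt (not c) as p q
  go false true  = trans (cong D (append-reverse X Y (σ l ⊡ a)))
    (pairing-short (alternating-⧺ alt _) (arity-∷ʳ ar _) lt (not c) as p q)
  go false false = pairing-short alt ar (ℕ.m<n⇒m<1+n lt) (not c) as p q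

-- The colours are opposite, so p = q means that the two selections are complementary.
pairing : ∀ {N k} {D : List (Vec ℤ N) → ℤ} → Alternating D → HasArity k D →
  ∀ c (a : Vec (Vec ℤ N) k) p q →
  D (sel c a p ⧺ reverseᴸ (sel (not c) (twist a) q)) ≡ δ p q * D (toList a)
pairing alt ar c [] [] [] = sym (ℤ.*-identityˡ _)
pairing {k = suc k} {D} alt ar c (a ∷ as) (p₀ ∷ p) (q₀ ∷ q) = go c p₀ q₀
  where
  short : ∀ c → D (sel c as p ⧺ reverseᴸ (sel (not c) (twist as) q)) ≡ 0ℤ
  short c = pairing-short alt ar ℕ.≤-refl c as p q
  first : ∀ c → D (a ∷ sel c as p ⧺ reverseᴸ (sel (not c) (twist as) q)) ≡ δ p q * D (a ∷ toList as)
  first c = pairing (alternating-∷ alt a) (arity-∷ ar a) c as p q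
  rotate : D (toList as ⧺ (σ k ⊡ a) ∷ []) ≡ D (a ∷ toList as)
  rotate = begin
    D (toList as ⧺ (σ k ⊡ a) ∷ [])
      ≡⟨ homogeneous alt (toList as) (σ k) a [] ⟩
    σ k * D (toList as ⧺ a ∷ [])
      ≡⟨ cong (σ k *_) (alternating-move alt a (toList as) []) ⟩
    σ k * (σ (length (toList as)) * D (a ∷ toList as ⧺ []))
      ≡⟨ cong₂ (λ i l → σ k * (σ i * D (a ∷ l))) (Vec.length-toList as) (List.++-identityʳ (toList as)) ⟩
    σ k * (σ k * D (a ∷ toList as))
      ≡⟨ trans (sym (ℤ.*-assoc (σ k) (σ k) _)) (cong (_* D (a ∷ toList as)) (σ² k)) ⟩
    1ℤ * D (a ∷ toList as)
      ≡⟨ ℤ.*-identityˡ _ ⟩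
    D (a ∷ toList as) ∎
    where open ≡-Reasoning
  second : ∀ c → D (sel c as p ⧺ reverseᴸ ((σ k ⊡ a) ∷ sel (not c) (twist as) q)) ≡ δ p q * D (a ∷ toList as)
  second c = trans (cong D (append-reverse (sel c as p) (sel (not c) (twist as) q) (σ k ⊡ a)))
    (trans (pairing (alternating-⧺ alt _) (arity-∷ʳ ar _) c as p q) (cong (δ p q *_) rotate))
  go : ∀ c p₀ q₀ →
    D (sel c (a ∷ as) (p₀ ∷ p) ⧺ reverseᴸ (sel (not c) (twist (a ∷ as)) (q₀ ∷ q))) ≡
    δ (p₀ ∷ p) (q₀ ∷ q) * D (toList (a ∷ as))
  go true  true  true  = second false
  go true  true  false = short false
  go true  false true  = alternating-both alt (σ k) a (sel false as p) (sel true (twist as) q)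
  go true  false false = first false
  go false true  true  = first true
  go false true  false = alternating-both alt (σ k) a (sel true as p) (sel false (twist as) q)
  go false false true  = short true
  go false false false = second true

-- Reversed selections

sel-∷ʳ : ∀ {N} n (a : Vec (Vec ℤ N) (double n)) x y q u v →
  sel false (a ∷ʳ x ∷ʳ y) (q ∷ʳ u ∷ʳ v) ≡ sel false a q ⧺ sel false (x ∷ y ∷ []) (u ∷ v ∷ [])
sel-∷ʳ zero    []            x y []                  u v = refl
sel-∷ʳ (suc n) (a₁ ∷ a₂ ∷ a) x y (true ∷ true ∷ q)   u v = cong (a₁ ∷_) (sel-∷ʳ n a x y q u v)
sel-∷ʳ (suc n) (a₁ ∷ a₂ ∷ a) x y (true ∷ false ∷ q)  u v = cong (λ l → a₁ ∷ a₂ ∷ l) (sel-∷ʳ n a x y q u v)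
sel-∷ʳ (suc n) (a₁ ∷ a₂ ∷ a) x y (false ∷ true ∷ q)  u v = sel-∷ʳ n a x y q u v
sel-∷ʳ (suc n) (a₁ ∷ a₂ ∷ a) x y (false ∷ false ∷ q) u v = cong (a₂ ∷_) (sel-∷ʳ n a x y q u v)

reverse-∷∷ : ∀ {A : Set} {k} x y (v : Vec A k) → reverse (x ∷ y ∷ v) ≡ reverse v ∷ʳ y ∷ʳ x
reverse-∷∷ x y v = trans (Vec.reverse-∷ x (y ∷ v)) (cong (_∷ʳ x) (Vec.reverse-∷ y v))

-- The number of sites is even, so reading them from the other end exchanges the colours. This
-- supplies the opposite colours that `pairing` asks for.
sel-reverse : ∀ {N} n (a : Vec (Vec ℤ N) (double n)) q →
  sel false (reverse a) (reverse q) ≡ reverseᴸ (sel true a q)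
sel-reverse zero    []          []          = refl
sel-reverse (suc n) (x ∷ y ∷ a) (u ∷ v ∷ q)
  rewrite reverse-∷∷ x y a | reverse-∷∷ u v q
        | sel-∷ʳ n (reverse a) y x (reverse q) v u | sel-reverse n a q = go u v
  where
  r = sel true a q
  go : ∀ u v → reverseᴸ r ⧺ sel false (y ∷ x ∷ []) (v ∷ u ∷ []) ≡ reverseᴸ (sel true (x ∷ y ∷ a) (u ∷ v ∷ q))
  go true  true  = sym (List.unfold-reverse y r)
  go true  false = List.++-identityʳ _
  go false true  = sym (trans (List.unfold-reverse x (y ∷ r))
    (trans (cong (_⧺ x ∷ []) (List.unfold-reverse y r)) (List.++-assoc (reverseᴸ r) (y ∷ []) (x ∷ []))))
  go false false = sym (List.unfold-reverse x r)

sites-∷ʳ : ∀ {N} n (w b : ℕ → Vec ℤ N) → sites (suc n) w b ≡ sites n (w ∘ suc) (b ∘ suc) ∷ʳ w 0 ∷ʳ b 0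
sites-∷ʳ zero    w b = refl
sites-∷ʳ (suc n) w b = cong₂ _∷_ refl (cong₂ _∷_ refl (sites-∷ʳ n w b))

reverse-sites : ∀ {N} n (w b : ℕ → Vec ℤ N) →
  reverse (sites n w b) ≡ sites n (λ j → b (n ℕ.∸ suc j)) (λ j → w (n ℕ.∸ suc j))
reverse-sites zero    w b = refl
reverse-sites (suc n) w b = begin
  reverse (w n ∷ b n ∷ sites n w b)        ≡⟨ reverse-∷∷ (w n) (b n) (sites n w b) ⟩
  reverse (sites n w b) ∷ʳ b n ∷ʳ w n      ≡⟨ cong (λ v → v ∷ʳ b n ∷ʳ w n) (reverse-sites n w b) ⟩
  sites n (λ j → b (n ℕ.∸ suc j)) (λ j → w (n ℕ.∸ suc j)) ∷ʳ b n ∷ʳ w n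
    ≡⟨ sites-∷ʳ n (λ j → b (suc n ℕ.∸ suc j)) (λ j → w (suc n ℕ.∸ suc j)) ⟨
  sites (suc n) (λ j → b (suc n ℕ.∸ suc j)) (λ j → w (suc n ℕ.∸ suc j)) ∎
  where open ≡-Reasoning

σ-double : ∀ n → σ (double n) ≡ 1ℤ
σ-double zero    = refl
σ-double (suc n) = trans (ℤ.neg-involutive _) (σ-double n)

twist-sites : ∀ {N} n (w b : ℕ → Vec ℤ N) →
  twist (sites n w b) ≡ sites n (λ j → -1ℤ ⊡ w j) (λ j → 1ℤ ⊡ b j)
twist-sites zero    w b = refl
twist-sites (suc n) w b = cong₂ _∷_ (cong (λ s → (- s) ⊡ w n) (σ-double n))
  (cong₂ _∷_ (cong (_⊡ b n) (σ-double n)) (twist-sites n w b))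

noBits : ∀ {k} → Vec Bool k
noBits = replicate _ false

sel-noBits-b : ∀ {N} n (w b : ℕ → Vec ℤ N) → sel false (sites n w b) noBits ≡ down b n
sel-noBits-b zero    w b = refl
sel-noBits-b (suc n) w b = cong (b n ∷_) (sel-noBits-b n w b)

sel-noBits-w : ∀ {N} n (w b : ℕ → Vec ℤ N) → sel true (sites n w b) noBits ≡ down w n
sel-noBits-w zero    w b = refl
sel-noBits-w (suc n) w b = cong (w n ∷_) (sel-noBits-w n w b)

up : ∀ {A : Set} → (ℕ → A) → ℕ → List A
up = applyUpTo

down-up : ∀ {A : Set} (f : ℕ → A) n → down f n ≡ up (λ j → f (n ℕ.∸ suc j)) n
down-up f zero    = refl
down-up f (suc n) = cong (f n ∷_) (down-up f n)

reverse-down : ∀ {A : Set} (f : ℕ → A) n → reverseᴸ (down f n) ≡ down (λ j → f (n ℕ.∸ suc j)) n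
reverse-down f n = trans (cong reverseᴸ (down-up f n)) (List.reverse-applyUpTo _ n)

σ-+ : ∀ i j → σ (i ℕ.+ j) ≡ σ i * σ j
σ-+ zero    j = sym (ℤ.*-identityˡ (σ j))
σ-+ (suc i) j = trans (cong -_ (σ-+ i j)) (ℤ.neg-distribˡ-* (σ i) (σ j))

σ-complement : ∀ n j → j ℕ.< n → σ j * σ (ℕ.pred n) ≡ σ (n ℕ.∸ suc j)
σ-complement (suc n) j (s≤s le) = begin
  σ j * σ n                        ≡⟨ cong (λ k → σ j * σ k) (ℕ.m+[n∸m]≡n le) ⟨
  σ j * σ (j ℕ.+ (n ℕ.∸ j))        ≡⟨ cong (σ j *_) (σ-+ j (n ℕ.∸ j)) ⟩
  σ j * (σ j * σ (n ℕ.∸ j))        ≡⟨ ℤ.*-assoc (σ j) (σ j) _ ⟨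
  σ j * σ j * σ (n ℕ.∸ j)          ≡⟨ cong (_* σ (n ℕ.∸ j)) (σ² j) ⟩
  1ℤ * σ (n ℕ.∸ j)                 ≡⟨ ℤ.*-identityˡ _ ⟩
  σ (n ℕ.∸ j)                      ∎
  where open ≡-Reasoning

⊡-⊡ : ∀ {N} a b (v : Vec ℤ N) → a ⊡ b ⊡ v ≡ (a * b) ⊡ v
⊡-⊡ a b v = lookup-ext λ i → trans (lookup-⊡ a (b ⊡ v) i) (trans (cong (a *_) (lookup-⊡ b v i))
  (trans (sym (ℤ.*-assoc a b _)) (sym (lookup-⊡ (a * b) v i))))

module _ {N} (n : ℕ) {D : List (Vec ℤ N) → ℤ} (alt : Alternating D) (ar : HasArity (double n) D)
         (w b : ℕ → Vec ℤ N) where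

  private
    τ : ℤ
    τ = σ (ℕ.pred n)
    a : Vec (Vec ℤ N) (double n)
    a = sites n (signed w) (signed b)
    w₂ b₂ : ℕ → Vec ℤ N
    w₂ j = τ ⊡ b (n ℕ.∸ suc j)
    b₂ j = (- τ) ⊡ w (n ℕ.∸ suc j)

  -- Brings the dual vectors into the signed form that the evaluation of a half expects. Reversal
  -- replaces `σ j` by `σ (n - 1 - j)`, and the constant `τ` makes up for the difference.
  reverse-twist-sites : reverse (twist a) ≡ sites n (signed w₂) (signed b₂)
  reverse-twist-sites = trans (cong reverse (twist-sites n (signed w) (signed b)))
    (trans (reverse-sites n _ _) (sites-cong n
      (λ j lt → begin
        1ℤ ⊡ σ (n ℕ.∸ suc j) ⊡ b (n ℕ.∸ suc j)  ≡⟨ ⊡-⊡ 1ℤ (σ (n ℕ.∸ suc j)) (b (n ℕ.∸ suc j)) ⟩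
        (1ℤ * σ (n ℕ.∸ suc j)) ⊡ b (n ℕ.∸ suc j)
          ≡⟨ cong (_⊡ b (n ℕ.∸ suc j)) (trans (ℤ.*-identityˡ _) (sym (σ-complement n j lt))) ⟩
        (σ j * τ) ⊡ b (n ℕ.∸ suc j)              ≡⟨ ⊡-⊡ (σ j) τ (b (n ℕ.∸ suc j)) ⟨
        σ j ⊡ τ ⊡ b (n ℕ.∸ suc j)                ∎)
      (λ j lt → begin
        -1ℤ ⊡ σ (n ℕ.∸ suc j) ⊡ w (n ℕ.∸ suc j)  ≡⟨ ⊡-⊡ -1ℤ (σ (n ℕ.∸ suc j)) (w (n ℕ.∸ suc j)) ⟩
        (-1ℤ * σ (n ℕ.∸ suc j)) ⊡ w (n ℕ.∸ suc j)
          ≡⟨ cong (_⊡ w (n ℕ.∸ suc j)) (trans (cong (-1ℤ *_) (sym (σ-complement n j lt))) (e (σ j) τ)) ⟩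
        (σ j * - τ) ⊡ w (n ℕ.∸ suc j)             ≡⟨ ⊡-⊡ (σ j) (- τ) (w (n ℕ.∸ suc j)) ⟨
        σ j ⊡ (- τ) ⊡ w (n ℕ.∸ suc j)             ∎)))
    where
    open ≡-Reasoning
    e : ∀ s t → -1ℤ * (s * t) ≡ s * - t
    e = solve-∀

  -- The pairing writes the matching condition of the halves as a value of `D`. Then the sum over
  -- each half is evaluated while the vectors contributed by the other are kept fixed.
  total-alternating : D (toList a) * lowerSum n (upperSum n) ≡
    D (down (signed (column n w b)) n ⧺ down (signed (column n w₂ b₂)) n)
  total-alternating = begin
    d * lowerSum n (upperSum n)
      ≡⟨ cong (d *_) (ext L (upperSum-lowerSum n)) ⟩
    d * lowerSum n (λ p → lowerSum n (λ q → δ p (reverse q)))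
      ≡⟨ scale L d _ ⟨
    lowerSum n (λ p → d * lowerSum n (λ q → δ p (reverse q)))
      ≡⟨ ext L (λ p → sym (scale L d _)) ⟩
    lowerSum n (λ p → lowerSum n (λ q → d * δ p (reverse q)))
      ≡⟨ ext L (λ p → ext L (λ q → paired p q)) ⟩
    lowerSum n (λ p → lowerSum n (λ q → D (sel false a p ⧺ sel false (sites n (signed w₂) (signed b₂)) q)))
      ≡⟨ ext L (λ p → lowerSum-alternating n n ℕ.≤-refl (alternating-prefix alt (sel false a p)) w₂ b₂) ⟩
    lowerSum n (λ p → D (sel false a p ⧺ down (signed (column n w₂ b₂)) n))
      ≡⟨ lowerSum-alternating n n ℕ.≤-refl (alternating-⧺ alt (down (signed (column n w₂ b₂)) n)) w b ⟩
    D (down (signed (column n w b)) n ⧺ down (signed (column n w₂ b₂)) n) ∎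
    where
    open ≡-Reasoning
    d = D (toList a)
    L = lowerSum-linear n
    paired : ∀ p q → d * δ p (reverse q) ≡ D (sel false a p ⧺ sel false (sites n (signed w₂) (signed b₂)) q)
    paired p q = begin
      d * δ p (reverse q)
        ≡⟨ ℤ.*-comm d _ ⟩
      δ p (reverse q) * d
        ≡⟨ pairing alt ar false a p (reverse q) ⟨
      D (sel false a p ⧺ reverseᴸ (sel true (twist a) (reverse q)))
        ≡⟨ cong (λ l → D (sel false a p ⧺ l)) (sel-reverse n (twist a) (reverse q)) ⟨
      D (sel false a p ⧺ sel false (reverse (twist a)) (reverse (reverse q)))
        ≡⟨ cong₂ (λ v r → D (sel false a p ⧺ sel false v r)) reverse-twist-sites (Vec.reverse-involutive q) ⟩
      D (sel false a p ⧺ sel false (sites n (signed w₂) (signed b₂)) q) ∎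

  -- Pairing the empty set with itself selects every `b` on one side and every `w` on the other,
  -- which sorts the interlaced vectors without a separate computation of signs.
  basis-alternating : D (toList a) ≡ D (down (signed b) n ⧺ down (λ j → -1ℤ ⊡ signed w (n ℕ.∸ suc j)) n)
  basis-alternating = begin
    D (toList a)
      ≡⟨ ℤ.*-identityˡ _ ⟨
    1ℤ * D (toList a)
      ≡⟨ cong (_* D (toList a)) (δ-refl none) ⟨
    δ none none * D (toList a)
      ≡⟨ pairing alt ar false a none none ⟨
    D (sel false a none ⧺ reverseᴸ (sel true (twist a) none))
      ≡⟨ cong (λ v → D (sel false a none ⧺ reverseᴸ (sel true v none))) (twist-sites n (signed w) (signed b)) ⟩
    D (sel false a none ⧺ reverseᴸ (sel true (sites n (λ j → -1ℤ ⊡ signed w j) _) none))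
      ≡⟨ cong₂ (λ l r → D (l ⧺ r)) (sel-noBits-b n (signed w) (signed b))
           (trans (cong reverseᴸ (sel-noBits-w n _ _)) (reverse-down _ n)) ⟩
    D (down (signed b) n ⧺ down (λ j → -1ℤ ⊡ signed w (n ℕ.∸ suc j)) n) ∎
    where
    open ≡-Reasoning
    none : Vec Bool (double n)
    none = noBits

-- Determinants as alternating forms of the columns

-- Laplace expansion along the first coordinate. Passing a column puts its tail into the form and
-- changes the sign, so no column has to be removed from the middle of a list.
lap : ∀ {N} → (List (Vec ℤ N) → ℤ) → List (Vec ℤ (suc N)) → ℤ
lap F []       = 0ℤ
lap F (v ∷ vs) = head v * F (mapᴸ tail vs) - lap (λ ys → F (tail v ∷ ys)) vs

Det : ∀ N → List (Vec ℤ N) → ℤ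
Det zero    []      = 1ℤ
Det zero    (_ ∷ _) = 0ℤ
Det (suc N) vs      = lap (Det N) vs

lap-linear : ∀ {N} (vs : List (Vec ℤ (suc N))) → Linear (λ F → lap F vs)
lap-linear []       = linear-0
lap-linear (v ∷ vs) = record
  { ext   = λ e → cong₂ (λ x y → head v * x - y) (e (mapᴸ tail vs)) (ext l (λ ys → e (tail v ∷ ys)))
  ; plus  = λ F G → trans (cong (λ y → head v * (F (mapᴸ tail vs) + G (mapᴸ tail vs)) - y) (plus l _ _))
                          (e₁ (head v) (F (mapᴸ tail vs)) (G (mapᴸ tail vs)) _ _)
  ; scale = λ u F → trans (cong (λ y → head v * (u * F (mapᴸ tail vs)) - y) (scale l u _))
                          (e₂ (head v) u (F (mapᴸ tail vs)) _)
  }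
  where
  l = lap-linear vs
  e₁ : ∀ h a b c d → h * (a + b) - (c + d) ≡ h * a - c + (h * b - d)
  e₁ = solve-∀
  e₂ : ∀ h u a c → h * (u * a) - u * c ≡ u * (h * a - c)
  e₂ = solve-∀

lap-alternating : ∀ {N} {F : List (Vec ℤ N) → ℤ} → Alternating F → Alternating (lap F)
lap-alternating alt = record
  { additive = add′ alt ; homogeneous = scale′ alt ; alternates = zero′ alt }
  where
  map-tail : ∀ {N} (xs : List (Vec ℤ (suc N))) vs → mapᴸ tail (xs ⧺ vs) ≡ mapᴸ tail xs ⧺ mapᴸ tail vs
  map-tail xs vs = List.map-++ tail xs vs

  add′ : ∀ {N} {F : List (Vec ℤ N) → ℤ} → Alternating F → ∀ xs u v ys →
         lap F (xs ⧺ (u ⊞ v) ∷ ys) ≡ lap F (xs ⧺ u ∷ ys) + lap F (xs ⧺ v ∷ ys)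
  add′ {F = F} alt [] (a ∷ u) (b ∷ v) ys =
    trans (cong (λ z → (a + b) * F (mapᴸ tail ys) - z)
            (trans (ext (lap-linear ys) (additive alt [] u v)) (plus (lap-linear ys) _ _)))
          (e a b (F (mapᴸ tail ys)) _ _)
    where
    e : ∀ a b x y z → (a + b) * x - (y + z) ≡ a * x - y + (b * x - z)
    e = solve-∀
  add′ {F = F} alt (x ∷ xs) u@(_ ∷ _) v@(_ ∷ _) ys
    rewrite map-tail xs ((u ⊞ v) ∷ ys) | map-tail xs (u ∷ ys) | map-tail xs (v ∷ ys)
          | add′ (alternating-∷ alt (tail x)) xs u v ys
          | additive alt (mapᴸ tail xs) (tail u) (tail v) (mapᴸ tail ys) =
    e (head x) (F (mapᴸ tail xs ⧺ tail u ∷ mapᴸ tail ys)) (F (mapᴸ tail xs ⧺ tail v ∷ mapᴸ tail ys)) _ _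
    where
    e : ∀ h a b c d → h * (a + b) - (c + d) ≡ h * a - c + (h * b - d)
    e = solve-∀

  scale′ : ∀ {N} {F : List (Vec ℤ N) → ℤ} → Alternating F → ∀ xs a v ys →
           lap F (xs ⧺ (a ⊡ v) ∷ ys) ≡ a * lap F (xs ⧺ v ∷ ys)
  scale′ {F = F} alt [] a (b ∷ v) ys =
    trans (cong (λ z → a * b * F (mapᴸ tail ys) - z)
            (trans (ext (lap-linear ys) (homogeneous alt [] a v)) (scale (lap-linear ys) a _)))
          (e a b (F (mapᴸ tail ys)) _)
    where
    e : ∀ a b x y → a * b * x - a * y ≡ a * (b * x - y)
    e = solve-∀
  scale′ {F = F} alt (x ∷ xs) a v@(_ ∷ _) ys
    rewrite map-tail xs ((a ⊡ v) ∷ ys) | map-tail xs (v ∷ ys)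
          | scale′ (alternating-∷ alt (tail x)) xs a v ys
          | homogeneous alt (mapᴸ tail xs) a (tail v) (mapᴸ tail ys) =
    e (head x) a (F (mapᴸ tail xs ⧺ tail v ∷ mapᴸ tail ys)) _
    where
    e : ∀ h a x y → h * (a * x) - a * y ≡ a * (h * x - y)
    e = solve-∀

  zero′ : ∀ {N} {F : List (Vec ℤ N) → ℤ} → Alternating F → ∀ xs v ys →
          lap F (xs ⧺ v ∷ v ∷ ys) ≡ 0ℤ
  zero′ {F = F} alt [] v ys =
    trans (cong (λ z → head v * F (tail v ∷ mapᴸ tail ys) - (head v * F (tail v ∷ mapᴸ tail ys) - z))
            (trans (ext (lap-linear ys) (alternates alt [] (tail v))) (null (lap-linear ys))))
          (e (head v * F (tail v ∷ mapᴸ tail ys)))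
    where
    e : ∀ x → x - (x - 0ℤ) ≡ 0ℤ
    e = solve-∀
  zero′ {F = F} alt (x ∷ xs) v ys
    rewrite map-tail xs (v ∷ v ∷ ys)
          | zero′ (alternating-∷ alt (tail x)) xs v ys
          | alternates alt (mapᴸ tail xs) (tail v) (mapᴸ tail ys) = cong (_- 0ℤ) (ℤ.*-zeroʳ (head x))

lap-arity : ∀ {N k} {F : List (Vec ℤ N) → ℤ} → HasArity k F → HasArity (suc k) (lap F)
lap-arity ar [] ne = refl
lap-arity {k = k} {F} ar (v ∷ vs) ne
  rewrite ar (mapᴸ tail vs) (λ e → ne (cong suc (trans (sym (List.length-map tail vs)) e))) =
  cong₂ _-_ (ℤ.*-zeroʳ (head v)) (rest k ar ne)
  where
  rest : ∀ k → HasArity k F → length (v ∷ vs) ≢ suc k → lap (λ ys → F (tail v ∷ ys)) vs ≡ 0ℤ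
  rest zero    ar ne = trans (ext (lap-linear vs) (λ ys → ar (tail v ∷ ys) (λ ()))) (null (lap-linear vs))
  rest (suc k) ar ne = lap-arity (arity-∷ ar (tail v)) vs (ne ∘ cong suc)

Det-alternating : ∀ N → Alternating (Det N)
Det-alternating zero    = record
  { additive    = λ { [] _ _ _ → refl ; (_ ∷ _) _ _ _ → refl }
  ; homogeneous = λ { [] a _ _ → sym (ℤ.*-zeroʳ a) ; (_ ∷ _) a _ _ → sym (ℤ.*-zeroʳ a) }
  ; alternates  = λ { [] _ _ → refl ; (_ ∷ _) _ _ → refl }
  }
Det-alternating (suc N) = lap-alternating (Det-alternating N)

Det-arity : ∀ N → HasArity N (Det N)
Det-arity zero    []       ne = contradiction refl ne
Det-arity zero    (_ ∷ _)  ne = refl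
Det-arity (suc N) vs       ne = lap-arity (Det-arity N) vs ne

lap-tabulate : ∀ {N m} (F : List (Vec ℤ N) → ℤ) (f : Fin (suc m) → Vec ℤ (suc N)) →
  lap F (Data.List.tabulate f) ≡
  sum (λ j → -1ℤ ℤ.^ toℕ j * head (f j) * F (Data.List.tabulate (λ k → tail (f (punchIn j k)))))
lap-tabulate {m = zero}  F f = e (head (f zero)) (F [])
  where
  e : ∀ h x → h * x - 0ℤ ≡ 1ℤ * h * x + 0ℤ
  e = solve-∀
lap-tabulate {m = suc m} F f = begin
  head (f zero) * F (mapᴸ tail (Data.List.tabulate (f ∘ suc))) - lap F′ (Data.List.tabulate (f ∘ suc))
    ≡⟨ cong₂ (λ l z → head (f zero) * F l - z) (List.map-tabulate (f ∘ suc) tail) (lap-tabulate F′ (f ∘ suc)) ⟩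
  head (f zero) * F₀ - sum t
    ≡⟨ cong (λ z → z + - sum t) (cong (_* F₀) (sym (ℤ.*-identityˡ (head (f zero))))) ⟩
  1ℤ * head (f zero) * F₀ + - sum t
    ≡⟨ cong (λ z → 1ℤ * head (f zero) * F₀ + z) (trans (sym (ℤ.-1*i≡-i (sum t))) (trans (*-distribˡ-sum {suc m} -1ℤ t)
         (sum-cong-≗ {suc m} (λ j → e -1ℤ (-1ℤ ℤ.^ toℕ j) (head (f (suc j)))
           (F′ (Data.List.tabulate (λ k → tail (f (suc (punchIn j k)))))))))) ⟩
  sum (λ j → -1ℤ ℤ.^ toℕ j * head (f j) * F (Data.List.tabulate (λ k → tail (f (punchIn j k))))) ∎
  where
  open ≡-Reasoning
  F₀ = F (Data.List.tabulate (λ k → tail (f (suc k))))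
  F′ = λ ys → F (tail (f zero) ∷ ys)
  t : Fin (suc m) → ℤ
  t j = -1ℤ ℤ.^ toℕ j * head (f (suc j)) * F′ (Data.List.tabulate (λ k → tail (f (suc (punchIn j k)))))
  e : ∀ m a b c → m * (a * b * c) ≡ m * a * b * c
  e = solve-∀

columnOf : ∀ {m n} → Matrix m n → Fin n → Vec ℤ m
columnOf A k = tabulate (λ i → A i k)

det-Det : ∀ {n} (A : Matrix n n) → det A ≡ Det n (Data.List.tabulate (columnOf A))
det-Det {zero}  A = refl
det-Det {suc n} A = trans
  (sum-cong-≗ {suc n} (λ j → cong (-1ℤ ℤ.^ toℕ j * A zero j *_) (det-Det (λ i k → A (suc i) (punchIn j k)))))
  (sym (lap-tabulate (Det n) (columnOf A)))

indicator : ℕ → ℕ → ℤ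
indicator i k = if i ℕ.≡ᵇ k then 1ℤ else 0ℤ

indicator-≡ : ∀ i → indicator i i ≡ 1ℤ
indicator-≡ zero    = refl
indicator-≡ (suc i) = indicator-≡ i

indicator-≢ : ∀ i k → i ≢ k → indicator i k ≡ 0ℤ
indicator-≢ i k ne with i ℕ.≡ᵇ k in eq
... | false = refl
... | true  = contradiction (ℕ.≡ᵇ⇒≡ i k (subst T (sym eq) tt)) ne

unit : ∀ {N} → ℕ → Vec ℤ N
unit k = tabulate (λ i → indicator (toℕ i) k)

lookup-unit : ∀ {N} k (i : Fin N) → lookup (unit k) i ≡ indicator (toℕ i) k
lookup-unit k i = Vec.lookup∘tabulate _ i

map-up : ∀ {A B : Set} (g : A → B) f n → mapᴸ g (up f n) ≡ up (g ∘ f) n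
map-up g f zero    = refl
map-up g f (suc n) = cong (g (f 0) ∷_) (map-up g (f ∘ suc) n)

lap-heads-0 : ∀ {N} (F : List (Vec ℤ N) → ℤ) f n → (∀ k → head (f k) ≡ 0ℤ) → lap F (up f n) ≡ 0ℤ
lap-heads-0 F f zero    e = refl
lap-heads-0 F f (suc n) e = cong₂ _-_ (cong (_* F (mapᴸ tail (up (f ∘ suc) n))) (e 0))
  (lap-heads-0 _ (f ∘ suc) n (e ∘ suc))

Det-unit : ∀ N → Det N (up unit N) ≡ 1ℤ
Det-unit zero    = refl
Det-unit (suc N) = cong₂ _-_
  (trans (ℤ.*-identityˡ _) (trans (cong (Det N) (map-up tail (unit ∘ suc) N)) (Det-unit N)))
  (lap-heads-0 {N} (λ ys → Det N (tail (unit {suc N} 0) ∷ ys)) (unit ∘ suc) N (λ k → refl))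

-- Signs of rescaling and reordering

product : (ℕ → ℤ) → ℕ → ℤ
product ρ zero    = 1ℤ
product ρ (suc n) = ρ n * product ρ n

product² : ∀ ρ n → (∀ j → ρ j * ρ j ≡ 1ℤ) → product ρ n * product ρ n ≡ 1ℤ
product² ρ zero    e = refl
product² ρ (suc n) e = trans (r (ρ n) (product ρ n)) (cong₂ _*_ (e n) (product² ρ n e))
  where
  r : ∀ a b → a * b * (a * b) ≡ a * a * (b * b)
  r = solve-∀

alternating-scale : ∀ {N} {D : List (Vec ℤ N) → ℤ} → Alternating D → ∀ ρ x n zs →
  D (down (λ j → ρ j ⊡ x j) n ⧺ zs) ≡ product ρ n * D (down x n ⧺ zs)
alternating-scale alt ρ x zero    zs = sym (ℤ.*-identityˡ _)
alternating-scale {D = D} alt ρ x (suc n) zs =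
  trans (homogeneous alt [] (ρ n) (x n) (down (λ j → ρ j ⊡ x j) n ⧺ zs))
    (trans (cong (ρ n *_) (alternating-scale (alternating-∷ alt (x n)) ρ x n zs))
           (sym (ℤ.*-assoc (ρ n) (product ρ n) (D (x n ∷ down x n ⧺ zs)))))

ε : ℕ → ℤ
ε = product σ

alternating-reverse : ∀ {N} {D : List (Vec ℤ N) → ℤ} → Alternating D → ∀ xs zs →
  D (reverseᴸ xs ⧺ zs) ≡ ε (length xs) * D (xs ⧺ zs)
alternating-reverse alt []       zs = sym (ℤ.*-identityˡ _)
alternating-reverse {D = D} alt (x ∷ xs) zs = begin
  D (reverseᴸ (x ∷ xs) ⧺ zs)
    ≡⟨ cong D (trans (cong (_⧺ zs) (List.unfold-reverse x xs)) (List.++-assoc (reverseᴸ xs) (x ∷ []) zs)) ⟩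
  D (reverseᴸ xs ⧺ x ∷ zs)
    ≡⟨ alternating-move alt x (reverseᴸ xs) zs ⟩
  σ (length (reverseᴸ xs)) * D (x ∷ reverseᴸ xs ⧺ zs)
    ≡⟨ cong₂ (λ l d → σ l * d) (List.length-reverse xs) (alternating-reverse (alternating-∷ alt x) xs zs) ⟩
  σ (length xs) * (ε (length xs) * D (x ∷ xs ⧺ zs))
    ≡⟨ ℤ.*-assoc (σ (length xs)) _ _ ⟨
  ε (length (x ∷ xs)) * D (x ∷ xs ⧺ zs) ∎
  where open ≡-Reasoning

-- The sign of reordering and rescaling the columns; only its being ±1 matters.
κ : ℕ → ℤ
κ n = product σ n * (product (λ j → σ j * σ (ℕ.pred n)) n * ε n)

κ² : ∀ n → κ n * κ n ≡ 1ℤ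
κ² n = trans (e (product σ n) (product (λ j → σ j * σ (ℕ.pred n)) n))
  (cong₂ _*_ p (cong₂ _*_ (product² _ n (λ j → trans (e′ (σ j) (σ (ℕ.pred n))) (cong₂ _*_ (σ² j) (σ² (ℕ.pred n))))) p))
  where
  p = product² σ n σ²
  e : ∀ a b → a * (b * a) * (a * (b * a)) ≡ a * a * (b * b * (a * a))
  e = solve-∀
  e′ : ∀ a b → a * b * (a * b) ≡ a * a * (b * b)
  e′ = solve-∀

-- The factor does not depend on `x` and `y`, so it is the same for the basis vectors and for the
-- columns of the block matrix.
alternating-reorder : ∀ {N} {D : List (Vec ℤ N) → ℤ} → Alternating D → ∀ n x y →
  D (down (λ j → σ j ⊡ x j) n ⧺ down (λ j → (σ j * σ (ℕ.pred n)) ⊡ y j) n) ≡ κ n * D (up x n ⧺ down y n)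
alternating-reorder {D = D} alt n x y = begin
  D (down (λ j → σ j ⊡ x j) n ⧺ down (λ j → ρ j ⊡ y j) n)
    ≡⟨ alternating-scale alt σ x n _ ⟩
  product σ n * D (down x n ⧺ down (λ j → ρ j ⊡ y j) n)
    ≡⟨ cong (product σ n *_) scale-y ⟩
  product σ n * (product ρ n * D (down x n ⧺ down y n))
    ≡⟨ cong (λ z → product σ n * (product ρ n * z)) flip ⟩
  product σ n * (product ρ n * (ε n * D (up x n ⧺ down y n)))
    ≡⟨ e (product σ n) (product ρ n) (D (up x n ⧺ down y n)) ⟩
  κ n * D (up x n ⧺ down y n) ∎
  where
  open ≡-Reasoning
  ρ : ℕ → ℤ
  ρ j = σ j * σ (ℕ.pred n)
  e : ∀ a b d → a * (b * (a * d)) ≡ a * (b * a) * d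
  e = solve-∀
  scale-y : D (down x n ⧺ down (λ j → ρ j ⊡ y j) n) ≡ product ρ n * D (down x n ⧺ down y n)
  scale-y = begin
    D (down x n ⧺ down (λ j → ρ j ⊡ y j) n)
      ≡⟨ cong (λ l → D (down x n ⧺ l)) (List.++-identityʳ (down (λ j → ρ j ⊡ y j) n)) ⟨
    D (down x n ⧺ (down (λ j → ρ j ⊡ y j) n ⧺ []))
      ≡⟨ alternating-scale (alternating-prefix alt (down x n)) ρ y n [] ⟩
    product ρ n * D (down x n ⧺ (down y n ⧺ []))
      ≡⟨ cong (λ l → product ρ n * D (down x n ⧺ l)) (List.++-identityʳ (down y n)) ⟩
    product ρ n * D (down x n ⧺ down y n) ∎
  flip : D (down x n ⧺ down y n) ≡ ε n * D (up x n ⧺ down y n)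
  flip = begin
    D (down x n ⧺ down y n)
      ≡⟨ cong (λ l → D (l ⧺ down y n)) (List.reverse-applyUpTo x n) ⟨
    D (reverseᴸ (up x n) ⧺ down y n)
      ≡⟨ alternating-reverse alt (up x n) (down y n) ⟩
    ε (length (up x n)) * D (up x n ⧺ down y n)
      ≡⟨ cong (λ l → ε l * D (up x n ⧺ down y n)) (List.length-applyUpTo x n) ⟩
    ε n * D (up x n ⧺ down y n) ∎

-- The block matrix

double≡+ : ∀ n → double n ≡ n ℕ.+ n
double≡+ zero    = refl
double≡+ (suc n) = cong suc (trans (cong suc (double≡+ n)) (sym (ℕ.+-suc n n)))

down-cong-< : ∀ {A : Set} n {f g : ℕ → A} → (∀ j → j ℕ.< n → f j ≡ g j) → down f n ≡ down g n
down-cong-< zero    e = refl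
down-cong-< (suc n) e = cong₂ _∷_ (e n ℕ.≤-refl) (down-cong-< n (λ j lt → e j (ℕ.m<n⇒m<1+n lt)))

down-complement : ∀ {A : Set} (g : ℕ → A) n → down (λ j → g (n ℕ.∸ suc j)) n ≡ up g n
down-complement g n = trans (sym (reverse-down g n)) (List.reverse-applyDownFrom g n)

up-+ : ∀ {A : Set} (f : ℕ → A) m n → up f (m ℕ.+ n) ≡ up f m ⧺ up (λ j → f (m ℕ.+ j)) n
up-+ f zero    n = refl
up-+ f (suc m) n = cong (f 0 ∷_) (up-+ (f ∘ suc) m n)

up-tabulate : ∀ {A : Set} (f : ℕ → A) n → up f n ≡ Data.List.tabulate {n = n} (f ∘ toℕ)
up-tabulate f zero    = refl
up-tabulate f (suc n) = cong (f 0 ∷_) (up-tabulate (f ∘ suc) n)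

tabulate-+ : ∀ {A : Set} m n (f : Fin (m ℕ.+ n) → A) →
  Data.List.tabulate f ≡ Data.List.tabulate (f ∘ (_↑ˡ n)) ⧺ Data.List.tabulate (f ∘ (m ↑ʳ_))
tabulate-+ zero    n f = refl
tabulate-+ (suc m) n f = cong (f zero ∷_) (tabulate-+ m n (f ∘ suc))

sum-single : ∀ {M} (f : Fin M → ℤ) j → (∀ k → k ≢ j → f k ≡ 0ℤ) → sum f ≡ f j
sum-single {suc M} f zero    e =
  trans (cong (λ z → f zero + z) (sum-0 {M} _ (λ k → e (suc k) λ ()))) (ℤ.+-identityʳ _)
sum-single {suc M} f (suc j) e = trans (cong₂ _+_ (e zero λ ())
  (sum-single (f ∘ suc) j (λ k ne → e (suc k) (ne ∘ Fin.suc-injective)))) (ℤ.+-identityˡ _)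

if-dec-true : ∀ {A : Set} (a? : Dec A) → A → (if does a? then 1ℤ else 0ℤ) ≡ 1ℤ
if-dec-true a? a rewrite dec-true a? a = refl

if-dec-false : ∀ {A : Set} (a? : Dec A) → ¬ A → (if does a? then 1ℤ else 0ℤ) ≡ 0ℤ
if-dec-false a? ¬a rewrite dec-false a? ¬a = refl

I-indicator : ∀ {n} (i k : Fin n) → I n i k ≡ indicator (toℕ i) (toℕ k)
I-indicator i k with i Fin.≟ k
... | yes refl = sym (indicator-≡ (toℕ i))
... | no ne    = sym (indicator-≢ _ _ (ne ∘ Fin.toℕ-injective))

JSJ : ∀ n (i k : Fin n) → (J n · S n · J n) i k ≡ sᶻ (toℕ (opposite i)) (toℕ (opposite k))
JSJ n i k = begin
  sum {n} (λ l → (J n · S n) i l * J n l k)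
    ≡⟨ sum-single {n} (λ l → (J n · S n) i l * J n l k) (opposite k) (λ l ne →
         trans (cong ((J n · S n) i l *_) (if-dec-false (l Fin.≟ opposite k) ne)) (ℤ.*-zeroʳ ((J n · S n) i l))) ⟩
  (J n · S n) i (opposite k) * J n (opposite k) k
    ≡⟨ trans (cong ((J n · S n) i (opposite k) *_) (if-dec-true (opposite k Fin.≟ opposite k) refl)) (ℤ.*-identityʳ _) ⟩
  sum {n} (λ m → J n i m * S n m (opposite k))
    ≡⟨ sum-single {n} (λ m → J n i m * S n m (opposite k)) (opposite i) (λ m ne →
         cong (_* S n m (opposite k)) (if-dec-false (i Fin.≟ opposite m)
           λ e → ne (trans (sym (Fin.opposite-involutive m)) (cong opposite (sym e))))) ⟩
  J n i (opposite i) * S n (opposite i) (opposite k)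
    ≡⟨ trans (cong (_* S n (opposite i) (opposite k))
               (if-dec-true (i Fin.≟ opposite (opposite i)) (sym (Fin.opposite-involutive i)))) (ℤ.*-identityˡ _) ⟩
  sᶻ (toℕ (opposite i)) (toℕ (opposite k)) ∎
  where open ≡-Reasoning

module _ (n : ℕ) where

  private
    w b x y : ℕ → Vec ℤ (n ℕ.+ n)
    -- The sign yields the block `-I` in the columns `x`, and it cancels the sign of the dual
    -- vectors `b₂`, so that the last block comes out positive.
    w j = -1ℤ ⊡ unit (n ℕ.+ j)
    b j = unit j
    x = column n w b
    y = column n (λ j → unit (n ℕ.∸ suc j)) (λ j → unit (n ℕ.+ (n ℕ.∸ suc j)))
    τ : ℤ
    τ = σ (ℕ.pred n)
    D : List (Vec ℤ (n ℕ.+ n)) → ℤ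
    D = Det (n ℕ.+ n)
    alt = Det-alternating (n ℕ.+ n)
    ar : HasArity (double n) D
    ar = subst (λ k → HasArity k D) (sym (double≡+ n)) (Det-arity (n ℕ.+ n))
    B : Matrix (n ℕ.+ n) (n ℕ.+ n)
    B = block (S n) (I n) (neg (I n)) (J n · S n · J n)

    second-columns : ∀ j →
      signed (column n (λ j → τ ⊡ b (n ℕ.∸ suc j)) (λ j → (- τ) ⊡ w (n ℕ.∸ suc j))) j ≡ (σ j * τ) ⊡ y j
    second-columns j = lookup-ext λ i → begin
      lookup (σ j ⊡ column n w₂ b₂ j) i
        ≡⟨ trans (lookup-⊡ (σ j) (column n w₂ b₂ j) i) (cong (σ j *_) (lookup-column n w₂ b₂ j i)) ⟩
      σ j * (lookup (w₂ j) i + sum {n} (λ k → sᶻ (toℕ k) j * lookup (b₂ (toℕ k)) i))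
        ≡⟨ cong (σ j *_) (cong₂ _+_ (lookup-⊡ τ (u j) i)
             (trans (sum-cong-≗ {n} (λ k → trans (cong (sᶻ (toℕ k) j *_) (lookup-b₂ i (toℕ k)))
                      (e₁ (sᶻ (toℕ k) j) τ (lookup (v (toℕ k)) i))))
                    (sym (*-distribˡ-sum {n} τ (λ k → sᶻ (toℕ k) j * lookup (v (toℕ k)) i))))) ⟩
      σ j * (τ * lookup (u j) i + τ * sum {n} (λ k → sᶻ (toℕ k) j * lookup (v (toℕ k)) i))
        ≡⟨ e₂ (σ j) τ (lookup (u j) i) (sum {n} (λ k → sᶻ (toℕ k) j * lookup (v (toℕ k)) i)) ⟩
      σ j * τ * (lookup (u j) i + sum {n} (λ k → sᶻ (toℕ k) j * lookup (v (toℕ k)) i))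
        ≡⟨ trans (lookup-⊡ (σ j * τ) (y j) i) (cong (σ j * τ *_) (lookup-column n u v j i)) ⟨
      lookup ((σ j * τ) ⊡ y j) i ∎
      where
      open ≡-Reasoning
      u v w₂ b₂ : ℕ → Vec ℤ (n ℕ.+ n)
      u j = unit (n ℕ.∸ suc j)
      v j = unit (n ℕ.+ (n ℕ.∸ suc j))
      w₂ j = τ ⊡ b (n ℕ.∸ suc j)
      b₂ j = (- τ) ⊡ w (n ℕ.∸ suc j)
      lookup-b₂ : ∀ i k → lookup (b₂ k) i ≡ - τ * (-1ℤ * lookup (v k) i)
      lookup-b₂ i k = trans (lookup-⊡ (- τ) (-1ℤ ⊡ v k) i) (cong (- τ *_) (lookup-⊡ -1ℤ (v k) i))
      e₁ : ∀ s t v → s * (- t * (-1ℤ * v)) ≡ t * (s * v)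
      e₁ = solve-∀
      e₂ : ∀ s t a c → s * (t * a + t * c) ≡ s * t * (a + c)
      e₂ = solve-∀

    basis : D (toList (sites n (signed w) (signed b))) ≡ κ n
    basis = begin
      D (toList (sites n (signed w) (signed b)))
        ≡⟨ basis-alternating n alt ar w b ⟩
      D (down (signed unit) n ⧺ down (λ j → -1ℤ ⊡ signed w (n ℕ.∸ suc j)) n)
        ≡⟨ cong (λ l → D (down (signed unit) n ⧺ l)) (down-cong-< n λ j lt → begin
             -1ℤ ⊡ σ (n ℕ.∸ suc j) ⊡ -1ℤ ⊡ v j
               ≡⟨ trans (cong (-1ℤ ⊡_) (⊡-⊡ (σ (n ℕ.∸ suc j)) -1ℤ (v j))) (⊡-⊡ -1ℤ (σ (n ℕ.∸ suc j) * -1ℤ) (v j)) ⟩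
             (-1ℤ * (σ (n ℕ.∸ suc j) * -1ℤ)) ⊡ v j
               ≡⟨ cong (_⊡ v j) (trans (e (σ (n ℕ.∸ suc j))) (sym (σ-complement n j lt))) ⟩
             (σ j * τ) ⊡ v j ∎) ⟩
      D (down (λ j → σ j ⊡ unit j) n ⧺ down (λ j → (σ j * τ) ⊡ v j) n)
        ≡⟨ alternating-reorder alt n unit v ⟩
      κ n * D (up unit n ⧺ down v n)
        ≡⟨ cong (λ l → κ n * D (up unit n ⧺ l)) (down-complement (λ j → unit (n ℕ.+ j)) n) ⟩
      κ n * D (up unit n ⧺ up (λ j → unit (n ℕ.+ j)) n)
        ≡⟨ cong (λ l → κ n * D l) (up-+ unit n n) ⟨
      κ n * D (up unit (n ℕ.+ n))
        ≡⟨ trans (cong (κ n *_) (Det-unit (n ℕ.+ n))) (ℤ.*-identityʳ _) ⟩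
      κ n ∎
      where
      open ≡-Reasoning
      v : ℕ → Vec ℤ (n ℕ.+ n)
      v j = unit (n ℕ.+ (n ℕ.∸ suc j))
      e : ∀ s → -1ℤ * (s * -1ℤ) ≡ s
      e = solve-∀

    on-blocks : ∀ {u v : Vec ℤ (n ℕ.+ n)} → (∀ i → lookup u (i ↑ˡ n) ≡ lookup v (i ↑ˡ n)) →
      (∀ i → lookup u (n ↑ʳ i) ≡ lookup v (n ↑ʳ i)) → u ≡ v
    on-blocks {u} {v} e f = lookup-ext λ i →
      subst (λ i → lookup u i ≡ lookup v i) (Fin.join-splitAt n n i) (go (splitAt n i))
      where
      go : ∀ s → lookup u (join n n s) ≡ lookup v (join n n s)
      go (inj₁ i) = e i
      go (inj₂ i) = f i

    B₁₁ : ∀ i k → B (i ↑ˡ n) (k ↑ˡ n) ≡ sᶻ (toℕ i) (toℕ k)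
    B₁₁ i k rewrite Fin.splitAt-↑ˡ n i n | Fin.splitAt-↑ˡ n k n = refl

    B₁₂ : ∀ i k → B (i ↑ˡ n) (n ↑ʳ k) ≡ I n i k
    B₁₂ i k rewrite Fin.splitAt-↑ˡ n i n | Fin.splitAt-↑ʳ n n k = refl

    B₂₁ : ∀ i k → B (n ↑ʳ i) (k ↑ˡ n) ≡ - I n i k
    B₂₁ i k rewrite Fin.splitAt-↑ʳ n n i | Fin.splitAt-↑ˡ n k n = refl

    B₂₂ : ∀ i k → B (n ↑ʳ i) (n ↑ʳ k) ≡ (J n · S n · J n) i k
    B₂₂ i k rewrite Fin.splitAt-↑ʳ n n i | Fin.splitAt-↑ʳ n n k = refl

    lookup-unitˡ : ∀ k (i : Fin n) → lookup (unit k) (i ↑ˡ n) ≡ indicator (toℕ i) k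
    lookup-unitˡ k i = trans (lookup-unit k (i ↑ˡ n)) (cong (λ m → indicator m k) (Fin.toℕ-↑ˡ i n))

    lookup-unitʳ : ∀ k (i : Fin n) → lookup (unit k) (n ↑ʳ i) ≡ indicator (n ℕ.+ toℕ i) k
    lookup-unitʳ k i = trans (lookup-unit k (n ↑ʳ i)) (cong (λ m → indicator m k) (Fin.toℕ-↑ʳ n i))

    low-high : ∀ (i : Fin n) k → toℕ i ≢ n ℕ.+ k
    low-high i k e = ℕ.<⇒≱ (Fin.toℕ<n i) (ℕ.≤-trans (ℕ.m≤m+n n k) (ℕ.≤-reflexive (sym e)))

    indicator-+ : ∀ m i k → indicator (m ℕ.+ i) (m ℕ.+ k) ≡ indicator i k
    indicator-+ zero    i k = refl
    indicator-+ (suc m) i k = indicator-+ m i k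

    first-block : ∀ k → columnOf B (k ↑ˡ n) ≡ x (toℕ k)
    first-block k = on-blocks upper lower
      where
      open ≡-Reasoning
      upper : ∀ i → lookup (columnOf B (k ↑ˡ n)) (i ↑ˡ n) ≡ lookup (x (toℕ k)) (i ↑ˡ n)
      upper i = sym (begin
        lookup (x (toℕ k)) (i ↑ˡ n)
          ≡⟨ lookup-column n w b (toℕ k) (i ↑ˡ n) ⟩
        lookup (w (toℕ k)) (i ↑ˡ n) + sum {n} (λ m → sᶻ (toℕ m) (toℕ k) * lookup (b (toℕ m)) (i ↑ˡ n))
          ≡⟨ cong₂ _+_ (trans (lookup-⊡ -1ℤ (unit (n ℕ.+ toℕ k)) (i ↑ˡ n)) (cong (-1ℤ *_)
                 (trans (lookup-unitˡ (n ℕ.+ toℕ k) i) (indicator-≢ _ _ (low-high i (toℕ k))))))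
               (trans (sum-cong-≗ {n} (λ m → cong (sᶻ (toℕ m) (toℕ k) *_) (lookup-unitˡ (toℕ m) i)))
                 (sum-single {n} (λ m → sᶻ (toℕ m) (toℕ k) * indicator (toℕ i) (toℕ m)) i (λ m ne → trans
                   (cong (sᶻ (toℕ m) (toℕ k) *_) (indicator-≢ _ _ (λ e → ne (sym (Fin.toℕ-injective e)))))
                   (ℤ.*-zeroʳ (sᶻ (toℕ m) (toℕ k)))))) ⟩
        0ℤ + sᶻ (toℕ i) (toℕ k) * indicator (toℕ i) (toℕ i)
          ≡⟨ trans (ℤ.+-identityˡ _) (trans (cong (sᶻ (toℕ i) (toℕ k) *_) (indicator-≡ (toℕ i))) (ℤ.*-identityʳ _)) ⟩
        sᶻ (toℕ i) (toℕ k)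
          ≡⟨ trans (Vec.lookup∘tabulate _ (i ↑ˡ n)) (B₁₁ i k) ⟨
        lookup (columnOf B (k ↑ˡ n)) (i ↑ˡ n) ∎)
      lower : ∀ i → lookup (columnOf B (k ↑ˡ n)) (n ↑ʳ i) ≡ lookup (x (toℕ k)) (n ↑ʳ i)
      lower i = sym (begin
        lookup (x (toℕ k)) (n ↑ʳ i)
          ≡⟨ lookup-column n w b (toℕ k) (n ↑ʳ i) ⟩
        lookup (w (toℕ k)) (n ↑ʳ i) + sum {n} (λ m → sᶻ (toℕ m) (toℕ k) * lookup (b (toℕ m)) (n ↑ʳ i))
          ≡⟨ cong₂ _+_ (trans (lookup-⊡ -1ℤ (unit (n ℕ.+ toℕ k)) (n ↑ʳ i)) (cong (-1ℤ *_)
                 (trans (lookup-unitʳ (n ℕ.+ toℕ k) i) (trans (indicator-+ n (toℕ i) (toℕ k)) (sym (I-indicator i k))))))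
               (sum-0 {n} _ (λ m → trans (cong (sᶻ (toℕ m) (toℕ k) *_)
                 (trans (lookup-unitʳ (toℕ m) i) (indicator-≢ _ _ (low-high m (toℕ i) ∘ sym))))
                 (ℤ.*-zeroʳ (sᶻ (toℕ m) (toℕ k))))) ⟩
        -1ℤ * I n i k + 0ℤ
          ≡⟨ trans (ℤ.+-identityʳ _) (ℤ.-1*i≡-i (I n i k)) ⟩
        - I n i k
          ≡⟨ trans (Vec.lookup∘tabulate _ (n ↑ʳ i)) (B₂₁ i k) ⟨
        lookup (columnOf B (k ↑ˡ n)) (n ↑ʳ i) ∎)

    complement : ∀ (i : Fin n) → n ℕ.∸ suc (toℕ (opposite i)) ≡ toℕ i
    complement i = trans (sym (Fin.opposite-prop (opposite i))) (cong toℕ (Fin.opposite-involutive i))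

    -- Conjugation by `J` reverses rows and columns. The vectors in `y` run backwards through the
    -- basis, which accounts for the rows; listing `y` downwards accounts for the columns.
    second-block : ∀ k → columnOf B (n ↑ʳ k) ≡ y (n ℕ.∸ suc (toℕ k))
    second-block k = trans (on-blocks upper lower) (cong y (Fin.opposite-prop k))
      where
      open ≡-Reasoning
      j = toℕ (opposite k)
      u v : ℕ → Vec ℤ (n ℕ.+ n)
      u j = unit (n ℕ.∸ suc j)
      v j = unit (n ℕ.+ (n ℕ.∸ suc j))
      upper : ∀ i → lookup (columnOf B (n ↑ʳ k)) (i ↑ˡ n) ≡ lookup (y j) (i ↑ˡ n)
      upper i = sym (begin
        lookup (y j) (i ↑ˡ n)
          ≡⟨ lookup-column n u v j (i ↑ˡ n) ⟩
        lookup (u j) (i ↑ˡ n) + sum {n} (λ m → sᶻ (toℕ m) j * lookup (v (toℕ m)) (i ↑ˡ n))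
          ≡⟨ cong₂ _+_ (trans (lookup-unitˡ (n ℕ.∸ suc j) i)
                 (trans (cong (indicator (toℕ i)) (complement k)) (sym (I-indicator i k))))
               (sum-0 {n} _ (λ m → trans (cong (sᶻ (toℕ m) j *_)
                 (trans (lookup-unitˡ (n ℕ.+ (n ℕ.∸ suc (toℕ m))) i)
                   (indicator-≢ _ _ (low-high i (n ℕ.∸ suc (toℕ m))))))
                 (ℤ.*-zeroʳ (sᶻ (toℕ m) j)))) ⟩
        I n i k + 0ℤ
          ≡⟨ ℤ.+-identityʳ _ ⟩
        I n i k
          ≡⟨ trans (Vec.lookup∘tabulate _ (i ↑ˡ n)) (B₁₂ i k) ⟨
        lookup (columnOf B (n ↑ʳ k)) (i ↑ˡ n) ∎)
      lower : ∀ i → lookup (columnOf B (n ↑ʳ k)) (n ↑ʳ i) ≡ lookup (y j) (n ↑ʳ i)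
      lower i = sym (begin
        lookup (y j) (n ↑ʳ i)
          ≡⟨ lookup-column n u v j (n ↑ʳ i) ⟩
        lookup (u j) (n ↑ʳ i) + sum {n} (λ m → sᶻ (toℕ m) j * lookup (v (toℕ m)) (n ↑ʳ i))
          ≡⟨ cong₂ _+_ (trans (lookup-unitʳ (n ℕ.∸ suc j) i)
                 (trans (cong (indicator (n ℕ.+ toℕ i)) (complement k)) (indicator-≢ _ _ (low-high k (toℕ i) ∘ sym))))
               (trans (sum-cong-≗ {n} (λ m → cong (sᶻ (toℕ m) j *_) (trans
                   (lookup-unitʳ (n ℕ.+ (n ℕ.∸ suc (toℕ m))) i)
                   (trans (indicator-+ n (toℕ i) (n ℕ.∸ suc (toℕ m))) (cong (indicator (toℕ i)) (sym (Fin.opposite-prop m)))))))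
                 (sum-single {n} (λ m → sᶻ (toℕ m) j * indicator (toℕ i) (toℕ (opposite m))) (opposite i)
                   (λ m ne → trans (cong (sᶻ (toℕ m) j *_) (indicator-≢ _ _ (λ e → ne
                       (trans (sym (Fin.opposite-involutive m)) (cong opposite (sym (Fin.toℕ-injective e)))))))
                     (ℤ.*-zeroʳ (sᶻ (toℕ m) j))))) ⟩
        0ℤ + sᶻ (toℕ (opposite i)) j * indicator (toℕ i) (toℕ (opposite (opposite i)))
          ≡⟨ trans (ℤ.+-identityˡ _) (trans (cong (sᶻ (toℕ (opposite i)) j *_)
               (trans (cong (indicator (toℕ i) ∘ toℕ) (Fin.opposite-involutive i)) (indicator-≡ (toℕ i)))) (ℤ.*-identityʳ _)) ⟩
        sᶻ (toℕ (opposite i)) j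
          ≡⟨ trans (Vec.lookup∘tabulate _ (n ↑ʳ i)) (trans (B₂₂ i k) (JSJ n i k)) ⟨
        lookup (columnOf B (n ↑ʳ k)) (n ↑ʳ i) ∎)

    columns : D (up x n ⧺ down y n) ≡ det B
    columns = sym (begin
      det B
        ≡⟨ det-Det B ⟩
      D (Data.List.tabulate (columnOf B))
        ≡⟨ cong D (tabulate-+ n n (columnOf B)) ⟩
      D (Data.List.tabulate (columnOf B ∘ (_↑ˡ n)) ⧺ Data.List.tabulate (columnOf B ∘ (n ↑ʳ_)))
        ≡⟨ cong₂ (λ l r → D (l ⧺ r))
             (trans (List.tabulate-cong first-block) (sym (up-tabulate x n)))
             (trans (List.tabulate-cong second-block)
               (sym (trans (down-up y n) (up-tabulate (λ j → y (n ℕ.∸ suc j)) n)))) ⟩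
      D (up x n ⧺ down y n) ∎)
      where open ≡-Reasoning

  -- The form takes the value `κ n` on all sites, and `κ n` is also the factor relating the signed
  -- columns to those of `B`. Since `κ n` squares to one, it cancels.
  lowerSum-det : lowerSum n (upperSum n) ≡ det B
  lowerSum-det = begin
    total                  ≡⟨ cancel total ⟩
    κ n * (κ n * total)        ≡⟨ cong (λ z → κ n * (z * total)) basis ⟨
    κ n * (D (toList (sites n (signed w) (signed b))) * total)
      ≡⟨ cong (κ n *_) (total-alternating n alt ar w b) ⟩
    κ n * D (down (signed x) n ⧺ down (signed (column n (λ j → τ ⊡ b (n ℕ.∸ suc j)) (λ j → (- τ) ⊡ w (n ℕ.∸ suc j)))) n)
      ≡⟨ cong (λ l → κ n * D (down (signed x) n ⧺ l)) (down-cong-< n (λ j _ → second-columns j)) ⟩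
    κ n * D (down (signed x) n ⧺ down (λ j → (σ j * τ) ⊡ y j) n)
      ≡⟨ cong (κ n *_) (alternating-reorder alt n x y) ⟩
    κ n * (κ n * D (up x n ⧺ down y n))
      ≡⟨ cancel (D (up x n ⧺ down y n)) ⟨
    D (up x n ⧺ down y n)  ≡⟨ columns ⟩
    det B                  ∎
    where
    open ≡-Reasoning
    total = lowerSum n (upperSum n)
    cancel : ∀ z → z ≡ κ n * (κ n * z)
    cancel z = sym (trans (sym (ℤ.*-assoc (κ n) (κ n) z)) (trans (cong (_* z) (κ² n)) (ℤ.*-identityˡ z)))

theorem5p7 : ∀ (n : ℕ) → 1 ≤ n →
    ∃[ k ] (tilings n HasCardinality k) ×
    (+ k ≡ det (block (S n) (I n) (neg (I n)) (J n · S n · J n)))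
theorem5p7 n _ =
  let (k , i , eq) = count-tilings n in k , i , trans eq (lowerSum-det n)
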